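{- There is an absolute constant $c$ such that the following holds. If for some integer $k\ge 2$ and some $\varepsilon>0$ the problem Local-$k$-LCS on $k$ strings of length $n$ over an alphabet of size at most $c$ can be solved in $O(n^{k-\varepsilon})$ time, then the Strong Exponential Time Hypothesis (SETH) is false.
   Context: Local-$k$-LCS problem: given $k$ strings of length $n$ over an alphabet $\Sigma$ and an integer $L$, output the length of the longest sequence $X$ such that there are $k$ substrings (contiguous) of length $L$, one of each input string, for which $X$ is a common subsequence of all these $k$ substrings. SETH: for every $\varepsilon>0$ there is an integer $q>3$ such that $q$-SAT on $n$ variables cannot be solved in $2^{(1-\varepsilon)n}$ time. -}

module Defs where

open import Data.Bool using (Bool; if_then_else_)
open import Data.Fin using (Fin; toℕ)
open import Data.Integer using (∣_∣)
open import Data.List using (List; []; _∷_; length; map; concatMap)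
open import Data.List.Relation.Binary.Infix.Heterogeneous using (Infix)
open import Data.List.Relation.Binary.Sublist.Propositional using (_⊆_)
open import Data.List.Relation.Unary.All using (All)
open import Data.List.Relation.Unary.Any using (Any)
open import Data.List.Relation.Unary.Unique.Propositional using (Unique)
open import Data.Nat using (ℕ; zero; suc; _+_; _*_; _∸_; _/_; _^_; _≤_; _>_; _≟_)
open import Data.Nat.Logarithm using (⌊log₂_⌋)
open import Data.Product using (Σ-syntax; ∃-syntax; _×_; _,_)
open import Data.Rational using (ℚ; 0ℚ; ↥_; ↧ₙ_) renaming (_<_ to _<ℚ_)
open import Data.Sum using (_⊎_)
open import Data.Vec using (Vec; lookup; toList)
open import Relation.Binary.PropositionalEquality using (_≡_; _≢_)
open import Relation.Nullary using (¬_; does)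

-- Random-access machine.
--
-- Programs are structured (while/if instead of jumps), which changes running
-- times by a constant factor only.  Each step is charged the bit length of the
-- numbers and addresses it handles (logarithmic cost), so words may be
-- unbounded, and running times agree with those of a word RAM with
-- logarithmic word size up to polylogarithmic factors.  A program may name any
-- registers but, being finite, uses only a constant number of them.

Reg : Set
Reg = ℕ

data Op : Set where
  add sub mul div : Op

⟦_⟧ : Op → ℕ → ℕ → ℕ
⟦ add ⟧ a b       = a + b
⟦ sub ⟧ a b       = a ∸ b
⟦ mul ⟧ a b       = a * b
⟦ div ⟧ a zero    = 0
⟦ div ⟧ a (suc b) = a / suc b

infixr 5 _⨾_

data Program : Set where
  skip   : Program
  const  : (x : Reg) (c : ℕ) → Program
  op     : (x : Reg) (f : Op) (y z : Reg) → Program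
  load   : (x y : Reg) → Program          -- x := memory[y]
  store  : (x y : Reg) → Program          -- memory[x] := y
  _⨾_    : Program → Program → Program
  if≢0   : Reg → Program → Program → Program
  while≢0 : Reg → Program → Program

record State : Set where
  constructor ⟨_,_⟩
  field
    register : Reg → ℕ
    memory   : ℕ → ℕ

open State public

update : (ℕ → ℕ) → ℕ → ℕ → (ℕ → ℕ)
update f i v j = if does (i ≟ j) then v else f j

setRegister : State → Reg → ℕ → State
setRegister s x v = ⟨ update (register s) x v , memory s ⟩

setMemory : State → ℕ → ℕ → State
setMemory s i v = ⟨ register s , update (memory s) i v ⟩

bits : ℕ → ℕ
bits v = suc ⌊log₂ v ⌋

-- p ∶ s ⇓ s′ [ t ]: started in s, the program p halts in s′ after time t.
infix 4 _∶_⇓_[_]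

data _∶_⇓_[_] : Program → State → State → ℕ → Set where
  skip : ∀ {s} → skip ∶ s ⇓ s [ 1 ]
  const : ∀ {s x c} →
    const x c ∶ s ⇓ setRegister s x c [ bits c ]
  op : ∀ {s x f y z} →
    let a = register s y ; b = register s z ; r = ⟦ f ⟧ a b in
    op x f y z ∶ s ⇓ setRegister s x r [ bits a + bits b + bits r ]
  load : ∀ {s x y} →
    let i = register s y ; v = memory s i in
    load x y ∶ s ⇓ setRegister s x v [ bits i + bits v ]
  store : ∀ {s x y} →
    let i = register s x ; v = register s y in
    store x y ∶ s ⇓ setMemory s i v [ bits i + bits v ]
  seq : ∀ {p q s s′ s″ t u} →
    p ∶ s ⇓ s′ [ t ] → q ∶ s′ ⇓ s″ [ u ] →
    p ⨾ q ∶ s ⇓ s″ [ t + u ]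
  if-true : ∀ {x p q s s′ t} → register s x ≢ 0 →
    p ∶ s ⇓ s′ [ t ] →
    if≢0 x p q ∶ s ⇓ s′ [ bits (register s x) + t ]
  if-false : ∀ {x p q s s′ t} → register s x ≡ 0 →
    q ∶ s ⇓ s′ [ t ] →
    if≢0 x p q ∶ s ⇓ s′ [ bits (register s x) + t ]
  while-true : ∀ {x p s s′ s″ t u} → register s x ≢ 0 →
    p ∶ s ⇓ s′ [ t ] → while≢0 x p ∶ s′ ⇓ s″ [ u ] →
    while≢0 x p ∶ s ⇓ s″ [ bits (register s x) + (t + u) ]
  while-false : ∀ {x p s} → register s x ≡ 0 →
    while≢0 x p ∶ s ⇓ s [ bits (register s x) ]

-- The input occupies the memory cells 0, 1, 2, …; everything else is zero.
contents : List ℕ → ℕ → ℕ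
contents []       _       = 0
contents (v ∷ vs) zero    = v
contents (v ∷ vs) (suc i) = contents vs i

initial : List ℕ → State
initial vs = ⟨ (λ _ → 0) , contents vs ⟩

output : State → ℕ
output s = register s 0

record Problem : Set₁ where
  field
    Instance : Set
    size     : Instance → ℕ           -- the parameter n of the time bound
    encode   : Instance → List ℕ
    Answer   : Instance → ℕ → Set     -- the admissible outputs

-- A time bound f is given by the relation  B C n t ⇔ t ≤ C · f n.
TimeBound : Set₁
TimeBound = (C n t : ℕ) → Set

-- Solvable in time O(f), by a single program for all instances.
_SolvableInO_ : Problem → TimeBound → Set
P SolvableInO B =
  ∃[ p ] ∃[ C ] ∃[ n₀ ] ((x : Instance) →
    ∃[ s ] ∃[ t ] (p ∶ initial (encode x) ⇓ s [ t ])
                × Answer x (output s)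
                × (n₀ ≤ size x → B C (size x) t))
  where open Problem P

-- Rational exponents suffice below: in "for some ε > 0 solvable in time …" and
-- "for every ε > 0 not solvable in time …", ε may be decreased.

-- With ε = a / b, for n ≥ 1:  t ≤ C · n ^ (k - a / b)  iff
-- t ^ b · n ^ a ≤ C ^ b · n ^ (k · b).
n^[_-_] : ℕ → ℚ → TimeBound
n^[ k - ε ] C n t =
  t ^ ↧ₙ ε * n ^ ∣ ↥ ε ∣ ≤ C ^ ↧ₙ ε * n ^ (k * ↧ₙ ε)

-- With ε = a / b:  t ≤ C · 2 ^ ((1 - a / b) · n)  iff
-- t ^ b · 2 ^ (a · n) ≤ C ^ b · 2 ^ (b · n).
2^[1-_]n : ℚ → TimeBound
2^[1- ε ]n C n t =
  t ^ ↧ₙ ε * 2 ^ (∣ ↥ ε ∣ * n) ≤ C ^ ↧ₙ ε * 2 ^ (↧ₙ ε * n)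

Literal : ℕ → Set
Literal n = Bool × Fin n

Clause : ℕ → Set
Clause n = List (Literal n)

Satisfies : ∀ {n} → (Fin n → Bool) → List (Clause n) → Set
Satisfies α φ = All (Any (λ (b , i) → α i ≡ b)) φ

Satisfiable : ∀ {n} → List (Clause n) → Set
Satisfiable φ = ∃[ α ] Satisfies α φ

-- Clauses are not repeated, so that the length of a formula is polynomial in
-- its number of variables; otherwise no bound in terms of n alone could hold,
-- as the time to read the formula would be unbounded.
record CNF (q : ℕ) : Set where
  field
    n        : ℕ
    clauses  : List (Clause n)
    width    : All (λ c → length c ≤ q) clauses
    distinct : Unique clauses

encodeLiteral : ∀ {n} → Literal n → ℕ
encodeLiteral (b , i) = (if b then 1 else 0) + 2 * toℕ i

encodeClause : ∀ {n} → Clause n → List ℕ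
encodeClause c = length c ∷ map encodeLiteral c

SAT : ℕ → Problem
SAT q = record
  { Instance = CNF q
  ; size     = CNF.n
  ; encode   = λ φ → let open CNF φ in
                 n ∷ length clauses ∷ concatMap encodeClause clauses
  ; Answer   = λ φ r → let open CNF φ in
                 (Satisfiable clauses × r ≡ 1) ⊎ (¬ Satisfiable clauses × r ≡ 0)
  }

SETH : Set
SETH = (ε : ℚ) → 0ℚ <ℚ ε →
       Σ[ q ∈ ℕ ] q > 3 × ¬ (SAT q SolvableInO 2^[1- ε ]n)

Substring : {A : Set} → List A → List A → Set
Substring = Infix _≡_

-- L ≤ n since otherwise there are no substrings of length L.
record LocalLCSInstance (k σ : ℕ) : Set where
  field
    n       : ℕ
    strings : Vec (Vec (Fin σ) n) k
    L       : ℕ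
    L≤n     : L ≤ n

LocallyCommon : ∀ {k σ} → LocalLCSInstance k σ → List (Fin σ) → Set
LocallyCommon x X =
  ∀ i → ∃[ Y ] Substring Y (toList (lookup strings i)) × length Y ≡ L × X ⊆ Y
  where open LocalLCSInstance x

-- Local-k-LCS over the alphabet Fin σ.
LocalLCS : (k σ : ℕ) → Problem
LocalLCS k σ = record
  { Instance = LocalLCSInstance k σ
  ; size     = LocalLCSInstance.n
  ; encode   = λ x → let open LocalLCSInstance x in
                 n ∷ L ∷ concatMap (λ v → map toℕ (toList v)) (toList strings)
  ; Answer   = λ x r →
                 (∃[ X ] LocallyCommon x X × length X ≡ r)
               × (∀ X → LocallyCommon x X → length X ≤ r)
  }

{-# OPTIONS --safe #-}
module Submission where

-- The variables of a q-CNF formula with n variables and m clauses are split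
-- into k groups of H = n/k + 1, and string i has one block for each of the
-- N = 2 ^ H assignments to group i.  A block is a run of pads followed by one
-- gadget per clause, all gadgets together having the window length L; the run
-- is so long that a window meets the gadgets of one block only, and since the
-- pads of string 0 occur in no other string, choosing k windows amounts to
-- choosing k partial assignments.  The k gadgets of a clause have a common
-- subsequence of length k + 1 exactly if one of the k partial assignments
-- makes the clause true, and they never have a longer one.  So the formula is
-- satisfiable exactly if the Local-k-LCS is at least m (k + 1).
--
-- The strings have length N times a polynomial in n, as m is polynomial in n
-- for distinct clauses.  A program computes them from the formula, packed into
-- a single number.  Hence time O(n ^ (k - a / b)) for Local-k-LCS gives time
-- O(2 ^ ((1 - 1 / (2 b k)) n)) for q-SAT, whatever q is.

-- The alphabet must not grow with `k`, so a clause cannot have a letter of its own for each string.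
-- Instead, the string whose assignment makes the clause true is recorded by the position of a
-- single `1` among `k - 1` zeros. Five letters suffice: `0`, `1`, a separator and two pads.
--
-- The denominator `2 b k` arises as follows. Since `N ^ k` is `2 ^ n` up to a factor `2 ^ k`,
-- saving a factor `N ^ (1 / b)` means saving `2 ^ (n / (b k))`; half of this pays for all
-- polynomial factors, the other half is left. Writing the strings costs about `2 ^ (n / k)`, which
-- is harmless as `k ≥ 2`.
--
-- The formula and the instance handed to the Local-k-LCS program both start at cell 0, and each of
-- the `k N` blocks reads the whole formula again. So the formula has to leave the memory before the
-- first string is written, which is why it is packed into a register; under logarithmic cost a
-- register of polynomially many bits slows down each step by a polynomial factor only. The
-- Local-k-LCS program must also find every register that it names, and every cell behind its input,
-- equal to zero.

open import Defs
open import Data.Bool using (Bool; true; false; if_then_else_)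
open import Data.Fin using (Fin; toℕ; fromℕ<)
open import Data.Fin.Patterns
open import Data.Fin.Properties using (toℕ<n; toℕ-injective; fromℕ<-toℕ; toℕ-fromℕ<; fromℕ<-injective; injective⇒≤)
import Data.Integer as ℤ
open import Data.Integer.Properties using (∣i∣≡0⇒i≡0)
open import Data.List as List using (List; []; _∷_; _++_; length; map; concatMap; replicate)
open import Data.List.Membership.Propositional.Properties using (∈-lookup)
open import Data.List.Properties using (length-++; length-replicate; length-map; map-++; ++-assoc; map-injective)
open import Data.List.Relation.Binary.Infix.Heterogeneous using (Infix; here; there; _++ⁱ_; _ⁱ++_)
open import Data.List.Relation.Binary.Prefix.Heterogeneous using (Prefix; []; _∷_)
open import Data.List.Relation.Binary.Sublist.Propositional using (_⊆_; []; _∷_; _∷ʳ_; ⊆-refl; ⊆-trans; minimum)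
open import Data.List.Relation.Binary.Sublist.Propositional.Properties using (++⁺; ++⁺ˡ; All-resp-⊆; length-mono-≤)
open import Data.List.Relation.Unary.All as All using (All; []; _∷_)
open import Data.List.Relation.Unary.All.Properties using () renaming (++⁺ to All-++⁺; ++⁻ʳ to All-++⁻ʳ; ++⁻ˡ to All-++⁻ˡ; replicate⁺ to All-replicate⁺)
open import Data.List.Relation.Unary.AllPairs using ([]; _∷_)
open import Data.List.Relation.Unary.Any as Any using (Any; here; there)
open import Data.List.Relation.Unary.Unique.Propositional using (Unique)
open import Data.Nat using (ℕ; zero; suc; pred; _+_; _*_; _∸_; _/_; _%_; _^_; _⊔_; _≤_; _<_; _≡ᵇ_; _<ᵇ_; _≤?_; _<?_; z≤n; s≤s; ≤-pred; NonZero; >-nonZero)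
open import Data.Nat.Coprimality using (1-coprimeTo)
open import Data.Nat.DivMod using (m<n⇒m/n≡0; +-distrib-/-∣ʳ; m*n/n≡m; m/n≤m; m/n*n≤m; m%n<n; m≡m%n+[m/n]*n; m%n≡m∸m/n*n; m<n*o⇒m/o<n)
open import Data.Nat.Divisibility using (divides)
open import Data.Nat.Logarithm using (⌊log₂⌋-mono-≤; ⌊log₂[2^n]⌋≡n)
open import Data.Nat.Properties hiding (≤-pred)
open import Data.Nat.Solver using (module +-*-Solver)
open import Data.Product using (∃-syntax; _×_; _,_; proj₁; proj₂)
open import Data.Rational using (ℚ; 0ℚ; mkℚ; ↥_) renaming (_<_ to _<ℚ_)
open import Data.Rational.Properties using (positive⁻¹; ↥p≡0⇒p≡0) renaming (<-irrefl to <ℚ-irrefl)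
open import Data.Sum as Sum using (_⊎_; inj₁; inj₂)
open import Data.Vec as Vec using (Vec; toList; fromList; tabulate; cast)
open import Data.Vec.Properties using (lookup∘tabulate; toList-cast; toList∘fromList)
open import Function using (_∘_)
open import Relation.Binary.Definitions using (tri<; tri≈; tri>)
open import Relation.Binary.PropositionalEquality
open import Relation.Nullary using (¬_; Dec; yes; no; contradiction)

-- Executions and their cost

-- does (i ≟ j) unfolds to i ≡ᵇ j, so case distinctions must be made on the latter.
data SameCell (i : ℕ) : ℕ → Bool → Set where
  same  : SameCell i i true
  other : ∀ {j} → i ≢ j → SameCell i j false

same? : ∀ i j → SameCell i j (i ≡ᵇ j)
same? i j with i ≡ᵇ j | ≡ᵇ⇒≡ i j | ≡⇒≡ᵇ i j
... | true  | i≡j | _   with refl ← i≡j _ = same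
... | false | _   | i≢j = other i≢j

update-same : ∀ f i v → update f i v i ≡ v
update-same f i v with i ≡ᵇ i | same? i i
... | _ | same      = refl
... | _ | other i≢i = contradiction refl i≢i

update-other : ∀ f {i j} v → i ≢ j → update f i v j ≡ f j
update-other f {i} {j} v i≢j with i ≡ᵇ j | same? i j
... | _ | same    = contradiction refl i≢j
... | _ | other _ = refl

update-cong : ∀ {f g : ℕ → ℕ} {i i′ v v′} → (∀ j → f j ≡ g j) → i ≡ i′ → v ≡ v′ →
              ∀ j → update f i v j ≡ update g i′ v′ j
update-cong {i = i} f≗g refl refl j with i ≡ᵇ j
... | true  = refl
... | false = f≗g j

update-≤ : ∀ {b} f i {v} → v ≤ b → (∀ j → f j ≤ b) → ∀ j → update f i v j ≤ b
update-≤ f i v≤b f≤b j with i ≡ᵇ j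
... | true  = v≤b
... | false = f≤b j

update-restrict : ∀ {f g : ℕ → ℕ} {R} i {v v′} → (∀ j → j < R → f j ≡ g j) → v ≡ v′ →
                  ∀ j → j < R → update f i v j ≡ update g i v′ j
update-restrict i f≗g refl j j<R with i ≡ᵇ j
... | true  = refl
... | false = f≗g j j<R

retime : ∀ {p s s′ t t′} → t ≡ t′ → p ∶ s ⇓ s′ [ t ] → p ∶ s ⇓ s′ [ t′ ]
retime refl d = d

-- Independence of the registers that a program does not name

data Uses< (R : ℕ) : Program → Set where
  skip    : Uses< R skip
  const   : ∀ {x c} → x < R → Uses< R (const x c)
  op      : ∀ {x f y z} → x < R → y < R → z < R → Uses< R (op x f y z)
  load    : ∀ {x y} → x < R → y < R → Uses< R (load x y)
  store   : ∀ {x y} → x < R → y < R → Uses< R (store x y)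
  _⨾_     : ∀ {p q} → Uses< R p → Uses< R q → Uses< R (p ⨾ q)
  if≢0    : ∀ {x p q} → x < R → Uses< R p → Uses< R q → Uses< R (if≢0 x p q)
  while≢0 : ∀ {x p} → x < R → Uses< R p → Uses< R (while≢0 x p)

uses-mono : ∀ {R S p} → R ≤ S → Uses< R p → Uses< S p
uses-mono le skip         = skip
uses-mono le (const x)    = const (<-≤-trans x le)
uses-mono le (op x y z)   = op (<-≤-trans x le) (<-≤-trans y le) (<-≤-trans z le)
uses-mono le (load x y)   = load (<-≤-trans x le) (<-≤-trans y le)
uses-mono le (store x y)  = store (<-≤-trans x le) (<-≤-trans y le)
uses-mono le (u ⨾ v)      = uses-mono le u ⨾ uses-mono le v
uses-mono le (if≢0 x u v) = if≢0 (<-≤-trans x le) (uses-mono le u) (uses-mono le v)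
uses-mono le (while≢0 x u) = while≢0 (<-≤-trans x le) (uses-mono le u)

uses-some : ∀ p → ∃[ R ] Uses< R p
uses-some skip = 0 , skip
uses-some (const x c) = suc x , const ≤-refl
uses-some (op x f y z) = suc (x ⊔ (y ⊔ z)) ,
  op (s≤s (m≤m⊔n x _))
     (s≤s (≤-trans (m≤m⊔n y z) (m≤n⊔m x _)))
     (s≤s (≤-trans (m≤n⊔m y z) (m≤n⊔m x _)))
uses-some (load x y) = suc (x ⊔ y) , load (s≤s (m≤m⊔n x y)) (s≤s (m≤n⊔m x y))
uses-some (store x y) = suc (x ⊔ y) , store (s≤s (m≤m⊔n x y)) (s≤s (m≤n⊔m x y))
uses-some (p ⨾ q) with uses-some p | uses-some q
... | R , u | S , v = R ⊔ S , (uses-mono (m≤m⊔n R S) u ⨾ uses-mono (m≤n⊔m R S) v)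
uses-some (if≢0 x p q) with uses-some p | uses-some q
... | R , u | S , v = suc x ⊔ (R ⊔ S) ,
  if≢0 (m≤m⊔n (suc x) (R ⊔ S))
       (uses-mono (≤-trans (m≤m⊔n R S) (m≤n⊔m (suc x) _)) u)
       (uses-mono (≤-trans (m≤n⊔m R S) (m≤n⊔m (suc x) _)) v)
uses-some (while≢0 x p) with uses-some p
... | R , u = suc x ⊔ R , while≢0 (m≤m⊔n (suc x) R) (uses-mono (m≤n⊔m (suc x) R) u)

-- States consist of functions, so they are compared pointwise. Registers from `R` on are left free:
-- there the solver keeps the threshold while the Local-k-LCS program runs.
record Agree (R : ℕ) (s u : State) : Set where
  constructor agree
  field
    sameRegisters : ∀ i → i < R → register s i ≡ register u i
    sameCells     : ∀ i → memory s i ≡ memory u i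
open Agree

SameAbove : ℕ → State → State → Set
SameAbove R s u = ∀ i → R ≤ i → register s i ≡ register u i

above-set : ∀ {R} u {x v} → x < R → SameAbove R u (setRegister u x v)
above-set u {v = v} x<R i R≤i =
  sym (update-other (register u) v (<⇒≢ (<-≤-trans x<R R≤i)))

-- Each rule touches only registers named in the program, so the derivation can be replayed rule by
-- rule; the charges coincide because the numbers handled do. The component `SameAbove` is what
-- preserves the threshold.
frame : ∀ {R p s s′ u t} → Uses< R p → Agree R s u → p ∶ s ⇓ s′ [ t ] →
        ∃[ u′ ] (p ∶ u ⇓ u′ [ t ]) × Agree R s′ u′ × SameAbove R u u′
frame {u = u} skip a skip = u , skip , a , λ _ _ → refl
frame {u = u} (const {x} x<R) a const =
  _ , const , agree (update-restrict x (sameRegisters a) refl) (sameCells a) , above-set u x<R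
frame {u = u} (op {x} {f} x<R y<R z<R) a op =
  _ , retime (sym (cong₂ (λ m n → bits m + bits n + bits (⟦ f ⟧ m n)) ey ez)) op ,
  agree (update-restrict x (sameRegisters a) (cong₂ ⟦ f ⟧ ey ez)) (sameCells a) , above-set u x<R
  where
    ey = sameRegisters a _ y<R
    ez = sameRegisters a _ z<R
frame {s = s} {u = u} (load {x} {y} x<R y<R) a load =
  _ , retime (sym (cong₂ (λ m n → bits m + bits n) ey ev)) load ,
  agree (update-restrict x (sameRegisters a) ev) (sameCells a) , above-set u x<R
  where
    ey = sameRegisters a _ y<R
    ev = trans (sameCells a _) (cong (memory u) ey)
frame (store x<R y<R) a store =
  _ , retime (sym (cong₂ (λ m n → bits m + bits n) ex ey)) store ,
  agree (sameRegisters a) (update-cong (sameCells a) ex ey) , λ _ _ → refl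
  where
    ex = sameRegisters a _ x<R
    ey = sameRegisters a _ y<R
frame (up ⨾ uq) a (seq d e) with frame up a d
... | _ , d′ , a′ , k with frame uq a′ e
... | _ , e′ , a″ , l = _ , seq d′ e′ , a″ , λ i R≤i → trans (k i R≤i) (l i R≤i)
frame (if≢0 {x} x<R up uq) a (if-true nz d) with frame up a d
... | _ , d′ , a′ , k =
  _ , retime (cong (λ v → bits v + _) (sym (sameRegisters a x x<R)))
        (if-true (nz ∘ trans (sameRegisters a x x<R)) d′) , a′ , k
frame (if≢0 {x} x<R up uq) a (if-false z d) with frame uq a d
... | _ , d′ , a′ , k =
  _ , retime (cong (λ v → bits v + _) (sym (sameRegisters a x x<R)))
        (if-false (trans (sym (sameRegisters a x x<R)) z) d′) , a′ , k
frame (while≢0 {x} x<R up) a (while-true nz d e) with frame up a d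
... | _ , d′ , a′ , k with frame (while≢0 x<R up) a′ e
... | _ , e′ , a″ , l =
  _ , retime (cong (λ v → bits v + _) (sym (sameRegisters a x x<R)))
        (while-true (nz ∘ trans (sameRegisters a x x<R)) d′ e′) ,
  a″ , λ i R≤i → trans (k i R≤i) (l i R≤i)
frame (while≢0 {x} x<R up) a (while-false z) =
  _ , retime (cong bits (sym (sameRegisters a x x<R)))
        (while-false (trans (sym (sameRegisters a x x<R)) z)) , a , λ _ _ → refl

-- A configuration lists the registers 0, 1, …; those not listed are zero.
Config : Set
Config = List ℕ × (ℕ → ℕ)

infix 4 _≃_
_≃_ : State → Config → Set
s ≃ (vs , M) = (∀ i → register s i ≡ contents vs i) × (∀ i → memory s i ≡ M i)

infix 4 _⊢_⟶_⟨_⟩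
-- Total correctness: a run exists from every state that the configuration describes. Time is only
-- bounded above, so that all iterations of a loop can share one bound.
record _⊢_⟶_⟨_⟩ (p : Program) (c d : Config) (t : ℕ) : Set where
  constructor triple
  field
    run : ∀ {s} → s ≃ c → ∃[ s′ ] ∃[ t′ ] (p ∶ s ⇓ s′ [ t′ ]) × s′ ≃ d × t′ ≤ t
open _⊢_⟶_⟨_⟩ public

⟶-seq : ∀ {p q c d e t u} → p ⊢ c ⟶ d ⟨ t ⟩ → q ⊢ d ⟶ e ⟨ u ⟩ → p ⨾ q ⊢ c ⟶ e ⟨ t + u ⟩
⟶-seq P Q .run s≃c with run P s≃c
... | _ , _ , d , s′≃d , le with run Q s′≃d
... | _ , _ , e , s″≃e , le′ = _ , _ , seq d e , s″≃e , +-mono-≤ le le′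

⟶-weaken : ∀ {p c d t u} → t ≤ u → p ⊢ c ⟶ d ⟨ t ⟩ → p ⊢ c ⟶ d ⟨ u ⟩
⟶-weaken t≤u P .run s≃c with run P s≃c
... | _ , _ , d , s′≃d , le = _ , _ , d , s′≃d , ≤-trans le t≤u

⟶-post : ∀ {p c vs vs′ M M′ t} → p ⊢ c ⟶ (vs , M) ⟨ t ⟩ → vs ≡ vs′ → (∀ i → M i ≡ M′ i) →
         p ⊢ c ⟶ (vs′ , M′) ⟨ t ⟩
⟶-post P refl eq .run s≃c with run P s≃c
... | _ , _ , d , (r , m) , le = _ , _ , d , (r , λ i → trans (m i) (eq i)) , le

⟶-skip : ∀ {c} → skip ⊢ c ⟶ c ⟨ 1 ⟩
⟶-skip .run s≃c = _ , _ , skip , s≃c , ≤-refl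

⟶-stop : ∀ {x p vs M} → contents vs x ≡ 0 → while≢0 x p ⊢ (vs , M) ⟶ (vs , M) ⟨ 1 ⟩
⟶-stop {x} eq .run (r , m) =
  _ , _ , while-false (trans (r x) eq) , (r , m) , ≤-reflexive (cong bits (trans (r x) eq))

⟶-iterate : ∀ {x p vs M d e t u} w → bits (contents vs x) ≤ w → contents vs x ≢ 0 →
            p ⊢ (vs , M) ⟶ d ⟨ t ⟩ → while≢0 x p ⊢ d ⟶ e ⟨ u ⟩ →
            while≢0 x p ⊢ (vs , M) ⟶ e ⟨ w + (t + u) ⟩
⟶-iterate {x} w bw nz P Q .run (r , m) with run P (r , m)
... | _ , _ , d , s′≃d , le with run Q s′≃d
... | _ , _ , e , s″≃e , le′ =
  _ , _ , while-true (nz ∘ trans (sym (r x))) d e , s″≃e ,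
  +-mono-≤ (≤-trans (≤-reflexive (cong bits (r x))) bw) (+-mono-≤ le le′)

-- Straight-line code is kept as a list of instructions so that `exec` computes its effect on a
-- configuration; most of the state changes below then hold by reduction.
data Instr : Set where
  const : (x : Reg) (c : ℕ) → Instr
  op    : (x : Reg) (f : Op) (y z : Reg) → Instr
  load  : (x y : Reg) → Instr
  store : (x y : Reg) → Instr

⌜_⌝ : Instr → Program
⌜ const x c ⌝  = const x c
⌜ op x f y z ⌝ = op x f y z
⌜ load x y ⌝   = load x y
⌜ store x y ⌝  = store x y

block : List Instr → Program
block []       = skip
block (i ∷ is) = ⌜ i ⌝ ⨾ block is

set : List ℕ → ℕ → ℕ → List ℕ
set []       zero    v = v ∷ []
set []       (suc x) v = 0 ∷ set [] x v
set (_ ∷ vs) zero    v = v ∷ vs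
set (u ∷ vs) (suc x) v = u ∷ set vs x v

step : Instr → Config → Config
step (const x c)  (vs , M) = set vs x c , M
step (op x f y z) (vs , M) = set vs x (⟦ f ⟧ (contents vs y) (contents vs z)) , M
step (load x y)   (vs , M) = set vs x (M (contents vs y)) , M
step (store x y)  (vs , M) = vs , update M (contents vs x) (contents vs y)

exec : List Instr → Config → Config
exec []       c = c
exec (i ∷ is) c = exec is (step i c)

update-suc : ∀ f i v j → update f (suc i) v (suc j) ≡ update (f ∘ suc) i v j
update-suc f i v j with i ≡ᵇ j
... | true  = refl
... | false = refl

contents-set : ∀ vs x v i → update (contents vs) x v i ≡ contents (set vs x v) i
contents-set []       zero    v zero    = refl
contents-set []       zero    v (suc i) = refl
contents-set []       (suc x) v zero    = refl
contents-set []       (suc x) v (suc i) = trans (update-suc (contents []) x v i) (contents-set [] x v i)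
contents-set (u ∷ vs) zero    v zero    = refl
contents-set (u ∷ vs) zero    v (suc i) = refl
contents-set (u ∷ vs) (suc x) v zero    = refl
contents-set (u ∷ vs) (suc x) v (suc i) = trans (update-suc (contents (u ∷ vs)) x v i) (contents-set vs x v i)

Bounded : ℕ → Config → Set
Bounded w (vs , M) = All (_≤ 2 ^ w) vs × (∀ i → M i ≤ 2 ^ w)

bits-≤ : ∀ {v w} → v ≤ 2 ^ w → bits v ≤ suc w
bits-≤ {v} {w} le = s≤s (≤-trans (⌊log₂⌋-mono-≤ le) (≤-reflexive (⌊log₂[2^n]⌋≡n w)))

n≤2^n : ∀ n → n ≤ 2 ^ n
n≤2^n zero    = z≤n
n≤2^n (suc n) = +-mono-≤ (m^n>0 2 n) (≤-trans (n≤2^n n) (≤-reflexive (sym (+-identityʳ _))))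

contents-≤ : ∀ {b vs} → All (_≤ b) vs → ∀ i → contents vs i ≤ b
contents-≤ []         i       = z≤n
contents-≤ (v≤b ∷ _)  zero    = v≤b
contents-≤ (_ ∷ vs≤b) (suc i) = contents-≤ vs≤b i

set-≤ : ∀ {b vs} → All (_≤ b) vs → ∀ x {v} → v ≤ b → All (_≤ b) (set vs x v)
set-≤ []           zero    v≤b = v≤b ∷ []
set-≤ []           (suc x) v≤b = z≤n ∷ set-≤ [] x v≤b
set-≤ (_ ∷ vs≤b)   zero    v≤b = v≤b ∷ vs≤b
set-≤ (u≤b ∷ vs≤b) (suc x) v≤b = u≤b ∷ set-≤ vs≤b x v≤b

-- The factor by which the exponent in `Bounded` may grow. For a constant, `c ≤ 2 ^ c` is enough;
-- for an operation, a product doubles the exponent.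
growth : Instr → ℕ
growth (const x c)  = suc c
growth (op x f y z) = 2
growth (load x y)   = 1
growth (store x y)  = 1

growth>0 : ∀ i → 1 ≤ growth i
growth>0 (const x c)  = s≤s z≤n
growth>0 (op x f y z) = s≤s z≤n
growth>0 (load x y)   = s≤s z≤n
growth>0 (store x y)  = s≤s z≤n

charge : Instr → ℕ
charge (const x c)  = suc c
charge (op x f y z) = 7
charge (load x y)   = 4
charge (store x y)  = 4

2^-mono : ∀ {m n} → m ≤ n → 2 ^ m ≤ 2 ^ n
2^-mono = ^-monoʳ-≤ 2

op-≤ : ∀ f {a b w} → 1 ≤ w → a ≤ 2 ^ w → b ≤ 2 ^ w → ⟦ f ⟧ a b ≤ 2 ^ (2 * w)
op-≤ add {a} {b} {w} 1≤w a≤ b≤ = begin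
  a + b             ≤⟨ +-mono-≤ a≤ b≤ ⟩
  2 ^ w + 2 ^ w     ≡⟨ cong (2 ^ w +_) (sym (+-identityʳ _)) ⟩
  2 ^ suc w         ≤⟨ 2^-mono (+-monoˡ-≤ w 1≤w) ⟩
  2 ^ (w + w)       ≡⟨ cong (λ z → 2 ^ (w + z)) (sym (+-identityʳ w)) ⟩
  2 ^ (2 * w)       ∎ where open ≤-Reasoning
op-≤ sub {a} {b} {w} _ a≤ _ = ≤-trans (m∸n≤m a b) (≤-trans a≤ (2^-mono (m≤m+n w _)))
op-≤ mul {a} {b} {w} _ a≤ b≤ = begin
  a * b             ≤⟨ *-mono-≤ a≤ b≤ ⟩
  2 ^ w * 2 ^ w     ≡⟨ sym (^-distribˡ-+-* 2 w w) ⟩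
  2 ^ (w + w)       ≡⟨ cong (λ z → 2 ^ (w + z)) (sym (+-identityʳ w)) ⟩
  2 ^ (2 * w)       ∎ where open ≤-Reasoning
op-≤ div {b = zero} _ _ _ = z≤n
op-≤ div {a} {suc b} {w} _ a≤ _ = ≤-trans (m/n≤m a (suc b)) (≤-trans a≤ (2^-mono (m≤m+n w _)))

step-bounded : ∀ i {w c} → 1 ≤ w → Bounded w c → Bounded (growth i * w) (step i c)
step-bounded (const x c) {suc w} _ (vs≤ , M≤) =
  set-≤ (All.map up vs≤) x
    (≤-trans (n≤2^n c) (2^-mono (≤-trans (n≤1+n c) (m≤m*n (suc c) (suc w))))) , up ∘ M≤
  where
    up : ∀ {v} → v ≤ 2 ^ suc w → v ≤ 2 ^ (suc c * suc w)
    up v≤ = ≤-trans v≤ (2^-mono (m≤m+n (suc w) (c * suc w)))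
step-bounded (op x f y z) {w} 1≤w (vs≤ , M≤) =
  set-≤ (All.map up vs≤) x
    (op-≤ f 1≤w (contents-≤ vs≤ y) (contents-≤ vs≤ z)) , up ∘ M≤
  where
    up : ∀ {v} → v ≤ 2 ^ w → v ≤ 2 ^ (2 * w)
    up v≤ = ≤-trans v≤ (2^-mono (m≤m+n w _))
step-bounded (load x y) {w} _ (vs≤ , M≤) rewrite +-identityʳ w = set-≤ vs≤ x (M≤ _) , M≤
step-bounded (store x y) {w} {vs , M} _ (vs≤ , M≤) rewrite +-identityʳ w =
  vs≤ , update-≤ M (contents vs x) (contents-≤ vs≤ y) M≤

charge-op : ∀ {w b₁ b₂ b₃} → 1 ≤ w → b₁ ≤ suc w → b₂ ≤ suc w → b₃ ≤ suc (2 * w) → b₁ + b₂ + b₃ ≤ 7 * w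
charge-op {w} {b₁} {b₂} {b₃} 1≤w p q r = begin
  b₁ + b₂ + b₃                         ≤⟨ +-mono-≤ (+-mono-≤ p q) r ⟩
  (1 + w) + (1 + w) + (1 + 2 * w)      ≤⟨ +-mono-≤ (+-mono-≤ 1+w 1+w) (+-monoˡ-≤ (2 * w) 1≤w) ⟩
  (w + w) + (w + w) + (w + 2 * w)      ≡⟨ solve 1 (λ x → (x :+ x) :+ (x :+ x) :+ (x :+ con 2 :* x) := con 7 :* x) refl w ⟩
  7 * w                                ∎
  where
    open ≤-Reasoning
    open +-*-Solver
    1+w = +-monoˡ-≤ w 1≤w

charge-mem : ∀ {w b₁ b₂} → 1 ≤ w → b₁ ≤ suc w → b₂ ≤ suc w → b₁ + b₂ ≤ 4 * w
charge-mem {w} {b₁} {b₂} 1≤w p q = begin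
  b₁ + b₂             ≤⟨ +-mono-≤ p q ⟩
  (1 + w) + (1 + w)   ≤⟨ +-mono-≤ 1+w 1+w ⟩
  (w + w) + (w + w)   ≡⟨ solve 1 (λ x → (x :+ x) :+ (x :+ x) := con 4 :* x) refl w ⟩
  4 * w               ∎
  where
    open ≤-Reasoning
    open +-*-Solver
    1+w = +-monoˡ-≤ w 1≤w

⟶-step : ∀ i {w c} → 1 ≤ w → Bounded w c → ⌜ i ⌝ ⊢ c ⟶ step i c ⟨ charge i * w ⟩
⟶-step (const x c) {suc w} {vs , M} _ _ .run (r , m) =
  _ , _ , const , ((λ i → trans (update-cong {i = x} r refl refl i) (contents-set vs x c i)) , m) ,
  ≤-trans (bits-≤ (n≤2^n c)) (m≤m*n (suc c) (suc w))
⟶-step (op x f y z) {w} {vs , M} 1≤w (vs≤ , M≤) .run (r , m) =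
  _ , _ , op ,
  ((λ i → trans (update-cong {i = x} r refl (cong₂ ⟦ f ⟧ (r y) (r z)) i) (contents-set vs x _ i)) , m) ,
  charge-op 1≤w (bits-≤ (y≤ y)) (bits-≤ (y≤ z)) (bits-≤ (op-≤ f 1≤w (y≤ y) (y≤ z)))
  where
    y≤ : ∀ i → _
    y≤ i = ≤-trans (≤-reflexive (r i)) (contents-≤ vs≤ i)
⟶-step (load x y) {w} {vs , M} 1≤w (vs≤ , M≤) .run (r , m) =
  _ , _ , load ,
  ((λ i → trans (update-cong {i = x} r refl (trans (m _) (cong M (r y))) i) (contents-set vs x _ i)) , m) ,
  charge-mem 1≤w (bits-≤ (≤-trans (≤-reflexive (r y)) (contents-≤ vs≤ y)))
    (bits-≤ (≤-trans (≤-reflexive (m _)) (M≤ _)))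
⟶-step (store x y) {w} {vs , M} 1≤w (vs≤ , M≤) .run (r , m) =
  _ , _ , store , (r , update-cong m (r x) (r y)) ,
  charge-mem 1≤w (bits-≤ (≤-trans (≤-reflexive (r x)) (contents-≤ vs≤ x)))
    (bits-≤ (≤-trans (≤-reflexive (r y)) (contents-≤ vs≤ y)))

-- Each instruction multiplies the bit length of the state by a constant at
-- most, so the time of a loop-free block is linear in that bit length.
opaque
  factor : List Instr → ℕ
  factor []       = 1
  factor (i ∷ is) = charge i + factor is * growth i

opaque
  unfolding factor

  ⟶-block : ∀ is {w c} → 1 ≤ w → Bounded w c → block is ⊢ c ⟶ exec is c ⟨ factor is * w ⟩
  ⟶-block [] {w} 1≤w _ = ⟶-weaken (≤-trans 1≤w (≤-reflexive (sym (+-identityʳ w)))) ⟶-skip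
  ⟶-block (i ∷ is) {w} 1≤w b = ⟶-weaken (≤-reflexive eq)
    (⟶-seq (⟶-step i 1≤w b)
           (⟶-block is (≤-trans 1≤w (m≤n*m w (growth i) ⦃ >-nonZero (growth>0 i) ⦄))
                       (step-bounded i 1≤w b)))
    where
      eq : charge i * w + factor is * (growth i * w) ≡ factor (i ∷ is) * w
      eq = solve 4 (λ c f g w → c :* w :+ f :* (g :* w) := (c :+ f :* g) :* w) refl
             (charge i) (factor is) (growth i) w
        where open +-*-Solver

-- Gadgets

Letter : Set
Letter = Fin 5

pattern $ = 2F

-- String 0 has other pads than the rest, so no common subsequence has a pad.
pad : ℕ → Letter
pad zero    = 3F
pad (suc _) = 4F

-- What a mark supplies if the clause is made true: in string 0 the zero that completes `K` zeros
-- behind the `1`, in a later string `i` the only `1` between the `i`-th zero and the next.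
hit : ℕ → Letter
hit zero    = 0F
hit (suc _) = 1F

mark : ℕ → Bool → Letter
mark i b = if b then hit i else pad i

10s 01s : ℕ → List Letter
10s zero    = []
10s (suc n) = 1F ∷ 0F ∷ 10s n
01s zero    = []
01s (suc n) = 0F ∷ 1F ∷ 01s n

0s : ℕ → List Letter
0s n = replicate n 0F

-- The gadget of a clause in string i of the strings 0, …, K.  The common
-- subsequences word K j, one for each string j, are the only ones of length
-- K + 1; string i lacks word K i exactly if its mark is a pad.
before after : ℕ → ℕ → List Letter
before K zero    = 0s K ++ 1F ∷ []
before K (suc i) = 10s (suc i)
after  K zero    = 0s (K ∸ 1)
after  K (suc i) = 01s (K ∸ suc i)

core gadget : ℕ → ℕ → Bool → List Letter
core   K i b = before K i ++ mark i b ∷ after K i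
gadget K i b = core K i b ++ $ ∷ []

word : ℕ → ℕ → List Letter
word K j = 0s j ++ 1F ∷ 0s (K ∸ j)

-- Counting letters

weight : (Letter → ℕ) → List Letter → ℕ
weight f []       = 0
weight f (x ∷ xs) = f x + weight f xs

weight-++ : ∀ f xs ys → weight f (xs ++ ys) ≡ weight f xs + weight f ys
weight-++ f []       ys = refl
weight-++ f (x ∷ xs) ys = trans (cong (f x +_) (weight-++ f xs ys)) (sym (+-assoc (f x) _ _))

weight-⊆ : ∀ f {xs ys} → xs ⊆ ys → weight f xs ≤ weight f ys
weight-⊆ f []              = z≤n
weight-⊆ f (y ∷ʳ xs⊆ys)    = ≤-trans (weight-⊆ f xs⊆ys) (m≤n+m _ (f y))
weight-⊆ f (_∷_ {x = x} refl xs⊆ys) = +-monoʳ-≤ (f x) (weight-⊆ f xs⊆ys)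

is0 is1 is$ : Letter → ℕ
is0 0F = 1
is0 _  = 0
is1 1F = 1
is1 _  = 0
is$ $  = 1
is$ _  = 0

#0 #1 #$ : List Letter → ℕ
#0 = weight is0
#1 = weight is1
#$ = weight is$

Unpadded : Letter → Set
Unpadded x = x ≢ 3F × x ≢ 4F

≢pad : ∀ i {x} → Unpadded x → x ≢ pad i
≢pad zero    = proj₁
≢pad (suc _) = proj₂

length-unpadded : ∀ {xs} → All Unpadded xs → length xs ≡ #0 xs + #1 xs + #$ xs
length-unpadded []                    = refl
length-unpadded {0F ∷ xs} (_ ∷ us)    = cong suc (length-unpadded us)
length-unpadded {1F ∷ xs} (_ ∷ us)    = trans (cong suc (length-unpadded us)) (cong (_+ #$ xs) (sym (+-suc (#0 xs) (#1 xs))))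
length-unpadded {$ ∷ xs}  (_ ∷ us)    = trans (cong suc (length-unpadded us)) (sym (+-suc (#0 xs + #1 xs) (#$ xs)))
length-unpadded {3F ∷ xs} ((u , _) ∷ _) = contradiction refl u
length-unpadded {4F ∷ xs} ((_ , u) ∷ _) = contradiction refl u

#0-0s : ∀ n → #0 (0s n) ≡ n
#0-0s zero    = refl
#0-0s (suc n) = cong suc (#0-0s n)

#1-0s : ∀ n → #1 (0s n) ≡ 0
#1-0s zero    = refl
#1-0s (suc n) = #1-0s n

#$-0s : ∀ n → #$ (0s n) ≡ 0
#$-0s zero    = refl
#$-0s (suc n) = #$-0s n

#0-10s : ∀ n → #0 (10s n) ≡ n
#0-10s zero    = refl
#0-10s (suc n) = cong suc (#0-10s n)

#0-01s : ∀ n → #0 (01s n) ≡ n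
#0-01s zero    = refl
#0-01s (suc n) = cong suc (#0-01s n)

#$-10s : ∀ n → #$ (10s n) ≡ 0
#$-10s zero    = refl
#$-10s (suc n) = #$-10s n

#$-01s : ∀ n → #$ (01s n) ≡ 0
#$-01s zero    = refl
#$-01s (suc n) = #$-01s n

#0-word : ∀ a b → #0 (0s a ++ 1F ∷ 0s b) ≡ a + b
#0-word a b = trans (weight-++ is0 (0s a) (1F ∷ 0s b)) (cong₂ _+_ (#0-0s a) (#0-0s b))

#$-mark : ∀ i b → is$ (mark i b) ≡ 0
#$-mark zero    true  = refl
#$-mark zero    false = refl
#$-mark (suc i) true  = refl
#$-mark (suc i) false = refl

#$-before : ∀ K i → #$ (before K i) ≡ 0
#$-before K zero    = trans (weight-++ is$ (0s K) _) (trans (+-identityʳ _) (#$-0s K))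
#$-before K (suc i) = #$-10s (suc i)

#$-after : ∀ K i → #$ (after K i) ≡ 0
#$-after K zero    = #$-0s (K ∸ 1)
#$-after K (suc i) = #$-01s (K ∸ suc i)

#$-core : ∀ K i b → #$ (core K i b) ≡ 0
#$-core K i b = trans (weight-++ is$ (before K i) _)
  (cong₂ _+_ (#$-before K i) (cong₂ _+_ (#$-mark i b) (#$-after K i)))

#1-core-zero : ∀ K b → #1 (core K 0 b) ≡ 1
#1-core-zero K b = trans (cong #1 (++-assoc (0s K) _ _)) (trans (weight-++ is1 (0s K) _)
  (cong₂ _+_ (#1-0s K) (cong suc (trans (cong (_+ #1 (0s (K ∸ 1))) (z b)) (#1-0s (K ∸ 1))))))
  where
    z : ∀ b → is1 (mark 0 b) ≡ 0
    z true  = refl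
    z false = refl

#0-core-one : ∀ K b → #0 (core (suc K) 1 b) ≡ suc K
#0-core-one K true  = cong suc (#0-01s K)
#0-core-one K false = cong suc (#0-01s K)

skip-⊆ : ∀ {A : Set} {x y : A} {xs ys} → x ≢ y → x ∷ xs ⊆ y ∷ ys → x ∷ xs ⊆ ys
skip-⊆ x≢y (_ ∷ʳ τ)  = τ
skip-⊆ x≢y (x≡y ∷ _) = contradiction x≡y x≢y

drop-pads : ∀ {A : Set} {p : A} {xs} n {ys} → All (_≢ p) xs → xs ⊆ replicate n p ++ ys → xs ⊆ ys
drop-pads zero    _        τ        = τ
drop-pads (suc n) xs≢p     (_ ∷ʳ τ) = drop-pads n xs≢p τ
drop-pads (suc n) (x≢p ∷ _) (x≡p ∷ _) = contradiction x≡p x≢p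

drop-pads-end : ∀ {A : Set} {p : A} {xs} ys n → All (_≢ p) xs → xs ⊆ ys ++ replicate n p → xs ⊆ ys
drop-pads-end {xs = []}     ys       n _    τ = minimum ys
drop-pads-end {xs = x ∷ xs} []       (suc n) xs≢p (_ ∷ʳ τ) = drop-pads-end [] n xs≢p τ
drop-pads-end {xs = x ∷ xs} []       (suc n) (x≢p ∷ _) (x≡p ∷ _) = contradiction x≡p x≢p
drop-pads-end {xs = x ∷ xs} (y ∷ ys) n xs≢p (_ ∷ʳ τ) = y ∷ʳ drop-pads-end ys n xs≢p τ
drop-pads-end {xs = x ∷ xs} (y ∷ ys) n (_ ∷ xs≢p) (refl ∷ τ) = refl ∷ drop-pads-end ys n xs≢p τ

drop-pad : ∀ {A : Set} {p : A} {xs} us {vs} → All (_≢ p) xs → xs ⊆ us ++ p ∷ vs → xs ⊆ us ++ vs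
drop-pad []       xs≢p       (_ ∷ʳ τ)     = τ
drop-pad []       (x≢p ∷ _)  (x≡p ∷ _)    = contradiction x≡p x≢p
drop-pad (u ∷ us) xs≢p       (_ ∷ʳ τ)     = u ∷ʳ drop-pad us xs≢p τ
drop-pad (u ∷ us) (_ ∷ xs≢p) (refl ∷ τ)   = refl ∷ drop-pad us xs≢p τ

⊆-0s : ∀ {xs} n → xs ⊆ 0s n → xs ≡ 0s (length xs) × length xs ≤ n
⊆-0s zero    []         = refl , z≤n
⊆-0s (suc n) (_ ∷ʳ τ)   with ⊆-0s n τ
... | eq , le = eq , ≤-trans le (n≤1+n n)
⊆-0s (suc n) (refl ∷ τ) with ⊆-0s n τ
... | eq , le = cong (0F ∷_) eq , s≤s le

⊆-0s10s : ∀ {xs} m n → xs ⊆ 0s m ++ 1F ∷ 0s n →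
          (∃[ a ] xs ≡ 0s a) ⊎ ∃[ a ] ∃[ b ] b ≤ n × xs ≡ 0s a ++ 1F ∷ 0s b
⊆-0s10s zero    n (_ ∷ʳ τ)   = inj₁ (_ , proj₁ (⊆-0s n τ))
⊆-0s10s zero    n (refl ∷ τ) = inj₂ (0 , _ , proj₂ (⊆-0s n τ) , cong (1F ∷_) (proj₁ (⊆-0s n τ)))
⊆-0s10s (suc m) n (_ ∷ʳ τ)   = ⊆-0s10s m n τ
⊆-0s10s (suc m) n (refl ∷ τ) with ⊆-0s10s m n τ
... | inj₁ (a , eq)          = inj₁ (suc a , cong (0F ∷_) eq)
... | inj₂ (a , b , le , eq) = inj₂ (suc a , b , le , cong (0F ∷_) eq)

too-many-0s : ∀ {xs ys} → xs ⊆ ys → ¬ #0 ys < #0 xs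
too-many-0s τ lt = <⇒≱ lt (weight-⊆ is0 τ)

-- There are only `i + d` zeros on the right, so the word must use all of them. Its `1` would have
-- to lie between the `i`-th zero and the next, where no `1` stands.
word-missing : ∀ i d → ¬ 0s i ++ 1F ∷ 0s d ⊆ 10s i ++ 01s d
word-missing zero (suc d) (_ ∷ʳ _ ∷ʳ τ)   = too-many-0s τ
  (subst₂ _<_ (sym (#0-01s d)) (sym (cong suc (#0-0s d))) ≤-refl)
word-missing zero (suc d) (_ ∷ʳ (_ ∷ τ)) = too-many-0s τ
  (subst₂ _<_ (sym (#0-01s d)) (sym (cong suc (#0-0s d))) ≤-refl)
word-missing (suc i) d (_ ∷ʳ (_ ∷ τ))     = word-missing i d τ
word-missing (suc i) d (_ ∷ʳ (_ ∷ʳ τ))    = too-many-0s τ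
  (subst₂ _<_ (sym (trans (weight-++ is0 (10s i) _) (cong₂ _+_ (#0-10s i) (#0-01s d))))
              (sym (cong suc (#0-word i d))) ≤-refl)

find-true : ∀ (b : Bool) {A : Set} → (b ≡ false → A) → (b ≡ true → A) → A
find-true false f t = f refl
find-true true  f t = t refl

-- String 1 has exactly `K` zeros and string 0 a single `1`, so the length `K + 1` forces `xs` to be
-- `word K j` for some `j`; and string `j` contains that word only with its mark.
core-sound : ∀ K (b : ℕ → Bool) {xs} → 1 ≤ K → All Unpadded xs → (∀ i → i ≤ K → xs ⊆ core K i (b i)) →
             suc K ≤ length xs → ∃[ i ] i ≤ K × b i ≡ true
core-sound (suc K) b {xs} _ us xs⊆ len = main
  where
    C = suc K
    #0≤ : #0 xs ≤ C
    #0≤ = ≤-trans (weight-⊆ is0 (xs⊆ 1 (s≤s z≤n))) (≤-reflexive (#0-core-one K (b 1)))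
    -- Deleting a pad mark only shortens string 0, so this holds for either mark and leaves two
    -- possible shapes of `xs`.
    zero-good : xs ⊆ 0s C ++ 1F ∷ 0s C
    zero-good = go (b 0) (subst (xs ⊆_) (++-assoc (0s C) _ _) (xs⊆ 0 z≤n))
      where
        go : ∀ c → xs ⊆ 0s C ++ 1F ∷ mark 0 c ∷ 0s K → xs ⊆ 0s C ++ 1F ∷ 0s C
        go true  τ = τ
        go false τ = ⊆-trans (subst (xs ⊆_) (++-assoc (0s C) _ _)
            (drop-pad (0s C ++ 1F ∷ []) (All.map (≢pad 0) us) (subst (xs ⊆_) (sym (++-assoc (0s C) _ _)) τ)))
            (++⁺ (⊆-refl {x = 0s C}) (refl ∷ (0F ∷ʳ ⊆-refl)))
    zero-bad : b 0 ≡ false → xs ⊆ 0s C ++ 1F ∷ 0s K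
    zero-bad eq = subst (xs ⊆_) (++-assoc (0s C) _ _)
        (drop-pad (0s C ++ 1F ∷ []) (All.map (≢pad 0) us)
          (subst (λ c → xs ⊆ core C 0 c) eq (xs⊆ 0 z≤n)))
    word-of : ∀ {a e} → xs ≡ 0s a ++ 1F ∷ 0s e → a + e ≡ C
    word-of {a} {e} refl = ≤-antisym (≤-trans (≤-reflexive (sym (#0-word a e))) #0≤)
      (≤-pred (≤-trans len (≤-reflexive (trans (length-++ (0s a))
         (trans (cong₂ (λ u v → u + suc v) (length-replicate a) (length-replicate e)) (+-suc a e))))))
    pick : ∀ a e → xs ≡ 0s a ++ 1F ∷ 0s e → ∃[ i ] i ≤ C × b i ≡ true
    -- With a pad as its mark, string 0 has only `C - 1` zeros behind its `1`, while `word C 0`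
    -- needs `C`.
    pick zero e eq = find-true (b 0)
      (λ b0 → contradiction (zero-bad b0) (λ τ → too-many (subst (_⊆ _) eq τ)))
      (λ b0 → 0 , z≤n , b0)
      where
        too-many : ¬ 1F ∷ 0s e ⊆ 0s C ++ 1F ∷ 0s K
        too-many τ = 1+n≰n (≤-trans (≤-reflexive (sym (trans (#0-0s e) (word-of {0} eq)))) (≤-trans (weight-⊆ is0 (tl (0s C) (all-0s C) τ)) (≤-reflexive (#0-0s K))))
          where
            all-0s : ∀ n → All (λ x → 1F ≢ x) (0s n)
            all-0s n = All-replicate⁺ n (λ ())
            tl : ∀ us {vs ws} → All (λ x → 1F ≢ x) us → 1F ∷ ws ⊆ us ++ 1F ∷ vs → ws ⊆ vs
            tl [] _ (_ ∷ʳ τ) = ⊆-trans (_ ∷ʳ ⊆-refl) τ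
            tl [] _ (_ ∷ τ) = τ
            tl (u ∷ us) (p ∷ ps) τ = tl us ps (skip-⊆ p τ)
    pick (suc a) e eq = find-true (b (suc a))
      (λ ba → contradiction
        (subst (_⊆ 10s (suc a) ++ 01s e) eq
          (drop-pad (10s (suc a)) (All.map (≢pad (suc a)) us)
            (subst (λ d → xs ⊆ 10s (suc a) ++ 4F ∷ 01s d) (trans (cong (_∸ suc a) (sym s)) (m+n∸m≡n (suc a) e))
              (subst (λ c → xs ⊆ core C (suc a) c) ba (xs⊆ (suc a) a≤)))))
        (word-missing (suc a) e))
      (λ ba → suc a , a≤ , ba)
      where
        s = word-of {suc a} eq
        a≤ : suc a ≤ C
        a≤ = ≤-trans (m≤m+n (suc a) e) (≤-reflexive s)
    main : ∃[ i ] i ≤ C × b i ≡ true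
    main with ⊆-0s10s C C zero-good
    ... | inj₁ (a , refl) = contradiction
          (≤-trans len (≤-trans (≤-reflexive (trans (length-replicate a) (sym (#0-0s a)))) #0≤)) 1+n≰n
    ... | inj₂ (a , e , _ , eq) = pick a e eq

-- Since xs′ has at least as many separators as vs, the displayed separator of
-- the subsequence cannot be matched behind that of the supersequence.
split-⊆ : ∀ {xs xs′} us {vs} → #$ xs ≡ 0 → #$ us ≡ 0 → xs ++ $ ∷ xs′ ⊆ us ++ $ ∷ vs →
          #$ vs ≤ #$ xs′ → xs ⊆ us × xs′ ⊆ vs
split-⊆ {[]} [] fx fu (_ ∷ʳ τ) le = contradiction (≤-trans (weight-⊆ is$ τ) le) 1+n≰n
split-⊆ {[]} [] fx fu (refl ∷ τ) le = [] , τ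
split-⊆ {x ∷ xs} {xs′} [] fx fu (_ ∷ʳ τ) le = contradiction
  (≤-trans (≤-reflexive (sym (trans (weight-++ is$ (x ∷ xs) ($ ∷ xs′)) (cong (_+ suc (#$ xs′)) fx))))
    (≤-trans (weight-⊆ is$ τ) le)) 1+n≰n
split-⊆ {x ∷ xs} [] fx fu (refl ∷ τ) le = contradiction fx (λ ())
split-⊆ {[]} (u ∷ us) fx fu (_ ∷ʳ τ) le with split-⊆ {[]} us fx (m+n≡0⇒n≡0 (is$ u) fu) τ le
... | σ , ρ = u ∷ʳ σ , ρ
split-⊆ {[]} (u ∷ us) fx fu (refl ∷ τ) le = contradiction fu (λ ())
split-⊆ {x ∷ xs} (u ∷ us) fx fu (_ ∷ʳ τ) le with split-⊆ {x ∷ xs} us fx (m+n≡0⇒n≡0 (is$ u) fu) τ le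
... | σ , ρ = u ∷ʳ σ , ρ
split-⊆ {x ∷ xs} (u ∷ us) fx fu (refl ∷ τ) le with split-⊆ {xs} us (m+n≡0⇒n≡0 (is$ x) fx) (m+n≡0⇒n≡0 (is$ x) fu) τ le
... | σ , ρ = refl ∷ σ , ρ

first-$ : ∀ xs → 1 ≤ #$ xs → ∃[ ys ] ∃[ zs ] xs ≡ ys ++ $ ∷ zs × #$ ys ≡ 0
first-$ ($ ∷ xs) _ = [] , xs , refl , refl
first-$ (0F ∷ xs) le with first-$ xs le
... | ys , zs , refl , f = 0F ∷ ys , zs , refl , f
first-$ (1F ∷ xs) le with first-$ xs le
... | ys , zs , refl , f = 1F ∷ ys , zs , refl , f
first-$ (3F ∷ xs) le with first-$ xs le
... | ys , zs , refl , f = 3F ∷ ys , zs , refl , f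
first-$ (4F ∷ xs) le with first-$ xs le
... | ys , zs , refl , f = 4F ∷ ys , zs , refl , f

module _ {C : Set} (K : ℕ) where

  gadgets : ℕ → (C → Bool) → List C → List Letter
  gadgets i good = concatMap (λ c → gadget K i (good c))

  gadgets-∷ : ∀ i good c cs → gadgets i good (c ∷ cs) ≡ core K i (good c) ++ $ ∷ gadgets i good cs
  gadgets-∷ i good c cs = ++-assoc (core K i (good c)) _ _

  weight-gadgets : ∀ f i good n → (∀ b → weight f (gadget K i b) ≡ n) → ∀ cs → weight f (gadgets i good cs) ≡ length cs * n
  weight-gadgets f i good n eq []       = refl
  weight-gadgets f i good n eq (c ∷ cs) =
    trans (weight-++ f (gadget K i (good c)) _) (cong₂ _+_ (eq (good c)) (weight-gadgets f i good n eq cs))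

  #$-gadget : ∀ i b → #$ (gadget K i b) ≡ 1
  #$-gadget i b = trans (weight-++ is$ (core K i b) _) (cong (_+ 1) (#$-core K i b))

  #$-gadgets : ∀ i good cs → #$ (gadgets i good cs) ≡ length cs
  #$-gadgets i good cs = trans (weight-gadgets is$ i good 1 (#$-gadget i) cs) (*-identityʳ _)

#1-gadget-zero : ∀ K b → #1 (gadget K 0 b) ≡ 1
#1-gadget-zero K b = trans (weight-++ is1 (core K 0 b) _) (trans (+-identityʳ _) (#1-core-zero K b))

#0-gadget-one : ∀ K b → #0 (gadget (suc K) 1 b) ≡ suc K
#0-gadget-one K b = trans (weight-++ is0 (core (suc K) 1 b) _) (trans (+-identityʳ _) (#0-core-one K b))

CommonSubsequence : {C : Set} → ℕ → (ℕ → C → Bool) → List C → List Letter → Set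
CommonSubsequence K good cs xs = ∀ i → i ≤ K → xs ⊆ gadgets K i (good i) cs

module _ {C : Set} (K : ℕ) (good : ℕ → C → Bool) where

  -- Zeros are counted in string 1 and ones in string 0: these two counts do not depend on which
  -- marks are pads.
  #0+#1-common : ∀ {xs} cs → CommonSubsequence (suc K) good cs xs → #0 xs + #1 xs ≤ length cs * (2 + K)
  #0+#1-common cs xs⊆ = ≤-trans (+-mono-≤
    (≤-trans (weight-⊆ is0 (xs⊆ 1 (s≤s z≤n))) (≤-reflexive (weight-gadgets (suc K) is0 1 (good 1) (suc K) (#0-gadget-one K) cs)))
    (≤-trans (weight-⊆ is1 (xs⊆ 0 z≤n)) (≤-reflexive (weight-gadgets (suc K) is1 0 (good 0) 1 (#1-gadget-zero (suc K)) cs))))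
    (≤-reflexive (trans (sym (*-distribˡ-+ (length cs) (suc K) 1)) (cong (length cs *_) (+-comm (suc K) 1))))

  length-common : ∀ {xs} cs → All Unpadded xs → CommonSubsequence (suc K) good cs xs → length xs ≤ length cs * (3 + K)
  length-common {xs} cs us xs⊆ = begin
    length xs                           ≡⟨ length-unpadded us ⟩
    #0 xs + #1 xs + #$ xs               ≤⟨ +-mono-≤ (#0+#1-common cs xs⊆)
        (≤-trans (weight-⊆ is$ (xs⊆ 0 z≤n)) (≤-reflexive (#$-gadgets (suc K) 0 (good 0) cs))) ⟩
    length cs * (2 + K) + length cs     ≡⟨ +-comm _ (length cs) ⟩
    length cs + length cs * (2 + K)     ≡⟨ sym (*-suc (length cs) (2 + K)) ⟩
    length cs * (3 + K)                 ∎
    where open ≤-Reasoning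

  -- The required length leaves no slack. All separators must be used, so the first one of `xs`
  -- meets the first one of every string; the parts before and behind it are bounded separately, and
  -- both bounds must be attained.
  gadgets-sound : ∀ {xs} cs → All Unpadded xs → CommonSubsequence (suc K) good cs xs →
                  length cs * (3 + K) ≤ length xs → All (λ c → ∃[ i ] i ≤ suc K × good i c ≡ true) cs
  gadgets-sound []       _  _   _   = []
  gadgets-sound {xs} (c ∷ cs) us xs⊆ len with first-$ xs (≤-trans (s≤s z≤n) m<#$)
    where
      m<#$ : suc (length cs) ≤ #$ xs
      m<#$ = +-cancelˡ-≤ (suc (length cs) * (2 + K)) _ _ (begin
        suc (length cs) * (2 + K) + suc (length cs)  ≡⟨ +-comm _ (suc (length cs)) ⟩
        suc (length cs) + suc (length cs) * (2 + K)  ≡⟨ sym (*-suc (suc (length cs)) (2 + K)) ⟩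
        suc (length cs) * (3 + K)                    ≤⟨ len ⟩
        length xs                                    ≡⟨ length-unpadded us ⟩
        #0 xs + #1 xs + #$ xs                        ≤⟨ +-monoˡ-≤ (#$ xs) (#0+#1-common (c ∷ cs) xs⊆) ⟩
        suc (length cs) * (2 + K) + #$ xs            ∎)
        where open ≤-Reasoning
  ... | ys , zs , refl , ys-free = core-sound (suc K) (λ i → good i c) (s≤s z≤n) uys ys⊆ ys-long ∷ gadgets-sound cs uzs zs⊆ zs-long
    where
      uys : All Unpadded ys
      uys = All-++⁻ˡ ys us
      uzs : All Unpadded zs
      uzs with All-++⁻ʳ ys us
      ... | _ ∷ uzs = uzs
      #$≥ : length cs ≤ #$ zs
      #$≥ = ≤-pred (+-cancelˡ-≤ (suc (length cs) * (2 + K)) _ _ (begin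
        suc (length cs) * (2 + K) + suc (length cs)  ≡⟨ +-comm _ (suc (length cs)) ⟩
        suc (length cs) + suc (length cs) * (2 + K)  ≡⟨ sym (*-suc (suc (length cs)) (2 + K)) ⟩
        suc (length cs) * (3 + K)                    ≤⟨ len ⟩
        length xs                                    ≡⟨ length-unpadded us ⟩
        #0 xs + #1 xs + #$ xs                        ≤⟨ +-mono-≤ (#0+#1-common (c ∷ cs) xs⊆)
             (≤-reflexive (trans (weight-++ is$ ys ($ ∷ zs)) (cong (_+ suc (#$ zs)) ys-free))) ⟩
        suc (length cs) * (2 + K) + suc (#$ zs)      ∎))
        where open ≤-Reasoning
      parts : ∀ i → i ≤ suc K → ys ⊆ core (suc K) i (good i c) × zs ⊆ gadgets (suc K) i (good i) cs
      parts i i≤ = split-⊆ (core (suc K) i (good i c)) ys-free (#$-core (suc K) i (good i c))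
        (subst (xs ⊆_) (gadgets-∷ (suc K) i (good i) c cs) (xs⊆ i i≤))
        (≤-trans (≤-reflexive (#$-gadgets (suc K) i (good i) cs)) #$≥)
      ys⊆ : ∀ i → i ≤ suc K → ys ⊆ core (suc K) i (good i c)
      ys⊆ i i≤ = proj₁ (parts i i≤)
      zs⊆ : CommonSubsequence (suc K) good cs zs
      zs⊆ i i≤ = proj₂ (parts i i≤)
      |ys| : length ys ≤ 2 + K
      |ys| = begin
        length ys                  ≡⟨ length-unpadded uys ⟩
        #0 ys + #1 ys + #$ ys      ≡⟨ cong (#0 ys + #1 ys +_) ys-free ⟩
        #0 ys + #1 ys + 0          ≡⟨ +-identityʳ _ ⟩
        #0 ys + #1 ys              ≤⟨ +-mono-≤
            (≤-trans (weight-⊆ is0 (ys⊆ 1 (s≤s z≤n))) (≤-reflexive (#0-core-one K (good 1 c))))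
            (≤-trans (weight-⊆ is1 (ys⊆ 0 z≤n)) (≤-reflexive (#1-core-zero (suc K) (good 0 c)))) ⟩
        suc K + 1                  ≡⟨ +-comm (suc K) 1 ⟩
        2 + K                      ∎
        where open ≤-Reasoning
      total : (3 + K) + length cs * (3 + K) ≤ suc (length ys) + length zs
      total = ≤-trans len (≤-reflexive (trans (length-++ ys) (+-suc (length ys) (length zs))))
      ys-long : 2 + K ≤ length ys
      ys-long = ≤-pred (+-cancelʳ-≤ (length cs * (3 + K)) _ _
        (≤-trans total (+-monoʳ-≤ (suc (length ys)) (length-common cs uzs zs⊆))))
      zs-long : length cs * (3 + K) ≤ length zs
      zs-long = +-cancelˡ-≤ (3 + K) _ _ (≤-trans total (+-monoˡ-≤ (length zs) (s≤s |ys|)))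

-- Words contained in the gadgets

0s⊆10s : ∀ n → 0s n ⊆ 10s n
0s⊆10s zero    = []
0s⊆10s (suc n) = 1F ∷ʳ (refl ∷ 0s⊆10s n)

0s⊆01s : ∀ n → 0s n ⊆ 01s n
0s⊆01s zero    = []
0s⊆01s (suc n) = refl ∷ (1F ∷ʳ 0s⊆01s n)

0s-+ : ∀ m n → 0s (m + n) ≡ 0s m ++ 0s n
0s-+ zero    n = refl
0s-+ (suc m) n = cong (0F ∷_) (0s-+ m n)

word⊆01s : ∀ j d → suc j ≤ d → 0s (suc j) ++ 1F ∷ 0s (d ∸ suc j) ⊆ 01s d
word⊆01s zero    (suc d) _        = refl ∷ refl ∷ 0s⊆01s d
word⊆01s (suc j) (suc d) (s≤s le) = refl ∷ (1F ∷ʳ word⊆01s j d le)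

-- All zeros are used. For `j < i` the `1` of the word is the one just before the next zero, for
-- `j > i` the one just behind the `j`-th zero; only for `j = i` must it be `x`.
word⊆10s01s : ∀ i d j x → j ≤ i + d → j ≢ i ⊎ x ≡ 1F → 0s j ++ 1F ∷ 0s (i + d ∸ j) ⊆ 10s i ++ x ∷ 01s d
word⊆10s01s zero    d zero    x _ (inj₁ j≢i) = contradiction refl j≢i
word⊆10s01s zero    d zero    x _ (inj₂ refl) = refl ∷ 0s⊆01s d
word⊆10s01s (suc i) d zero    x _ _ =
  refl ∷ (refl ∷ subst (_⊆ 10s i ++ x ∷ 01s d) (sym (0s-+ i d)) (++⁺ (0s⊆10s i) (x ∷ʳ 0s⊆01s d)))
word⊆10s01s zero    d (suc j) x le _ = x ∷ʳ word⊆01s j d le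
word⊆10s01s (suc i) d (suc j) x (s≤s le) c =
  1F ∷ʳ (refl ∷ word⊆10s01s i d j x le (Sum.map (λ ne → ne ∘ cong suc) (λ e → e) c))

word⊆core : ∀ K i j b → 1 ≤ K → i ≤ K → j ≤ K → j ≢ i ⊎ b ≡ true → word K j ⊆ core K i b
word⊆core (suc K) zero j b _ _ j≤K c = subst (word (suc K) j ⊆_) (sym (++-assoc (0s (suc K)) _ _)) (zero-case j j≤K c b)
  where
    0s-mono : ∀ {m n} → m ≤ n → 0s m ⊆ 0s n
    0s-mono z≤n      = minimum _
    0s-mono (s≤s le) = refl ∷ 0s-mono le
    zero-case : ∀ j → j ≤ suc K → j ≢ 0 ⊎ b ≡ true → ∀ b′ →
                word (suc K) j ⊆ 0s (suc K) ++ 1F ∷ mark 0 b ∷ 0s K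
    zero-case zero    _  (inj₁ ne)   _ = contradiction refl ne
    zero-case zero    _  (inj₂ refl) _ = ++⁺ˡ (0s (suc K)) (refl ∷ ⊆-refl)
    zero-case (suc j) le _           _ = ++⁺ (0s-mono le) (refl ∷ (mark 0 b ∷ʳ 0s-mono (m∸n≤m K j)))
word⊆core K (suc i) j b _ i≤K j≤K c =
  subst (λ n → 0s j ++ 1F ∷ 0s (n ∸ j) ⊆ core K (suc i) b) eq
    (word⊆10s01s (suc i) (K ∸ suc i) j (mark (suc i) b) (≤-trans j≤K (≤-reflexive (sym eq)))
      (Sum.map₂ (λ { refl → refl }) c))
  where
    eq : suc i + (K ∸ suc i) ≡ K
    eq = m+[n∸m]≡n i≤K

length-word : ∀ K j → j ≤ K → length (word K j) ≡ suc K
length-word K j j≤K = trans (length-++ (0s j)) (trans (cong₂ (λ a b → a + suc b) (length-replicate j) (length-replicate (K ∸ j)))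
  (trans (+-suc j _) (cong suc (m+[n∸m]≡n j≤K))))

module _ {C : Set} (K : ℕ) (good : ℕ → C → Bool) where

  -- For a clause made true by string `j` the `j`-th word is taken; the other strings contain it
  -- whatever their marks.
  gadgets-complete : ∀ cs → All (λ c → ∃[ i ] i ≤ suc K × good i c ≡ true) cs →
                     ∃[ xs ] CommonSubsequence (suc K) good cs xs × length xs ≡ length cs * (3 + K)
  gadgets-complete []       []                  = [] , (λ _ _ → []) , refl
  gadgets-complete (c ∷ cs) ((j , j≤ , g) ∷ gs) with gadgets-complete cs gs
  ... | xs , xs⊆ , len = word (suc K) j ++ $ ∷ xs ,
    (λ i i≤ → subst (word (suc K) j ++ $ ∷ xs ⊆_) (sym (gadgets-∷ (suc K) i (good i) c cs))
      (++⁺ (word⊆core (suc K) i j (good i c) (s≤s z≤n) i≤ j≤ (cond i)) (refl ∷ xs⊆ i i≤))) ,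
    trans (length-++ (word (suc K) j)) (trans (cong₂ (λ a b → a + suc b) (length-word (suc K) j j≤) len) (+-suc (2 + K) _))
    where
      cond : ∀ i → j ≢ i ⊎ good i c ≡ true
      cond i with j ≟ i
      ... | yes refl = inj₂ g
      ... | no  ne   = inj₁ ne

-- Windows

Prefix⇒⊆ : ∀ {xs ys : List Letter} → Prefix _≡_ xs ys → xs ⊆ ys
Prefix⇒⊆ []         = minimum _
Prefix⇒⊆ (eq ∷ p)   = eq ∷ Prefix⇒⊆ p

Infix⇒⊆ : ∀ {xs ys : List Letter} → Infix _≡_ xs ys → xs ⊆ ys
Infix⇒⊆ (here p)  = Prefix⇒⊆ p
Infix⇒⊆ (there p) = _ ∷ʳ Infix⇒⊆ p

prefix-shorten : ∀ {xs : List Letter} us {vs} → Prefix _≡_ xs (us ++ vs) → length xs ≤ length us → xs ⊆ us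
prefix-shorten {[]}     us       p        le       = minimum us
prefix-shorten {x ∷ xs} (u ∷ us) (eq ∷ p) (s≤s le) = eq ∷ prefix-shorten us p le

infix-[] : ∀ {xs ys : List Letter} → xs ⊆ ys → Infix _≡_ ys [] → xs ≡ []
infix-[] [] (here []) = refl

-- Each v a has length L, so a window of length L meets at most one of them.
blocks : Letter → ℕ → (ℕ → List Letter) → ℕ → List Letter
blocks p L v zero    = []
blocks p L v (suc a) = replicate (suc L) p ++ v a ++ blocks p L v a

module Window (p : Letter) (L : ℕ) (v : ℕ → List Letter) (|v| : ∀ a → length (v a) ≡ L) where

  length-blocks : ∀ n → length (blocks p L v n) ≡ n * (suc L + L)
  length-blocks zero    = refl
  length-blocks (suc a) = trans (length-++ (replicate (suc L) p)) (trans
    (cong₂ _+_ (length-replicate (suc L)) (trans (length-++ (v a)) (cong₂ _+_ (|v| a) (length-blocks a))))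
    (sym (+-assoc (suc L) L _)))

  infix-blocks : ∀ {a} n → a < n → Infix _≡_ (v a) (blocks p L v n)
  infix-blocks {a} (suc n) lt with m<1+n⇒m<n∨m≡n lt
  ... | inj₁ a<n  = replicate (suc L) p ++ⁱ v n ++ⁱ infix-blocks n a<n
  ... | inj₂ refl = replicate (suc L) p ++ⁱ (here (refl-prefix (v a)) ⁱ++ blocks p L v a)
    where
      refl-prefix : ∀ (xs : List Letter) → Prefix _≡_ xs xs
      refl-prefix []       = []
      refl-prefix (x ∷ xs) = refl ∷ refl-prefix xs

  module _ {xs ys : List Letter} (xs⊆ys : xs ⊆ ys) (xs≢p : All (_≢ p) xs) (|ys| : length ys ≡ L) where

    -- The three lemmas follow the start of the window: at a block, in the gadgets with a suffix
    -- `us` left, or in the pads with `m` left. From the pads the window cannot get past `v a`, from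
    -- the gadgets it cannot get past the next pads; so only letters of `v a` remain once pads are
    -- dropped.
    window : ∀ n → Infix _≡_ ys (blocks p L v n) → xs ≡ [] ⊎ ∃[ a ] xs ⊆ v a
    in-gadget : ∀ a us → us ⊆ v a → Infix _≡_ ys (us ++ blocks p L v a) → xs ≡ [] ⊎ ∃[ a ] xs ⊆ v a
    in-pads : ∀ a m → Infix _≡_ ys (replicate m p ++ v a ++ blocks p L v a) → xs ≡ [] ⊎ ∃[ a ] xs ⊆ v a

    window zero    i = inj₁ (infix-[] xs⊆ys i)
    window (suc a) i = in-pads a (suc L) i

    in-pads a zero    i         = in-gadget a (v a) ⊆-refl i
    in-pads a (suc m) (there i) = in-pads a m i
    in-pads a (suc m) (here pr) = inj₂ (a , drop-pads (suc m) xs≢p (⊆-trans xs⊆ys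
      (prefix-shorten (replicate (suc m) p ++ v a)
        (subst (Prefix _≡_ ys) (sym (++-assoc (replicate (suc m) p) (v a) (blocks p L v a))) pr)
        (≤-trans (≤-reflexive (trans |ys| (sym (|v| a)))) (≤-trans (m≤n+m _ (length (replicate (suc m) p))) (≤-reflexive (sym (length-++ (replicate (suc m) p) {v a}))))))))

    in-gadget a []       _  i         = window a i
    in-gadget a (u ∷ us) us⊆ (there i) = in-gadget a us (⊆-trans (u ∷ʳ ⊆-refl) us⊆) i
    -- Block 0 is the last one, so no pads follow its gadgets.
    in-gadget zero (u ∷ us) us⊆ (here pr) = inj₂ (0 , ⊆-trans (drop-pads-end (u ∷ us) 0 xs≢p (⊆-trans xs⊆ys (Prefix⇒⊆ pr))) us⊆)
    in-gadget (suc a) (u ∷ us) us⊆ (here pr) = inj₂ (suc a , ⊆-trans (drop-pads-end (u ∷ us) (suc L) xs≢p (⊆-trans xs⊆ys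
      (prefix-shorten ((u ∷ us) ++ replicate (suc L) p)
        (subst (Prefix _≡_ ys) (sym (++-assoc (u ∷ us) (replicate (suc L) p) _)) pr)
        (≤-trans (≤-reflexive |ys|) (≤-trans (n≤1+n L) (≤-trans (≤-reflexive (sym (length-replicate (suc L)))) (≤-trans (m≤n+m _ (length (u ∷ us))) (≤-reflexive (sym (length-++ (u ∷ us) {replicate (suc L) p}))))))))) ) us⊆)

-- The program that writes the strings

loop-done : ∀ {x p vs M w t} → contents vs x ≡ 0 →
            while≢0 x p ⊢ (vs , M) ⟶ (vs , M) ⟨ 0 * (suc w + t) + 1 ⟩
loop-done = ⟶-stop

-- Per iteration, `suc w` pays for testing the counter and `t` for the body; the final 1 is the test
-- that ends the loop.
loop-next : ∀ {x p vs M d e t} w n → contents vs x ≡ suc n → suc n ≤ 2 ^ w →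
            p ⊢ (vs , M) ⟶ d ⟨ t ⟩ → while≢0 x p ⊢ d ⟶ e ⟨ n * (suc w + t) + 1 ⟩ →
            while≢0 x p ⊢ (vs , M) ⟶ e ⟨ suc n * (suc w + t) + 1 ⟩
loop-next {t = t} w n eq le P Q = ⟶-weaken (≤-reflexive time)
  (⟶-iterate (suc w) (bits-≤ (≤-trans (≤-reflexive eq) le)) (λ z → 1+n≢0 (trans (sym eq) z)) P Q)
  where
    time : suc w + (t + (n * (suc w + t) + 1)) ≡ suc n * (suc w + t) + 1
    time = solve 3 (λ a t r → a :+ (t :+ (r :+ con 1)) := ((a :+ t) :+ r) :+ con 1) refl (suc w) t (n * (suc w + t))
      where open +-*-Solver

-- The address is advanced to `p + 1` because this is the form that `op rPTR add rPTR rONE`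
-- produces.
writes : (ℕ → ℕ) → ℕ → List ℕ → (ℕ → ℕ)
writes M p []       = M
writes M p (x ∷ xs) = writes (update M p x) (p + 1) xs

writes-++ : ∀ M p xs ys → writes M p (xs ++ ys) ≡ writes (writes M p xs) (p + length xs) ys
writes-++ M p []       ys = cong (λ z → writes M z ys) (sym (+-identityʳ p))
writes-++ M p (x ∷ xs) ys = trans (writes-++ (update M p x) (p + 1) xs ys)
  (cong (λ z → writes (writes (update M p x) (p + 1) xs) z ys) (+-assoc p 1 (length xs)))

writes-≤ : ∀ {b} M p {xs} → All (_≤ b) xs → (∀ i → M i ≤ b) → ∀ i → writes M p xs i ≤ b
writes-≤ M p []           M≤ = M≤
writes-≤ M p (x≤b ∷ xs≤b) M≤ = writes-≤ _ (p + 1) xs≤b (update-≤ M p x≤b M≤)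

writes-below : ∀ M p xs {j} → j < p → writes M p xs j ≡ M j
writes-below M p []       j<p = refl
writes-below M p (x ∷ xs) j<p = trans (writes-below _ (p + 1) xs (≤-trans j<p (m≤m+n p 1)))
  (update-other M x (≢-sym (<⇒≢ j<p)))

writes-above : ∀ M p xs → (∀ j → p ≤ j → M j ≡ 0) → ∀ j → writes M p xs (p + j) ≡ contents xs j
writes-above M p []       M≡0 j = M≡0 _ (m≤m+n p j)
writes-above M p (x ∷ xs) M≡0 zero rewrite +-identityʳ p =
  trans (writes-below _ (p + 1) xs (≤-reflexive (+-comm 1 p))) (update-same M p x)
writes-above M p (x ∷ xs) M≡0 (suc j) = trans (cong (writes (update M p x) (p + 1) xs) (sym (+-assoc p 1 j)))
  (writes-above _ (p + 1) xs
    (λ i le → trans (update-other M x (<⇒≢ (≤-trans (≤-reflexive (+-comm 1 p)) le))) (M≡0 i (≤-trans (m≤m+n p 1) le))) j)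

writes-contents : ∀ xs j → writes (λ _ → 0) 0 xs j ≡ contents xs j
writes-contents xs = writes-above (λ _ → 0) 0 xs (λ _ _ → refl)

-- The head is the least significant digit, so division by `B` reads the list from the front.
pack : ℕ → List ℕ → ℕ
pack B []       = 0
pack B (v ∷ vs) = v + B * pack B vs

pop-rest : ∀ {v} B r → v < B → ⟦ div ⟧ (v + B * r) B ≡ r
pop-rest {v} (suc b) r v<B = begin
  (v + suc b * r) / suc b             ≡⟨ cong (λ z → (v + z) / suc b) (*-comm (suc b) r) ⟩
  (v + r * suc b) / suc b             ≡⟨ +-distrib-/-∣ʳ v (divides r refl) ⟩
  v / suc b + (r * suc b) / suc b     ≡⟨ cong₂ _+_ (m<n⇒m/n≡0 v<B) (m*n/n≡m r (suc b)) ⟩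
  r                                   ∎
  where open ≡-Reasoning

pop-digit : ∀ {v} B r → v < B → (v + B * r) ∸ ⟦ div ⟧ (v + B * r) B * B ≡ v
pop-digit {v} B r v<B = trans
  (cong ((v + B * r) ∸_) (trans (cong (_* B) (pop-rest B r v<B)) (*-comm r B)))
  (m+n∸n≡m v (B * r))

shift : ℕ → ℕ → ℕ
shift zero    a = a
shift (suc u) a = shift u (a / 2)

shift-≤ : ∀ u a → shift u a ≤ a
shift-≤ zero    a = ≤-refl
shift-≤ (suc u) a = ≤-trans (shift-≤ u (a / 2)) (m/n≤m a 2)

parity : ℕ → ℕ
parity a = a ∸ a / 2 * 2

∣_-_∣′ : ℕ → ℕ → ℕ
∣ a - b ∣′ = (a ∸ b) + (b ∸ a)

literalVar literalSign : ℕ → ℕ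
literalGroup literalPos : ℕ → ℕ → ℕ
literalVar v = v / 2
literalSign v = v ∸ literalVar v * 2
literalGroup h v = ⟦ div ⟧ (literalVar v) h
literalPos h v = literalVar v ∸ literalGroup h v * h

-- 1 if the assignment a to the i-th group of h variables makes the encoded
-- literal v true, else 0.  Only arithmetic of the machine is used.
litTrue : ℕ → ℕ → ℕ → ℕ → ℕ
litTrue h i a v = (1 ∸ ∣ literalGroup h v - i ∣′) ∸ ∣ parity (shift (literalPos h v) (a * 1)) - literalSign v ∣′

litTrue-≤1 : ∀ h i a v → litTrue h i a v ≤ 1
litTrue-≤1 h i a v = ≤-trans
  (m∸n≤m (1 ∸ ∣ literalGroup h v - i ∣′) ∣ parity (shift (literalPos h v) (a * 1)) - literalSign v ∣′)
  (m∸n≤m 1 ∣ literalGroup h v - i ∣′)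

-- A disjunction evaluated by addition: a clause is true if the count is positive.
trueCount : ℕ → ℕ → ℕ → ℕ → List ℕ → ℕ
trueCount h i a f []      = f
trueCount h i a f (v ∷ c) = trueCount h i a (f + litTrue h i a v) c

trueCount-≤ : ∀ h i a f c → trueCount h i a f c ≤ f + length c
trueCount-≤ h i a f []      = ≤-reflexive (sym (+-identityʳ f))
trueCount-≤ h i a f (v ∷ c) = ≤-trans (trueCount-≤ h i a _ c)
  (≤-trans (+-monoˡ-≤ (length c) (+-monoʳ-≤ f (litTrue-≤1 h i a v))) (≤-reflexive (+-assoc f 1 (length c))))

positive : ℕ → Bool
positive zero    = false
positive (suc _) = true

satisfied : ℕ → ℕ → ℕ → List ℕ → Bool
satisfied h i a c = positive (trueCount h i a 0 c)

withLength : List ℕ → List ℕ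
withLength c = length c ∷ c

-- The code

rONE rTWO rH rM rB rN rPL rΦ rPTR rA rΨ rJ rFLAG rLEN rV rPW rU rT rY : Reg
rONE = 0
rTWO = 1
rH = 2
rM = 3
rB = 4
rN = 5
rPL = 6
rΦ = 7
rPTR = 8
rA = 9
rΨ = 10
rJ = 11
rFLAG = 12
rLEN = 13
rV = 14
rPW = 15
rU = 16
rT = 17
rY = 18

halving : List Instr
halving = op rPW div rPW rTWO ∷ op rU sub rU rONE ∷ []

-- Ends with the sign of the literal in `rV`, a copy of the assignment in `rPW`, the number of bits
-- to shift away in `rU`, and in `rT` a 1 exactly if the variable is in group `i`. Copying is
-- multiplication by `rONE`, whence the `a * 1` in `litTrue`.
readLiteral : ℕ → List Instr
readLiteral i =
  op rT div rΨ rB ∷ op rT mul rT rB ∷ op rV sub rΨ rT ∷ op rΨ div rΨ rB ∷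
  op rT div rV rTWO ∷ op rY mul rT rTWO ∷ op rV sub rV rY ∷
  op rY div rT rH ∷ op rU mul rY rH ∷ op rU sub rT rU ∷
  const rT i ∷ op rPW sub rY rT ∷ op rY sub rT rY ∷ op rT add rPW rY ∷
  op rT sub rONE rT ∷ const rY 0 ∷ op rPW mul rA rONE ∷ []

testLiteral : List Instr
testLiteral =
  op rY div rPW rTWO ∷ op rY mul rY rTWO ∷ op rY sub rPW rY ∷
  op rPW sub rY rV ∷ op rY sub rV rY ∷ op rY add rPW rY ∷ op rT sub rT rY ∷
  op rFLAG add rFLAG rT ∷
  const rT 0 ∷ const rV 0 ∷ const rPW 0 ∷ const rY 0 ∷
  op rLEN sub rLEN rONE ∷ []

literalBody : ℕ → Program
literalBody i = block (readLiteral i) ⨾ (while≢0 rU (block halving) ⨾ block testLiteral)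

readClause : List Instr
readClause = op rT div rΨ rB ∷ op rT mul rT rB ∷ op rLEN sub rΨ rT ∷ op rΨ div rΨ rB ∷ const rT 0 ∷ []

emit : List Letter → List Instr
emit []       = []
emit (x ∷ xs) = const rV (toℕ x) ∷ store rPTR rV ∷ op rPTR add rPTR rONE ∷ const rV 0 ∷ emit xs

-- The letters are numbered so that `toℕ (pad i)` is `toℕ (hit i) + 3`; hence the mark is `hit` plus
-- three times `1 ∸ flag`, without a branch.
emitMark : ℕ → List Instr
emitMark i =
  op rT sub rONE rFLAG ∷ const rV 3 ∷ op rT mul rT rV ∷ const rV (toℕ (hit i)) ∷ op rV add rV rT ∷
  store rPTR rV ∷ op rPTR add rPTR rONE ∷ const rV 0 ∷ const rT 0 ∷ const rFLAG 0 ∷ op rJ sub rJ rONE ∷ []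

emitGadget : ℕ → ℕ → List Instr
emitGadget K i = emit (before K i) ++ emitMark i ++ emit (after K i ++ $ ∷ [])

clauseBody : ℕ → ℕ → Program
clauseBody K i = block readClause ⨾ (while≢0 rLEN (literalBody i) ⨾ block (emitGadget K i))

emitPad : ℕ → List Instr
emitPad i = emit (pad i ∷ []) ++ op rU sub rU rONE ∷ []

-- Reading consumes the packed formula, so each block works on a fresh copy `rΨ` of `rΦ`.
startBlock startGadgets : List Instr
startBlock   = op rA sub rA rONE ∷ op rU mul rPL rONE ∷ []
startGadgets = op rΨ mul rΦ rONE ∷ op rJ mul rM rONE ∷ []

blockBody : ℕ → ℕ → Program
blockBody K i = block startBlock ⨾ (while≢0 rU (block (emitPad i)) ⨾
                (block startGadgets ⨾ while≢0 rJ (clauseBody K i)))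

startString : List Instr
startString = op rA mul rN rONE ∷ []

emitString : ℕ → ℕ → Program
emitString K i = block startString ⨾ while≢0 rA (blockBody K i)

emitStrings : ℕ → ℕ → ℕ → Program
emitStrings K i zero    = skip
emitStrings K i (suc c) = emitString K i ⨾ emitStrings K (suc i) c

-- Correctness and running time of the code

exec-++ : ∀ is js c → exec (is ++ js) c ≡ exec js (exec is c)
exec-++ []       js c = refl
exec-++ (i ∷ is) js c = exec-++ is js (step i c)

letters : List Letter → List ℕ
letters = map toℕ

writes-letters-++ : ∀ M p xs ys →
  writes (writes M p (letters xs)) (p + length xs) (letters ys) ≡ writes M p (letters (xs ++ ys))
writes-letters-++ M p xs ys = begin
  writes (writes M p (letters xs)) (p + length xs) (letters ys)
    ≡⟨ cong (λ n → writes (writes M p (letters xs)) (p + n) (letters ys)) (sym (length-map toℕ xs)) ⟩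
  writes (writes M p (letters xs)) (p + length (letters xs)) (letters ys)
    ≡⟨ sym (writes-++ M p (letters xs) (letters ys)) ⟩
  writes M p (letters xs ++ letters ys)
    ≡⟨ cong (writes M p) (sym (map-++ toℕ xs ys)) ⟩
  writes M p (letters (xs ++ ys))
    ∎
  where open ≡-Reasoning

module Emission (K : ℕ) (h m B N L : ℕ) (clauses : List (List ℕ))
                (|clauses| : length clauses ≡ m)
                (digits : All (λ c → All (_< B) (withLength c)) clauses)
                (w D : ℕ) where

  pl Φ : ℕ
  pl = L + 1
  Φ = pack B (concatMap withLength clauses)

  regs : (ptr a Ψ j flag len v pw u t y : ℕ) → List ℕ
  regs ptr a Ψ j flag len v pw u t y =
    1 ∷ 2 ∷ h ∷ m ∷ B ∷ N ∷ pl ∷ Φ ∷ ptr ∷ a ∷ Ψ ∷ j ∷ flag ∷ len ∷ v ∷ pw ∷ u ∷ t ∷ y ∷ []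

  -- Numbers stored between two pieces of straight-line code are at most `2 ^ w`. All loops have at
  -- most `D` iterations, except for the one over the `N` blocks.
  record Fits : Set where
    field
      w≥4 : 4 ≤ w
      h≤ : h ≤ 2 ^ w
      m≤ : m ≤ 2 ^ w
      B≤ : B ≤ 2 ^ w
      N≤ : N ≤ 2 ^ w
      pl≤ : pl ≤ 2 ^ w
      Φ≤ : Φ ≤ 2 ^ w
      B≤D : B ≤ D
      m≤D : m ≤ D
      pl≤D : pl ≤ D

  module _ (fits : Fits) where
    open Fits fits

    V = 2 ^ w

    1≤w : 1 ≤ w
    1≤w = ≤-trans (s≤s z≤n) w≥4

    small : ∀ {x} → x ≤ 4 → x ≤ V
    small x≤4 = ≤-trans x≤4 (≤-trans w≥4 (n≤2^n w))

    regs-≤ : ∀ {ptr a Ψ j flag len v pw u t y} → ptr ≤ V → a ≤ V → Ψ ≤ V → j ≤ V → flag ≤ V → len ≤ V →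
             v ≤ V → pw ≤ V → u ≤ V → t ≤ V → y ≤ V → All (_≤ V) (regs ptr a Ψ j flag len v pw u t y)
    regs-≤ a b c d e f g h i j k =
      small (s≤s z≤n) ∷ small (s≤s (s≤s z≤n)) ∷ h≤ ∷ m≤ ∷ B≤ ∷ N≤ ∷ pl≤ ∷ Φ≤ ∷ a ∷ b ∷ c ∷ d ∷ e ∷ f ∷ g ∷ h ∷ i ∷ j ∷ k ∷ []

    tHalve : ℕ
    tHalve = D * (suc w + factor halving * w) + 1
    tLit tLits tClause tClauses tBlock tString : ℕ → ℕ
    tLit i = factor (readLiteral i) * w + (tHalve + factor testLiteral * w)
    tLits i = D * (suc w + tLit i) + 1
    tClause i = factor readClause * w + (tLits i + factor (emitGadget K i) * w)
    tClauses i = D * (suc w + tClause i) + 1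
    tBlock i = factor startBlock * w + ((D * (suc w + factor (emitPad i) * w) + 1) + (factor startGadgets * w + tClauses i))
    tString i = factor startString * w + (N * (suc w + tBlock i) + 1)

    MBounded : (ℕ → ℕ) → Set
    MBounded M = ∀ i → M i ≤ V

    halve-loop : ∀ {ptr a Ψ j flag len v t y M} pw u → ptr ≤ V → a ≤ V → Ψ ≤ V → j ≤ V → flag ≤ V → len ≤ V →
      v ≤ V → pw ≤ V → u ≤ V → t ≤ V → y ≤ V → MBounded M →
      while≢0 rU (block halving) ⊢ (regs ptr a Ψ j flag len v pw u t y , M) ⟶
        (regs ptr a Ψ j flag len v (shift u pw) 0 t y , M) ⟨ u * (suc w + factor halving * w) + 1 ⟩
    halve-loop pw zero    p a b c d e f g h i j M≤ = loop-done {w = w} {t = factor halving * w} refl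
    halve-loop pw (suc u) p a b c d e f g h i j M≤ = loop-next w u refl h
      (⟶-block halving 1≤w (regs-≤ p a b c d e f g h i j , M≤))
      (halve-loop (pw / 2) u p a b c d e f (≤-trans (m/n≤m pw 2) g) (≤-trans (n≤1+n u) h) i j M≤)

    div-≤ : ∀ x y → ⟦ div ⟧ x y ≤ x
    div-≤ x zero    = z≤n
    div-≤ x (suc y) = m/n≤m x (suc y)

    pop-≤ : ∀ {v r} → v < B → v + B * r ≤ V → r ≤ V
    pop-≤ {v} {r} v< Ψ≤ = ≤-trans (≤-reflexive (sym (pop-rest B r v<))) (≤-trans (div-≤ (v + B * r) B) Ψ≤)

    suffix-≤ : ∀ c {rest} → All (_< B) c → pack B (c ++ rest) ≤ V → pack B rest ≤ V
    suffix-≤ []      []        le = le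
    suffix-≤ (v ∷ c) (v< ∷ c<) le = suffix-≤ c c< (pop-≤ v< le)

    *1-≤ : ∀ {a} → a ≤ V → a * 1 ≤ V
    *1-≤ a≤ = ≤-trans (≤-reflexive (*-identityʳ _)) a≤

    lit-step : ∀ i v r {ptr a j f len M} → v < B → ptr ≤ V → a ≤ V → v + B * r ≤ V → j ≤ V →
      f ≤ V → suc len ≤ V → MBounded M →
      literalBody i ⊢ (regs ptr a (v + B * r) j f (suc len) 0 0 0 0 0 , M) ⟶
        (regs ptr a r j (f + litTrue h i a v) len 0 0 0 0 0 , M) ⟨ tLit i ⟩
    lit-step i v r {ptr} {a} {j} {f} {len} v< p≤ a≤ Ψ≤ j≤ f≤ len≤ M≤ = ⟶-seq
      (⟶-post (⟶-block (readLiteral i) 1≤w (regs-≤ p≤ a≤ Ψ≤ j≤ f≤ len≤ z≤n z≤n z≤n z≤n z≤n , M≤))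
        (cong₂ read (pop-rest B r v<) (pop-digit B r v<)) (λ _ → refl))
      (⟶-seq
        (⟶-weaken (+-monoˡ-≤ 1 (*-monoˡ-≤ (suc w + factor halving * w) (≤-trans (<⇒≤ (≤-<-trans u≤ v<)) B≤D)))
          (halve-loop (a * 1) (literalPos h v) p≤ a≤ (pop-≤ v< Ψ≤) j≤ f≤ len≤ s≤ (*1-≤ a≤) (≤-trans u≤ v≤) t≤ z≤n M≤))
        (⟶-block testLiteral 1≤w
          (regs-≤ p≤ a≤ (pop-≤ v< Ψ≤) j≤ f≤ len≤ s≤ (≤-trans (shift-≤ (literalPos h v) (a * 1)) (*1-≤ a≤)) z≤n t≤ z≤n , M≤)))
      where
        read : ℕ → ℕ → List ℕ
        read r v = regs ptr a r j f (suc len) (literalSign v) (a * 1) (literalPos h v) (1 ∸ ∣ literalGroup h v - i ∣′) 0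
        v≤ : v ≤ V
        v≤ = ≤-trans (<⇒≤ v<) B≤
        s≤ : literalSign v ≤ V
        s≤ = ≤-trans (m∸n≤m v (literalVar v * 2)) v≤
        u≤ : literalPos h v ≤ v
        u≤ = ≤-trans (m∸n≤m (literalVar v) (literalGroup h v * h)) (m/n≤m v 2)
        t≤ : 1 ∸ ∣ literalGroup h v - i ∣′ ≤ V
        t≤ = ≤-trans (m∸n≤m 1 ∣ literalGroup h v - i ∣′) (small (s≤s z≤n))

    -- The invariant `f + length c ≤ B` bounds the count of true literals: it rises by at most one
    -- while the clause gets shorter by one.
    lits-loop : ∀ i c rest {ptr a j M} f → All (_< B) c → ptr ≤ V → a ≤ V → pack B (c ++ rest) ≤ V → j ≤ V →
      f + length c ≤ B → MBounded M →
      while≢0 rLEN (literalBody i) ⊢ (regs ptr a (pack B (c ++ rest)) j f (length c) 0 0 0 0 0 , M) ⟶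
        (regs ptr a (pack B rest) j (trueCount h i a f c) 0 0 0 0 0 0 , M) ⟨ length c * (suc w + tLit i) + 1 ⟩
    lits-loop i []      rest f []          p≤ a≤ Ψ≤ j≤ f≤ M≤ = loop-done {w = w} {t = tLit i} refl
    lits-loop i (v ∷ c) rest {a = a} f (v< ∷ c<) p≤ a≤ Ψ≤ j≤ f≤ M≤ =
      loop-next w (length c) refl len≤
        (lit-step i v (pack B (c ++ rest)) v< p≤ a≤ Ψ≤ j≤ (≤-trans (m≤m+n f _) (≤-trans f≤ B≤)) len≤ M≤)
        (lits-loop i c rest (f + litTrue h i a v) c< p≤ a≤ (pop-≤ v< Ψ≤) j≤ f′≤ M≤)
      where
        len≤ : suc (length c) ≤ V
        len≤ = ≤-trans (m≤n+m _ f) (≤-trans f≤ B≤)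
        f′≤ : f + litTrue h i a v + length c ≤ B
        f′≤ = ≤-trans (+-monoˡ-≤ (length c) (+-monoʳ-≤ f (litTrue-≤1 h i a v))) (≤-trans (≤-reflexive (+-assoc f 1 (length c))) f≤)

    letters-≤ : ∀ (xs : List Letter) → All (_≤ V) (map toℕ xs)
    letters-≤ []       = []
    letters-≤ (x ∷ xs) = small (≤-pred (toℕ<n x)) ∷ letters-≤ xs

    exec-emit : ∀ xs {ptr a Ψ j flag len pw u t y M} →
      exec (emit xs) (regs ptr a Ψ j flag len 0 pw u t y , M) ≡
      (regs (ptr + length xs) a Ψ j flag len 0 pw u t y , writes M ptr (map toℕ xs))
    exec-emit [] {ptr} {a} {Ψ} {j} {flag} {len} {pw} {u} {t} {y} {M} =
      cong (λ p → regs p a Ψ j flag len 0 pw u t y , M) (sym (+-identityʳ ptr))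
    exec-emit (x ∷ xs) {ptr} {a} {Ψ} {j} {flag} {len} {pw} {u} {t} {y} {M} = trans
      (exec-emit xs {ptr + 1} {a} {Ψ} {j} {flag} {len} {pw} {u} {t} {y} {update M ptr (toℕ x)})
      (cong (λ p → regs p a Ψ j flag len 0 pw u t y , writes M ptr (map toℕ (x ∷ xs))) (+-assoc ptr 1 (length xs)))

    exec-mark : ∀ i {ptr a Ψ j flag M} →
      exec (emitMark i) (regs ptr a Ψ (suc j) flag 0 0 0 0 0 0 , M) ≡
      (regs (ptr + 1) a Ψ j 0 0 0 0 0 0 0 , writes M ptr (toℕ (mark i (positive flag)) ∷ []))
    exec-mark zero    {flag = zero}  = refl
    exec-mark zero    {flag = suc n} rewrite 0∸n≡0 n = refl
    exec-mark (suc i) {flag = zero}  = refl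
    exec-mark (suc i) {flag = suc n} rewrite 0∸n≡0 n = refl

    exec-gadget : ∀ i {ptr a Ψ j flag M} →
      exec (emitGadget K i) (regs ptr a Ψ (suc j) flag 0 0 0 0 0 0 , M) ≡
      (regs (ptr + length (gadget K i (positive flag))) a Ψ j 0 0 0 0 0 0 0 , writes M ptr (map toℕ (gadget K i (positive flag))))
    exec-gadget i {ptr} {a} {Ψ} {j} {flag} {M} = begin
      exec (emit bs ++ emitMark i ++ emit cs) c
        ≡⟨ exec-++ (emit bs) (emitMark i ++ emit cs) c ⟩
      exec (emitMark i ++ emit cs) (exec (emit bs) c)
        ≡⟨ cong (exec (emitMark i ++ emit cs)) (exec-emit bs) ⟩
      exec (emitMark i ++ emit cs) c₁
        ≡⟨ exec-++ (emitMark i) (emit cs) c₁ ⟩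
      exec (emit cs) (exec (emitMark i) c₁)
        ≡⟨ cong (exec (emit cs)) (exec-mark i {ptr + length bs} {a} {Ψ} {j} {flag} {M₁}) ⟩
      exec (emit cs) (regs (ptr + length bs + 1) a Ψ j 0 0 0 0 0 0 0 , writes M₁ (ptr + length bs) (toℕ x ∷ []))
        ≡⟨ exec-emit cs ⟩
      (regs (ptr + length bs + 1 + length cs) a Ψ j 0 0 0 0 0 0 0 , writes M₁ (ptr + length bs) (toℕ x ∷ map toℕ cs))
        ≡⟨ cong₂ (λ p N → regs p a Ψ j 0 0 0 0 0 0 0 , N) len mem ⟩
      (regs (ptr + length g) a Ψ j 0 0 0 0 0 0 0 , writes M ptr (map toℕ g))
        ∎
      where
        open ≡-Reasoning
        x = mark i (positive flag)
        bs = before K i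
        cs = after K i ++ $ ∷ []
        g = gadget K i (positive flag)
        c = (regs ptr a Ψ (suc j) flag 0 0 0 0 0 0 , M)
        M₁ = writes M ptr (map toℕ bs)
        c₁ = (regs (ptr + length bs) a Ψ (suc j) flag 0 0 0 0 0 0 , M₁)
        g≡ : g ≡ bs ++ x ∷ cs
        g≡ = ++-assoc bs (x ∷ after K i) ($ ∷ [])
        len : ptr + length bs + 1 + length cs ≡ ptr + length g
        len = trans (+-assoc (ptr + length bs) 1 _) (trans (+-assoc ptr (length bs) _)
          (cong (ptr +_) (trans (sym (length-++ bs)) (cong length (sym g≡)))))
        mem : writes M₁ (ptr + length bs) (toℕ x ∷ map toℕ cs) ≡ writes M ptr (map toℕ g)
        mem = trans (writes-letters-++ M ptr bs (x ∷ cs)) (cong (writes M ptr ∘ letters) (sym g≡))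

    writes-MBounded : ∀ {M} ptr xs → MBounded M → MBounded (writes M ptr (letters xs))
    writes-MBounded ptr xs M≤ = writes-≤ _ ptr (letters-≤ xs) M≤

    good : ℕ → ℕ → List ℕ → Bool
    good i a = satisfied h i a

    clause-step : ∀ i c rest {ptr a j M} → All (_< B) (withLength c) → ptr ≤ V → a ≤ V →
      pack B (withLength c ++ rest) ≤ V → suc j ≤ V → MBounded M →
      clauseBody K i ⊢ (regs ptr a (pack B (withLength c ++ rest)) (suc j) 0 0 0 0 0 0 0 , M) ⟶
        (regs (ptr + length (gadget K i (good i a c))) a (pack B rest) j 0 0 0 0 0 0 0 ,
         writes M ptr (letters (gadget K i (good i a c)))) ⟨ tClause i ⟩
    clause-step i c rest {ptr} {a} {j} {M} (len< ∷ c<) p≤ a≤ Ψ≤ j≤ M≤ = ⟶-seq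
      (⟶-post (⟶-block readClause 1≤w (regs-≤ p≤ a≤ Ψ≤ j≤ z≤n z≤n z≤n z≤n z≤n z≤n z≤n , M≤))
        (cong₂ read (pop-rest B r len<) (pop-digit B r len<)) (λ _ → refl))
      (⟶-seq
        (⟶-weaken (+-monoˡ-≤ 1 (*-monoˡ-≤ (suc w + tLit i) (≤-trans (<⇒≤ len<) B≤D)))
          (lits-loop i c rest 0 c< p≤ a≤ (pop-≤ len< Ψ≤) j≤ (<⇒≤ len<) M≤))
        (subst (λ d → block (emitGadget K i) ⊢ start ⟶ d ⟨ factor (emitGadget K i) * w ⟩) (exec-gadget i)
          (⟶-block (emitGadget K i) 1≤w (regs-≤ p≤ a≤ rest≤ j≤ (≤-trans (trueCount-≤ h i a 0 c) (≤-trans (<⇒≤ len<) B≤)) z≤n z≤n z≤n z≤n z≤n z≤n , M≤))))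
      where
        r = pack B (c ++ rest)
        start = (regs ptr a (pack B rest) (suc j) (trueCount h i a 0 c) 0 0 0 0 0 0 , M)
        read : ℕ → ℕ → List ℕ
        read r len = regs ptr a r (suc j) 0 len 0 0 0 0 0
        rest≤ : pack B rest ≤ V
        rest≤ = suffix-≤ c c< (pop-≤ len< Ψ≤)

    +-letters-≤ : ∀ {p b} (xs : List Letter) {ys : List Letter} → p + length (xs ++ ys) ≤ b → p + length xs + length ys ≤ b
    +-letters-≤ {p} xs le = ≤-trans (≤-reflexive (trans (+-assoc p (length xs) _) (cong (p +_) (sym (length-++ xs))))) le

    +-letters : ∀ p (xs : List Letter) {ys : List Letter} → p + length xs + length ys ≡ p + length (xs ++ ys)
    +-letters p xs = trans (+-assoc p (length xs) _) (cong (p +_) (sym (length-++ xs)))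

    clauses-loop : ∀ i cs {ptr a M} → All (λ c → All (_< B) (withLength c)) cs →
      ptr + length (gadgets K i (good i a) cs) ≤ V → a ≤ V →
      pack B (concatMap withLength cs) ≤ V → length cs ≤ V → MBounded M →
      while≢0 rJ (clauseBody K i) ⊢ (regs ptr a (pack B (concatMap withLength cs)) (length cs) 0 0 0 0 0 0 0 , M) ⟶
        (regs (ptr + length (gadgets K i (good i a) cs)) a 0 0 0 0 0 0 0 0 0 ,
         writes M ptr (letters (gadgets K i (good i a) cs))) ⟨ length cs * (suc w + tClause i) + 1 ⟩
    clauses-loop i [] {ptr} {a} {M} [] p≤ a≤ Ψ≤ j≤ M≤ =
      ⟶-post (loop-done {w = w} {t = tClause i} refl) (cong (λ p → regs p a 0 0 0 0 0 0 0 0 0) (sym (+-identityʳ ptr))) (λ _ → refl)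
    clauses-loop i (c ∷ cs) {ptr} {a} {M} (c< ∷ cs<) p≤ a≤ Ψ≤ j≤ M≤ =
      loop-next w (length cs) refl j≤
        (clause-step i c rest c< (≤-trans (m≤m+n ptr _) p≤) a≤ Ψ≤ j≤ M≤)
        (subst₂ (λ p N → while≢0 rJ (clauseBody K i) ⊢ start ⟶ (regs p a 0 0 0 0 0 0 0 0 0 , N) ⟨ length cs * (suc w + tClause i) + 1 ⟩)
          (+-letters ptr g) (writes-letters-++ M ptr g gs)
          (clauses-loop i cs cs< (+-letters-≤ g p≤) a≤ rest≤ (≤-trans (n≤1+n _) j≤) (writes-MBounded ptr g M≤)))
      where
        rest = concatMap withLength cs
        g  = gadget K i (good i a c)
        gs = gadgets K i (good i a) cs
        start = (regs (ptr + length g) a (pack B rest) (length cs) 0 0 0 0 0 0 0 , writes M ptr (letters g))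
        rest≤ : pack B rest ≤ V
        rest≤ = suffix-≤ (withLength c) c< Ψ≤

    pads-loop : ∀ i u {ptr a M} → ptr + u ≤ V → a ≤ V → u ≤ V → MBounded M →
      while≢0 rU (block (emitPad i)) ⊢ (regs ptr a 0 0 0 0 0 0 u 0 0 , M) ⟶
        (regs (ptr + u) a 0 0 0 0 0 0 0 0 0 , writes M ptr (letters (replicate u (pad i)))) ⟨ u * (suc w + factor (emitPad i) * w) + 1 ⟩
    pads-loop i zero {ptr} {a} p≤ a≤ u≤ M≤ =
      ⟶-post (loop-done {w = w} {t = factor (emitPad i) * w} refl) (cong (λ p → regs p a 0 0 0 0 0 0 0 0 0) (sym (+-identityʳ ptr))) (λ _ → refl)
    pads-loop i (suc u) {ptr} {a} {M} p≤ a≤ u≤ M≤ = loop-next w u refl u≤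
      (⟶-block (emitPad i) 1≤w (regs-≤ (≤-trans (m≤m+n ptr _) p≤) a≤ z≤n z≤n z≤n z≤n z≤n z≤n u≤ z≤n z≤n , M≤))
      (⟶-post (pads-loop i u (≤-trans (≤-reflexive (+-assoc ptr 1 u)) p≤) a≤ (≤-trans (n≤1+n u) u≤) (writes-MBounded ptr (pad i ∷ []) M≤))
        (cong (λ p → regs p a 0 0 0 0 0 0 0 0 0) (+-assoc ptr 1 u)) (λ _ → refl))

    vector : ℕ → ℕ → List Letter
    vector i a = gadgets K i (good i a) clauses

    block-step : ∀ i a {ptr M} → ptr + length (replicate (suc L) (pad i) ++ vector i a) ≤ V → suc a ≤ V → MBounded M →
      blockBody K i ⊢ (regs ptr (suc a) 0 0 0 0 0 0 0 0 0 , M) ⟶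
        (regs (ptr + length (replicate (suc L) (pad i) ++ vector i a)) a 0 0 0 0 0 0 0 0 0 ,
         writes M ptr (letters (replicate (suc L) (pad i) ++ vector i a))) ⟨ tBlock i ⟩
    block-step i a {ptr} {M} p≤ a≤ M≤ = ⟶-seq
      (⟶-post (⟶-block startBlock 1≤w (regs-≤ (≤-trans (m≤m+n ptr _) p≤) a≤ z≤n z≤n z≤n z≤n z≤n z≤n z≤n z≤n z≤n , M≤))
        (cong (λ u → regs ptr a 0 0 0 0 0 0 u 0 0) (trans (*-identityʳ pl) (+-comm L 1))) (λ _ → refl))
      (⟶-seq
        (⟶-weaken (+-monoˡ-≤ 1 (*-monoˡ-≤ (suc w + factor (emitPad i) * w) (≤-trans (≤-reflexive (+-comm 1 L)) pl≤D)))
          (⟶-post (pads-loop i (suc L) (≤-trans (+-monoʳ-≤ ptr (≤-reflexive (sym (length-replicate (suc L))))) p′≤)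
              (≤-trans (n≤1+n a) a≤) (≤-trans (≤-reflexive (+-comm 1 L)) pl≤) M≤)
            (cong (λ n → regs (ptr + n) a 0 0 0 0 0 0 0 0 0) (sym (length-replicate (suc L)))) (λ _ → refl)))
        (⟶-seq
          (⟶-post (⟶-block startGadgets 1≤w (regs-≤ p′≤ (≤-trans (n≤1+n a) a≤) z≤n z≤n z≤n z≤n z≤n z≤n z≤n z≤n z≤n , M′≤))
            (cong₂ (λ Ψ j → regs (ptr + length ps) a Ψ j 0 0 0 0 0 0 0) (*-identityʳ Φ) (trans (*-identityʳ m) (sym |clauses|))) (λ _ → refl))
          (⟶-weaken (+-monoˡ-≤ 1 (*-monoˡ-≤ (suc w + tClause i) (≤-trans (≤-reflexive |clauses|) m≤D)))
            (subst₂ (λ p N → while≢0 rJ (clauseBody K i) ⊢ start ⟶ (regs p a 0 0 0 0 0 0 0 0 0 , N) ⟨ length clauses * (suc w + tClause i) + 1 ⟩)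
              (+-letters ptr ps) (writes-letters-++ M ptr ps (vector i a))
              (clauses-loop i clauses digits (+-letters-≤ ps p≤) (≤-trans (n≤1+n a) a≤) Φ≤ (≤-trans (≤-reflexive |clauses|) m≤) M′≤)))))
      where
        ps = replicate (suc L) (pad i)
        p′≤ : ptr + length ps ≤ V
        p′≤ = ≤-trans (m≤m+n _ (length (vector i a))) (+-letters-≤ ps p≤)
        M′≤ : MBounded (writes M ptr (letters ps))
        M′≤ = writes-MBounded ptr ps M≤
        start = (regs (ptr + length ps) a Φ (length clauses) 0 0 0 0 0 0 0 , writes M ptr (letters ps))

    -- The block of assignment `a` is written just after the counter has dropped to `a`; this is the
    -- descending order used by `blocks`.
    blocks-loop : ∀ i a {ptr M} → ptr + length (blocks (pad i) L (vector i) a) ≤ V → a ≤ V → MBounded M →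
      while≢0 rA (blockBody K i) ⊢ (regs ptr a 0 0 0 0 0 0 0 0 0 , M) ⟶
        (regs (ptr + length (blocks (pad i) L (vector i) a)) 0 0 0 0 0 0 0 0 0 0 ,
         writes M ptr (letters (blocks (pad i) L (vector i) a))) ⟨ a * (suc w + tBlock i) + 1 ⟩
    blocks-loop i zero {ptr} p≤ a≤ M≤ =
      ⟶-post (loop-done {w = w} {t = tBlock i} refl) (cong (λ p → regs p 0 0 0 0 0 0 0 0 0 0) (sym (+-identityʳ ptr))) (λ _ → refl)
    blocks-loop i (suc a) {ptr} {M} p≤ a≤ M≤ = loop-next w a refl a≤
      (block-step i a (≤-trans (m≤m+n _ (length (blocks (pad i) L (vector i) a))) (+-letters-≤ bs p′≤)) a≤ M≤)
      (subst₂ (λ p N → while≢0 rA (blockBody K i) ⊢ start ⟶ (regs p 0 0 0 0 0 0 0 0 0 0 , N) ⟨ a * (suc w + tBlock i) + 1 ⟩)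
        (trans (+-letters ptr bs) (cong (λ xs → ptr + length xs) eq))
        (trans (writes-letters-++ M ptr bs _) (cong (writes M ptr ∘ letters) eq))
        (blocks-loop i a (+-letters-≤ bs p′≤) (≤-trans (n≤1+n a) a≤) (writes-MBounded ptr bs M≤)))
      where
        bs = replicate (suc L) (pad i) ++ vector i a
        start = (regs (ptr + length bs) a 0 0 0 0 0 0 0 0 0 , writes M ptr (letters bs))
        eq : bs ++ blocks (pad i) L (vector i) a ≡ blocks (pad i) L (vector i) (suc a)
        eq = ++-assoc (replicate (suc L) (pad i)) (vector i a) _
        p′≤ : ptr + length (bs ++ blocks (pad i) L (vector i) a) ≤ V
        p′≤ = ≤-trans (≤-reflexive (cong (λ xs → ptr + length xs) eq)) p≤

    string : ℕ → List Letter
    string i = blocks (pad i) L (vector i) N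

    strings : ℕ → ℕ → List Letter
    strings i zero    = []
    strings i (suc c) = string i ++ strings (suc i) c

    string-step : ∀ i {ptr M} → ptr + length (string i) ≤ V → MBounded M →
      emitString K i ⊢ (regs ptr 0 0 0 0 0 0 0 0 0 0 , M) ⟶
        (regs (ptr + length (string i)) 0 0 0 0 0 0 0 0 0 0 , writes M ptr (letters (string i))) ⟨ tString i ⟩
    string-step i {ptr} p≤ M≤ = ⟶-seq
      (⟶-post (⟶-block startString 1≤w (regs-≤ (≤-trans (m≤m+n ptr _) p≤) z≤n z≤n z≤n z≤n z≤n z≤n z≤n z≤n z≤n z≤n , M≤))
        (cong (λ a → regs ptr a 0 0 0 0 0 0 0 0 0) (*-identityʳ N)) (λ _ → refl))
      (blocks-loop i N p≤ N≤ M≤)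

    tStrings : ℕ → ℕ → ℕ
    tStrings i zero    = 1
    tStrings i (suc c) = tString i + tStrings (suc i) c

    strings-steps : ∀ i c {ptr M} → ptr + length (strings i c) ≤ V → MBounded M →
      emitStrings K i c ⊢ (regs ptr 0 0 0 0 0 0 0 0 0 0 , M) ⟶
        (regs (ptr + length (strings i c)) 0 0 0 0 0 0 0 0 0 0 , writes M ptr (letters (strings i c))) ⟨ tStrings i c ⟩
    strings-steps i zero {ptr} p≤ M≤ = ⟶-post ⟶-skip (cong (λ p → regs p 0 0 0 0 0 0 0 0 0 0) (sym (+-identityʳ ptr))) (λ _ → refl)
    strings-steps i (suc c) {ptr} {M} p≤ M≤ = ⟶-seq
      (string-step i (≤-trans (m≤m+n _ (length (strings (suc i) c))) (+-letters-≤ (string i) p≤)) M≤)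
      (subst₂ (λ p N → emitStrings K (suc i) c ⊢ start ⟶ (regs p 0 0 0 0 0 0 0 0 0 0 , N) ⟨ tStrings (suc i) c ⟩)
        (+-letters ptr (string i)) (writes-letters-++ M ptr (string i) _)
        (strings-steps (suc i) c (+-letters-≤ (string i) p≤) (writes-MBounded ptr (string i) M≤)))
      where start = (regs (ptr + length (string i)) 0 0 0 0 0 0 0 0 0 0 , writes M ptr (letters (string i)))

-- Formulas and their instances

bit : Bool → ℕ
bit b = if b then 1 else 0

bit≡ᵇ1 : ∀ b → (bit b ≡ᵇ 1) ≡ b
bit≡ᵇ1 true  = refl
bit≡ᵇ1 false = refl

half : ∀ b x → (bit b + x * 2) / 2 ≡ x
half b x = trans (+-distrib-/-∣ʳ (bit b) (divides x refl)) (cong₂ _+_ (small b) (m*n/n≡m x 2))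
  where
    small : ∀ b → bit b / 2 ≡ 0
    small true  = refl
    small false = refl

parity-bit : ∀ b x → parity (bit b + x * 2) ≡ bit b
parity-bit b x = trans (cong (λ z → bit b + x * 2 ∸ z * 2) (half b x)) (m+n∸n≡m (bit b) (x * 2))

encodeLiteral< : ∀ {n} (l : Literal n) → encodeLiteral l < n + n
encodeLiteral< {n} (b , v) = ≤-trans (s≤s (+-monoˡ-≤ (2 * toℕ v) (bit≤1 b))) (≤-trans (≤-reflexive eq) (+-mono-≤ (toℕ<n v) (toℕ<n v)))
  where
    bit≤1 : ∀ b → bit b ≤ 1
    bit≤1 true  = ≤-refl
    bit≤1 false = z≤n
    eq : 2 + 2 * toℕ v ≡ suc (toℕ v) + suc (toℕ v)
    eq = solve 1 (λ x → con 2 :+ con 2 :* x := con 1 :+ x :+ (con 1 :+ x)) refl (toℕ v)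
      where open +-*-Solver

∣-∣′-refl : ∀ a → ∣ a - a ∣′ ≡ 0
∣-∣′-refl a = cong₂ _+_ (n∸n≡0 a) (n∸n≡0 a)

∣-∣′-zero : ∀ a b → ∣ a - b ∣′ ≡ 0 → a ≡ b
∣-∣′-zero a b eq = ≤-antisym (m∸n≡0⇒m≤n (m+n≡0⇒m≡0 (a ∸ b) eq)) (m∸n≡0⇒m≤n (m+n≡0⇒n≡0 (a ∸ b) eq))

-- Bit 0 is the least significant one, so that `shift u` exposes bit `u` to `parity`.
fromBits : (ℕ → Bool) → ℕ → ℕ
fromBits f zero    = 0
fromBits f (suc h) = bit (f 0) + fromBits (f ∘ suc) h * 2

fromBits<2^ : ∀ f h → fromBits f h < 2 ^ h
fromBits<2^ f zero    = s≤s z≤n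
fromBits<2^ f (suc h) = begin-strict
  bit (f 0) + r * 2     <⟨ +-monoˡ-< (r * 2) (bit<2 (f 0)) ⟩
  2 + r * 2             ≡⟨⟩
  suc r * 2             ≤⟨ *-monoˡ-≤ 2 (fromBits<2^ (f ∘ suc) h) ⟩
  2 ^ h * 2             ≡⟨ *-comm (2 ^ h) 2 ⟩
  2 ^ suc h             ∎
  where
    open ≤-Reasoning
    r = fromBits (f ∘ suc) h
    bit<2 : ∀ b → bit b < 2
    bit<2 true  = s≤s (s≤s z≤n)
    bit<2 false = s≤s z≤n

parity-shift : ∀ f h u → u < h → parity (shift u (fromBits f h)) ≡ bit (f u)
parity-shift f (suc h) zero    _        = parity-bit (f 0) (fromBits (f ∘ suc) h)
parity-shift f (suc h) (suc u) (s≤s lt) =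
  trans (cong (parity ∘ shift u) (half (f 0) (fromBits (f ∘ suc) h))) (parity-shift (f ∘ suc) h u lt)

module Literals (n k : ℕ) (h : ℕ) (n<kh : n < k * suc h) where

  H = suc h

  group pos : ℕ → ℕ
  group x = x / H
  pos   x = x ∸ x / H * H

  pos≡% : ∀ x → pos x ≡ x % H
  pos≡% x = sym (m%n≡m∸m/n*n x H)

  encode≡ : ∀ b (v : Fin n) → encodeLiteral (b , v) ≡ bit b + toℕ v * 2
  encode≡ b v = cong (bit b +_) (*-comm 2 (toℕ v))

  Makes : ℕ → ℕ → Literal n → Set
  Makes i a (b , v) = group (toℕ v) ≡ i × parity (shift (pos (toℕ v)) a) ≡ bit b

  litTrue-encode : ∀ i a b (v : Fin n) → litTrue H i a (encodeLiteral (b , v)) ≡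
                   (1 ∸ ∣ group (toℕ v) - i ∣′) ∸ ∣ parity (shift (pos (toℕ v)) a) - bit b ∣′
  litTrue-encode i a b v = trans (cong (litTrue H i a) (encode≡ b v))
    (trans (cong₂ (λ x s → (1 ∸ ∣ group x - i ∣′) ∸ ∣ parity (shift (pos x) (a * 1)) - s ∣′)
      (half b (toℕ v)) (parity-bit b (toℕ v)))
      (cong (λ a → (1 ∸ ∣ group (toℕ v) - i ∣′) ∸ ∣ parity (shift (pos (toℕ v)) a) - bit b ∣′) (*-identityʳ a)))

  litTrue-sound : ∀ i a b (v : Fin n) → 1 ≤ litTrue H i a (encodeLiteral (b , v)) →
                  group (toℕ v) ≡ i × parity (shift (pos (toℕ v)) a) ≡ bit b
  litTrue-sound i a b v le = ∣-∣′-zero (group (toℕ v)) i (zero₁ d e le′) , ∣-∣′-zero (parity (shift (pos (toℕ v)) a)) (bit b) (zero₂ d e le′)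
    where
      d = ∣ group (toℕ v) - i ∣′
      e = ∣ parity (shift (pos (toℕ v)) a) - bit b ∣′
      le′ : 1 ≤ (1 ∸ d) ∸ e
      le′ = ≤-trans le (≤-reflexive (litTrue-encode i a b v))
      zero₁ : ∀ d e → 1 ≤ (1 ∸ d) ∸ e → d ≡ 0
      zero₁ zero    e       _  = refl
      zero₁ (suc d) e       le = contradiction (≤-trans le (≤-reflexive (trans (cong (_∸ e) (0∸n≡0 d)) (0∸n≡0 e)))) λ ()
      zero₂ : ∀ d e → 1 ≤ (1 ∸ d) ∸ e → e ≡ 0
      zero₂ d zero    _  = refl
      zero₂ d (suc e) le = contradiction (≤-trans le (≤-trans (∸-monoˡ-≤ (suc e) (m∸n≤m 1 d)) (≤-reflexive (0∸n≡0 e)))) λ ()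

  litTrue-complete : ∀ i a b (v : Fin n) → group (toℕ v) ≡ i → parity (shift (pos (toℕ v)) a) ≡ bit b →
                     1 ≤ litTrue H i a (encodeLiteral (b , v))
  litTrue-complete i a b v refl eq = ≤-reflexive (sym (trans (litTrue-encode i a b v)
    (cong₂ (λ d e → (1 ∸ d) ∸ e) (∣-∣′-refl i) (trans (cong (λ p → ∣ p - bit b ∣′) eq) (∣-∣′-refl (bit b))))))

  satisfied-sound : ∀ i a (c : Clause n) f → 1 ≤ trueCount H i a f (map encodeLiteral c) →
                    1 ≤ f ⊎ Any (Makes i a) c
  satisfied-sound i a []            f le = inj₁ le
  satisfied-sound i a ((b , v) ∷ c) f le with satisfied-sound i a c _ le
  ... | inj₂ p = inj₂ (there p)
  ... | inj₁ q with f
  ...   | suc _ = inj₁ (s≤s z≤n)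
  ...   | zero  = inj₂ (here (litTrue-sound i a b v q))

  trueCount-mono : ∀ i a f c → f ≤ trueCount H i a f c
  trueCount-mono i a f []      = ≤-refl
  trueCount-mono i a f (v ∷ c) = ≤-trans (m≤m+n f _) (trueCount-mono i a _ c)

  satisfied-complete : ∀ i a (c : Clause n) f →
                       Any (Makes i a) c →
                       1 ≤ trueCount H i a f (map encodeLiteral c)
  satisfied-complete i a ((b , v) ∷ c) f (here (g , e)) =
    ≤-trans (≤-trans (litTrue-complete i a b v g e) (m≤n+m _ f)) (trueCount-mono i a _ (map encodeLiteral c))
  satisfied-complete i a ((b , v) ∷ c) f (there p) = satisfied-complete i a c _ p

  positive⇒ : ∀ {x} → positive x ≡ true → 1 ≤ x
  positive⇒ {suc x} _ = s≤s z≤n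

  ⇒positive : ∀ {x} → 1 ≤ x → positive x ≡ true
  ⇒positive (s≤s _) = refl

  -- Defined for arbitrary numbers `as i`, since `Window.window` returns a block number without a
  -- bound.
  assignment : (ℕ → ℕ) → Fin n → Bool
  assignment as v = parity (shift (pos (toℕ v)) (as (group (toℕ v)))) ≡ᵇ 1

  assignment-sound : ∀ (as : ℕ → ℕ) i (c : Clause n) → satisfied H i (as i) (map encodeLiteral c) ≡ true →
                     Any (λ (b , v) → assignment as v ≡ b) c
  assignment-sound as i c sat with satisfied-sound i (as i) c 0 (positive⇒ sat)
  ... | inj₂ p = Any.map (λ { {b , v} (refl , e) → trans (cong (_≡ᵇ 1) e) (bit≡ᵇ1 b) }) p

  -- The groups together have more than `n` positions; those that belong to no variable get the
  -- value `false`.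
  extend : (Fin n → Bool) → ℕ → Bool
  extend α x with x <? n
  ... | yes x<n = α (fromℕ< x<n)
  ... | no _    = false

  extend-toℕ : ∀ α v → extend α (toℕ v) ≡ α v
  extend-toℕ α v with toℕ v <? n
  ... | yes lt = cong α (fromℕ<-toℕ v lt)
  ... | no ¬lt = contradiction (toℕ<n v) ¬lt

  encodeGroup : (Fin n → Bool) → ℕ → ℕ
  encodeGroup α i = fromBits (λ u → extend α (i * H + u)) H

  group<k : ∀ (v : Fin n) → group (toℕ v) < k
  group<k v = m<n*o⇒m/o<n (<-trans (toℕ<n v) n<kh)

  encodeGroup-makes : ∀ α v → Makes (group (toℕ v)) (encodeGroup α (group (toℕ v))) (α v , v)
  encodeGroup-makes α v = refl , trans
    (parity-shift (λ u → extend α (g * H + u)) H (pos x) (≤-trans (≤-reflexive (cong suc (pos≡% x))) (m%n<n x H)))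
    (cong bit (trans (cong (extend α) back) (extend-toℕ α v)))
    where
      x = toℕ v
      g = group x
      back : g * H + pos x ≡ x
      back = trans (+-comm (g * H) (pos x)) (trans (cong (_+ g * H) (pos≡% x)) (sym (m≡m%n+[m/n]*n x H)))

  encodeGroup-Any : ∀ α (c : Clause n) → Any (λ (b , v) → α v ≡ b) c →
                    ∃[ i ] i < k × Any (Makes i (encodeGroup α i)) c
  encodeGroup-Any α ((b , v) ∷ c) (here refl) = group (toℕ v) , group<k v , here (encodeGroup-makes α v)
  encodeGroup-Any α (l ∷ c)       (there p) with encodeGroup-Any α c p
  ... | i , i<k , q = i , i<k , there q

  assignment-complete : ∀ α (c : Clause n) → Any (λ (b , v) → α v ≡ b) c →
                        ∃[ i ] i < k × satisfied H i (encodeGroup α i) (map encodeLiteral c) ≡ true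
  assignment-complete α c p with encodeGroup-Any α c p
  ... | i , i<k , q = i , i<k , ⇒positive (satisfied-complete i (encodeGroup α i) c 0 q)

-- Lengths of gadgets and absence of foreign pads

length-10s : ∀ n → length (10s n) ≡ n + n
length-10s zero    = refl
length-10s (suc n) = cong suc (trans (cong suc (length-10s n)) (sym (+-suc n n)))

length-01s : ∀ n → length (01s n) ≡ n + n
length-01s zero    = refl
length-01s (suc n) = cong suc (trans (cong suc (length-01s n)) (sym (+-suc n n)))

-- That the gadgets of string 0 and of the later strings are equally long lets a single `L` serve
-- all strings.
length-gadget : ∀ K i b → i ≤ suc K → length (gadget (suc K) i b) ≡ 2 * suc (suc K)
length-gadget K i b i≤ = trans (length-++ (core (suc K) i b)) (trans (cong (_+ 1) (trans (length-++ (before (suc K) i)) (go i i≤)))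
    (solve 1 (λ x → con 3 :+ x :+ x :+ con 1 := con 2 :* (con 2 :+ x)) refl K))
  where
    open +-*-Solver
    go : ∀ i → i ≤ suc K → length (before (suc K) i) + suc (length (after (suc K) i)) ≡ 3 + K + K
    go zero    _ = trans (cong₂ (λ x y → x + suc y) (trans (length-++ (0s (suc K))) (cong (_+ 1) (length-replicate (suc K)))) (length-replicate K))
      (solve 1 (λ x → con 1 :+ x :+ con 1 :+ (con 1 :+ x) := con 3 :+ x :+ x) refl K)
    go (suc i) (s≤s i≤) = trans (cong₂ (λ x y → x + suc y) (length-10s (suc i)) (length-01s (K ∸ i)))
      (subst (λ z → suc i + suc i + suc (K ∸ i + (K ∸ i)) ≡ 3 + z + z) (m+[n∸m]≡n i≤)
        (solve 2 (λ i d → con 1 :+ i :+ (con 1 :+ i) :+ (con 1 :+ (d :+ d)) := con 3 :+ (i :+ d) :+ (i :+ d)) refl i (K ∸ i)))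

length-gadgets : ∀ {C : Set} K i (good : C → Bool) cs → i ≤ suc K →
                 length (gadgets (suc K) i good cs) ≡ length cs * (2 * suc (suc K))
length-gadgets K i good []       i≤ = refl
length-gadgets K i good (c ∷ cs) i≤ = trans (length-++ (gadget (suc K) i (good c)))
  (cong₂ _+_ (length-gadget K i (good c) i≤) (length-gadgets K i good cs i≤))

-- Established for `4F` in string 0 and for `3F` in string 1; together they exclude both pads from a
-- common subsequence.
Avoids : Letter → ℕ → Set
Avoids p i = ∀ K b → All (_≢ p) (gadget K i b)

All-0s : ∀ {p} → 0F ≢ p → ∀ n → All (_≢ p) (0s n)
All-0s ne n = All-replicate⁺ n ne

avoids-4F : Avoids 4F 0
avoids-4F K b = All-++⁺ (All-++⁺ (All-++⁺ (All-0s (λ ()) K) ((λ ()) ∷ [])) (mk b ∷ All-0s (λ ()) (K ∸ 1))) ((λ ()) ∷ [])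
  where
    mk : ∀ b → mark 0 b ≢ 4F
    mk true  ()
    mk false ()

All-01s : ∀ n → All (_≢ 3F) (01s n)
All-01s zero    = []
All-01s (suc n) = (λ ()) ∷ (λ ()) ∷ All-01s n

avoids-3F : Avoids 3F 1
avoids-3F K b = All-++⁺ {xs = 1F ∷ 0F ∷ mark 1 b ∷ 01s (K ∸ 1)} ((λ ()) ∷ (λ ()) ∷ mk b ∷ All-01s (K ∸ 1)) ((λ ()) ∷ [])
  where
    mk : ∀ b → mark 1 b ≢ 3F
    mk true  ()
    mk false ()

avoids-gadgets : ∀ {C : Set} {p i} → Avoids p i → ∀ K (good : C → Bool) cs → All (_≢ p) (gadgets K i good cs)
avoids-gadgets av K good []       = []
avoids-gadgets av K good (c ∷ cs) = All-++⁺ (av K (good c)) (avoids-gadgets av K good cs)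

avoids-blocks : ∀ {p q L v} → q ≢ p → (∀ a → All (_≢ p) (v a)) → ∀ n → All (_≢ p) (blocks q L v n)
avoids-blocks     ne av zero    = []
avoids-blocks {L = L} ne av (suc n) = All-++⁺ (All-replicate⁺ (suc L) ne) (All-++⁺ (av n) (avoids-blocks ne av n))

-- With k = 2 + κ strings, numbered 0, …, K; H is the size of a group.
module Reduction (κ : ℕ) {n : ℕ} (cs : List (Clause n)) (h : ℕ) (n<kh : n < (2 + κ) * suc h) where

  open Literals n (2 + κ) h n<kh

  k K m N L : ℕ
  k = 2 + κ
  K = 1 + κ
  m = length cs
  N = 2 ^ H
  L = m * (2 * k)

  clauses : List (List ℕ)
  clauses = map (map encodeLiteral) cs

  |clauses| : length clauses ≡ m
  |clauses| = length-map (map encodeLiteral) cs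

  vector : ℕ → ℕ → List Letter
  vector i a = gadgets K i (satisfied H i a) clauses

  string : ℕ → List Letter
  string i = blocks (pad i) L (vector i) N

  |vector| : ∀ i → i ≤ K → ∀ a → length (vector i a) ≡ L
  |vector| i i≤ a = trans (length-gadgets κ i (satisfied H i a) clauses i≤) (cong (_* (2 * k)) |clauses|)

  |string| : ∀ (i : Fin k) → length (string (toℕ i)) ≡ N * (suc L + L)
  |string| i = Window.length-blocks (pad (toℕ i)) L (vector (toℕ i)) (|vector| (toℕ i) (≤-pred (toℕ<n i))) N

  1≤N : 1 ≤ N
  1≤N = m^n>0 2 H

  stringVec : (i : Fin k) → Vec Letter (N * (suc L + L))
  stringVec i = cast (|string| i) (fromList (string (toℕ i)))

  instanceLCS : LocalLCSInstance k 5
  instanceLCS = record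
    { n = N * (suc L + L)
    ; strings = tabulate stringVec
    ; L = L
    ; L≤n = ≤-trans (m≤n+m L (suc L)) (≤-trans (≤-reflexive (sym (*-identityˡ _))) (*-monoˡ-≤ (suc L + L) 1≤N))
    }

  toList-string : ∀ i → toList (Vec.lookup (tabulate stringVec) i) ≡ string (toℕ i)
  toList-string i = trans (cong toList (lookup∘tabulate stringVec i))
    (trans (toList-cast (|string| i) (fromList (string (toℕ i)))) (toList∘fromList (string (toℕ i))))

  strings : ℕ → ℕ → List Letter
  strings i zero    = []
  strings i (suc c) = string i ++ strings (suc i) c

  encode-instance : Problem.encode (LocalLCS k 5) instanceLCS ≡ N * (suc L + L) ∷ L ∷ letters (strings 0 k)
  encode-instance = cong (λ z → N * (suc L + L) ∷ L ∷ z)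
    (go 0 k stringVec (λ i → trans (toList-cast (|string| i) (fromList (string (toℕ i)))) (toList∘fromList (string (toℕ i)))))
    where
      go : ∀ {l} i c (f : Fin c → Vec Letter l) → (∀ j → toList (f j) ≡ string (i + toℕ j)) →
           concatMap (λ v → map toℕ (toList v)) (toList (tabulate f)) ≡ letters (strings i c)
      go i zero    f eq = refl
      go i (suc c) f eq = trans
        (cong₂ _++_ (cong letters (trans (eq 0F) (cong string (+-identityʳ i))))
          (go (suc i) c (f ∘ Fin.suc) (λ j → trans (eq (Fin.suc j)) (cong string (+-suc i (toℕ j))))))
        (sym (map-++ toℕ (string i) _))

  threshold : ℕ
  threshold = m * (3 + κ)

  sound : ∀ X → LocallyCommon instanceLCS X → threshold ≤ length X → Satisfiable cs
  sound X common le = assignment as , go cs (gadgets-sound κ (λ i → satisfied H i (as i)) clauses unpadded X⊆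
      (≤-trans (≤-reflexive (cong (_* (3 + κ)) |clauses|)) le))
    where
      ⊆string : ∀ i → X ⊆ string (toℕ i)
      ⊆string i with common i
      ... | Y , inf , _ , X⊆Y = subst (X ⊆_) (toList-string i) (⊆-trans X⊆Y (Infix⇒⊆ inf))
      unpadded : All Unpadded X
      unpadded = All.zipWith (λ (p , q) → q , p)
        ( All-resp-⊆ (⊆string 0F) (avoids-blocks (λ ()) (λ a → avoids-gadgets {i = 0} avoids-4F K (satisfied H 0 a) clauses) N)
        , All-resp-⊆ (⊆string 1F) (avoids-blocks (λ ()) (λ a → avoids-gadgets {i = 1} avoids-3F K (satisfied H 1 a) clauses) N))
      choose : ∀ i → ∃[ a ] X ⊆ vector (toℕ i) a
      choose i with common i
      ... | Y , inf , |Y| , X⊆Y with Window.window (pad (toℕ i)) L (vector (toℕ i)) (|vector| (toℕ i) (≤-pred (toℕ<n i)))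
              X⊆Y (All.map (≢pad (toℕ i)) unpadded) |Y| N (subst (Substring Y) (toList-string i) inf)
      -- An empty `X` is contained in every block, so any block number will do.
      ...   | inj₁ refl = 0 , minimum _
      ...   | inj₂ p    = p
      choice : ∀ i → Dec (i < k) → ℕ
      choice i (yes i<k) = proj₁ (choose (fromℕ< i<k))
      choice i (no _)    = 0
      choice-⊆ : ∀ i d → i ≤ K → X ⊆ vector i (choice i d)
      choice-⊆ i (yes i<k) _   = subst (λ j → X ⊆ vector j (choice i (yes i<k))) (toℕ-fromℕ< i<k) (proj₂ (choose (fromℕ< i<k)))
      choice-⊆ i (no ¬lt)  i≤K = contradiction (s≤s i≤K) ¬lt
      as : ℕ → ℕ
      as i = choice i (i <? k)
      X⊆ : CommonSubsequence K (λ i → satisfied H i (as i)) clauses X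
      X⊆ i i≤K = choice-⊆ i (i <? k) i≤K
      go : ∀ cs → All (λ c → ∃[ i ] i ≤ suc κ × satisfied H i (as i) c ≡ true) (map (map encodeLiteral) cs) →
           Satisfies (assignment as) cs
      go []       []                = []
      go (c ∷ cs) ((i , _ , s) ∷ p) = assignment-sound as i c s ∷ go cs p

  complete : Satisfiable cs → ∃[ X ] LocallyCommon instanceLCS X × length X ≡ threshold
  complete (α , sat) with gadgets-complete κ (λ i → satisfied H i (encodeGroup α i)) clauses (go cs sat)
    where
      go : ∀ cs → Satisfies α cs → All (λ c → ∃[ i ] i ≤ suc κ × satisfied H i (encodeGroup α i) c ≡ true) (map (map encodeLiteral) cs)
      go []       []      = []
      go (c ∷ cs) (p ∷ s) with assignment-complete α c p
      ... | i , i<k , sat = (i , ≤-pred i<k , sat) ∷ go cs s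
  ... | X , X⊆ , |X| = X ,
    (λ i → vector (toℕ i) (encodeGroup α (toℕ i)) ,
      subst (Substring _) (sym (toList-string i))
        (Window.infix-blocks (pad (toℕ i)) L (vector (toℕ i)) (|vector| (toℕ i) (≤-pred (toℕ<n i))) N (fromBits<2^ (λ u → extend α (toℕ i * H + u)) H)) ,
      |vector| (toℕ i) (≤-pred (toℕ<n i)) (encodeGroup α (toℕ i)) ,
      X⊆ (toℕ i) (≤-pred (toℕ<n i))) ,
    trans |X| (cong (_* (3 + κ)) |clauses|)

-- The reduction and the resulting SAT solver

-- The memory during packing: the program goes from the top down and clears each cell that it has
-- read, since the Local-k-LCS program must find zeros behind its input.
truncate : (ℕ → ℕ) → ℕ → ℕ → ℕ
truncate M b i = if i <ᵇ b then M i else 0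

truncate-< : ∀ M {b i} → i < b → truncate M b i ≡ M i
truncate-< M {b} {i} i<b with i <ᵇ b | <⇒<ᵇ i<b
... | true | _ = refl

truncate-≥ : ∀ M {b i} → b ≤ i → truncate M b i ≡ 0
truncate-≥ M {b} {i} b≤i with i <ᵇ b | <ᵇ⇒< i b
... | true  | lt = contradiction (lt _) (≤⇒≯ b≤i)
... | false | _  = refl

truncate-step : ∀ M b j → update (truncate M (suc b)) b 0 j ≡ truncate M b j
truncate-step M b j with <-cmp j b
... | tri< lt ne _ = trans (update-other (truncate M (suc b)) 0 (≢-sym ne))
        (trans (truncate-< M {suc b} {j} (≤-trans lt (n≤1+n b))) (sym (truncate-< M {b} {j} lt)))
... | tri≈ _ refl _ = trans (update-same (truncate M (suc b)) b 0) (sym (truncate-≥ M {b} {b} ≤-refl))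
... | tri> _ ne gt = trans (update-other (truncate M (suc b)) 0 (≢-sym ne)) (trans (truncate-≥ M {suc b} {j} gt) (sym (truncate-≥ M {b} {j} (<⇒≤ gt))))

contents-≥ : ∀ xs {i} → length xs ≤ i → contents xs i ≡ 0
contents-≥ []       _        = refl
contents-≥ (x ∷ xs) (s≤s le) = contents-≥ xs le

truncate-contents : ∀ xs {b} → length xs ≤ b → ∀ i → contents xs i ≡ truncate (contents xs) b i
truncate-contents xs {b} le i with i <ᵇ b | <ᵇ⇒< i b | <⇒<ᵇ {i} {b}
... | true  | _ | _ = refl
... | false | _ | f = contents-≥ xs (≤-trans le (≮⇒≥ f))

double : ℕ → ℕ → ℕ
double zero    N = N
double (suc j) N = double j (N * 2)

double≡ : ∀ j N → double j N ≡ N * 2 ^ j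
double≡ zero    N = sym (*-identityʳ N)
double≡ (suc j) N = trans (double≡ j (N * 2)) (*-assoc N 2 (2 ^ j))

≤-double : ∀ j N → N ≤ double j N
≤-double j N = ≤-trans (m≤m*n N (2 ^ j) ⦃ m^n≢0 2 j ⦄) (≤-reflexive (sym (double≡ j N)))

-- Packing from the most significant digit downwards, as the program does it.
packDown : ℕ → (ℕ → ℕ) → ℕ → ℕ → ℕ
packDown B f zero    Φ = Φ
packDown B f (suc u) Φ = packDown B f u (Φ * B + f u)

packDown-suc : ∀ B f u Φ → packDown B f (suc u) Φ ≡ f 0 + B * packDown B (f ∘ suc) u Φ
packDown-suc B f zero    Φ = trans (+-comm (Φ * B) (f 0)) (cong (f 0 +_) (*-comm Φ B))
packDown-suc B f (suc u) Φ = packDown-suc B f u (Φ * B + f (suc u))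

packDown-zero : ∀ B u → packDown B (λ _ → 0) u 0 ≡ 0
packDown-zero B zero    = refl
packDown-zero B (suc u) = packDown-zero B u

-- The program does not know the number of cells, only an upper bound `u`. Cells past the end hold
-- zero and become leading zeros.
packDown≡pack : ∀ B vs u → length vs ≤ u → packDown B (contents vs) u 0 ≡ pack B vs
packDown≡pack B []       u       _        = packDown-zero B u
packDown≡pack B (v ∷ vs) (suc u) (s≤s le) =
  trans (packDown-suc B (contents (v ∷ vs)) u 0) (cong (λ z → v + B * z) (packDown≡pack B vs u le))

≤-packDown : ∀ B f u Φ → 1 ≤ B → Φ ≤ packDown B f u Φ
≤-packDown B f zero    Φ _   = ≤-refl
≤-packDown B f (suc u) Φ 1≤B = ≤-trans
  (≤-trans (≤-trans (≤-reflexive (sym (*-identityʳ Φ))) (*-monoʳ-≤ Φ 1≤B)) (m≤m+n (Φ * B) (f u)))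
  (≤-packDown B f u _ 1≤B)

pack-< : ∀ {B} vs → All (_< B) vs → pack B vs < B ^ length vs
pack-< []       []         = s≤s z≤n
pack-< {B} (v ∷ vs) (v< ∷ vs<) = begin-strict
  v + B * pack B vs       <⟨ +-monoˡ-< _ v< ⟩
  B + B * pack B vs       ≡⟨ sym (*-suc B _) ⟩
  B * suc (pack B vs)     ≤⟨ *-monoʳ-≤ B (pack-< vs vs<) ⟩
  B * B ^ length vs       ∎
  where open ≤-Reasoning

-- The program of the reduction

zeros : List ℕ
zeros = replicate 19 0

-- `rT` is still 0, so `load rT rT` fetches `n` from cell 0, and `rONE` addresses `m` in cell 1.
-- `rU` receives `m (q + 1)`, a bound on the number of cells that hold the clauses, and `rJ` the
-- number `H` of doublings that lead to `N`.
setup : ℕ → ℕ → List Instr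
setup k q =
  const rONE 1 ∷ const rTWO 2 ∷ load rT rT ∷ load rM rONE ∷
  const rY k ∷ op rH div rT rY ∷ op rH add rH rONE ∷
  op rB add rT rT ∷ const rY (suc q) ∷ op rB add rB rY ∷ op rU mul rM rY ∷
  const rY (2 * k) ∷ op rPL mul rM rY ∷ op rPL add rPL rONE ∷
  const rN 1 ∷ op rJ mul rH rONE ∷ const rT 0 ∷ const rY 0 ∷ []

doubling packing header : List Instr
doubling = op rN mul rN rTWO ∷ op rJ sub rJ rONE ∷ []
packing  =
  op rT add rU rONE ∷ load rV rT ∷ op rΦ mul rΦ rB ∷ op rΦ add rΦ rV ∷ store rT rY ∷
  op rU sub rU rONE ∷ const rT 0 ∷ const rV 0 ∷ []
header   =
  op rY sub rPL rONE ∷ op rT add rY rPL ∷ op rT mul rN rT ∷ store rV rT ∷ store rONE rY ∷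
  const rPTR 2 ∷ const rT 0 ∷ const rY 0 ∷ []

-- The oracle must find all its registers zero, so the threshold goes to a
-- register R that it does not use.
save : ℕ → Reg → List Instr
save k R =
  const rY (suc k) ∷ op rM mul rM rY ∷
  const rONE 0 ∷ const rTWO 0 ∷ const rH 0 ∷ const rB 0 ∷ const rN 0 ∷ const rPL 0 ∷ const rΦ 0 ∷ const rPTR 0 ∷ const rY 0 ∷
  op R add rM rY ∷ const rM 0 ∷ []

reduce : ℕ → ℕ → Reg → Program
reduce κ q R =
  block (setup (2 + κ) q) ⨾ (while≢0 rJ (block doubling) ⨾ (while≢0 rU (block packing) ⨾
  (block header ⨾ (emitStrings (1 + κ) 0 (2 + κ) ⨾ block (save (2 + κ) R)))))

-- The form to which executing `save` reduces: `R` is a variable, so its last two instructions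
-- remain visible as `set`.
withThreshold : Reg → ℕ → List ℕ
withThreshold R t = set (set (0 ∷ 0 ∷ 0 ∷ t ∷ replicate 15 0) R (t + 0)) 3 0

module Run (κ q : ℕ) (R : Reg) {n : ℕ} (cs : List (Clause n)) (width : All (λ c → length c ≤ q) cs) where

  h = n / (2 + κ)

  n<kh : n < (2 + κ) * suc h
  n<kh = ≤-trans (s≤s (≤-reflexive (m≡m%n+[m/n]*n n (2 + κ))))
    (≤-trans (+-monoˡ-≤ (h * (2 + κ)) (m%n<n n (2 + κ))) (≤-reflexive (*-comm (suc h) (2 + κ))))

  open Reduction κ cs h n<kh public
  open Literals n (2 + κ) h n<kh using (H) public

  -- The base `B` exceeds literal codes, which are below `2 n`, and clause lengths, which are at
  -- most `q`. `E` bounds the number of cells to be packed, and `D` every dimension at once. The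
  -- packed formula has up to `B * E` bits, whence `w = D * D`.
  B E D w : ℕ
  B = n + n + suc q
  E = m * suc q
  D = 4 + (n + (E + (B + (L + 1 + (H + (k + m))))))
  w = D * D

  V = 2 ^ w

  cells : List ℕ
  cells = concatMap withLength clauses

  P : ℕ
  P = 2 + k * (N * (suc L + L))

  cells≡ : cells ≡ concatMap encodeClause cs
  cells≡ = go cs
    where
      go : ∀ cs → concatMap withLength (map (map encodeLiteral) cs) ≡ concatMap encodeClause cs
      go []       = refl
      go (c ∷ cs) = cong₂ _++_ (cong (_∷ map encodeLiteral c) (length-map encodeLiteral c)) (go cs)

  |cells| : length cells ≤ E
  |cells| = go cs width
    where
      go : ∀ cs → All (λ c → length c ≤ q) cs → length (concatMap withLength (map (map encodeLiteral) cs)) ≤ length cs * suc q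
      go []       []           = z≤n
      go (c ∷ cs) (le ∷ width) = ≤-trans (≤-reflexive (length-++ (withLength (map encodeLiteral c))))
        (+-mono-≤ (s≤s (≤-trans (≤-reflexive (length-map encodeLiteral c)) le)) (go cs width))

  digits : All (λ c → All (_< B) (withLength c)) clauses
  digits = go cs width
    where
      lit : ∀ (c : Clause n) → All (_< B) (map encodeLiteral c)
      lit []      = []
      lit (l ∷ c) = ≤-trans (encodeLiteral< l) (m≤m+n (n + n) (suc q)) ∷ lit c
      go : ∀ cs → All (λ c → length c ≤ q) cs → All (λ c → All (_< B) (withLength c)) (map (map encodeLiteral) cs)
      go []       []           = []
      go (c ∷ cs) (le ∷ width) =
        (≤-trans (s≤s (≤-trans (≤-reflexive (length-map encodeLiteral c)) le)) (m≤n+m (suc q) (n + n)) ∷ lit c) ∷ go cs width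

  digits′ : All (_< B) cells
  digits′ = go clauses digits
    where
      go : ∀ cs → All (λ c → All (_< B) (withLength c)) cs → All (_< B) (concatMap withLength cs)
      go []       []       = []
      go (c ∷ cs) (p ∷ ps) = All-++⁺ p (go cs ps)

  D≤w : D ≤ w
  D≤w = m≤m*n D D

  ≤V : ∀ {x} → x ≤ D → x ≤ V
  ≤V x≤D = ≤-trans x≤D (≤-trans D≤w (n≤2^n w))

  4≤D : 4 ≤ D
  4≤D = m≤m+n 4 _
  n≤D : n ≤ D
  n≤D = ≤-trans (m≤m+n n _) (m≤n+m _ 4)
  E≤D : E ≤ D
  E≤D = ≤-trans (m≤m+n E _) (≤-trans (m≤n+m _ n) (m≤n+m _ 4))
  B≤D : B ≤ D
  B≤D = ≤-trans (m≤m+n B _) (≤-trans (m≤n+m _ E) (≤-trans (m≤n+m _ n) (m≤n+m _ 4)))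
  pl≤D : L + 1 ≤ D
  pl≤D = ≤-trans (m≤m+n (L + 1) _) (≤-trans (m≤n+m _ B) (≤-trans (m≤n+m _ E) (≤-trans (m≤n+m _ n) (m≤n+m _ 4))))
  rest≤D : H + (k + m) ≤ D
  rest≤D = ≤-trans (m≤n+m _ (L + 1)) (≤-trans (m≤n+m _ B) (≤-trans (m≤n+m _ E) (≤-trans (m≤n+m _ n) (m≤n+m _ 4))))
  H≤D : H ≤ D
  H≤D = ≤-trans (m≤m+n H _) rest≤D
  k≤D : k ≤ D
  k≤D = ≤-trans (≤-trans (m≤m+n k m) (m≤n+m _ H)) rest≤D
  m≤D : m ≤ D
  m≤D = ≤-trans (≤-trans (m≤n+m m k) (m≤n+m _ H)) rest≤D

  N≤V : N ≤ V
  N≤V = 2^-mono (≤-trans H≤D D≤w)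

  Φ≤V : pack B cells ≤ V
  Φ≤V = begin
    pack B cells          ≤⟨ <⇒≤ (pack-< cells digits′) ⟩
    B ^ length cells      ≤⟨ ^-monoˡ-≤ (length cells) (n≤2^n B) ⟩
    (2 ^ B) ^ length cells ≡⟨ ^-*-assoc 2 B (length cells) ⟩
    2 ^ (B * length cells) ≤⟨ 2^-mono (*-mono-≤ B≤D (≤-trans |cells| E≤D)) ⟩
    V                     ∎
    where open ≤-Reasoning

  P≤V : P ≤ V
  P≤V = begin
    2 + k * (N * (suc L + L))             ≤⟨ +-mono-≤ (^-monoʳ-≤ 2 {1} {s} (s≤s z≤n)) (*-mono-≤ (n≤2^n k) (*-monoʳ-≤ N (n≤2^n (suc L + L)))) ⟩
    2 ^ s + 2 ^ k * (2 ^ H * 2 ^ (suc L + L)) ≡⟨ cong (2 ^ s +_) (trans (cong (2 ^ k *_) (sym (^-distribˡ-+-* 2 H (suc L + L)))) (sym (^-distribˡ-+-* 2 k _))) ⟩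
    2 ^ s + 2 ^ s                         ≡⟨ cong (2 ^ s +_) (sym (+-identityʳ _)) ⟩
    2 ^ (1 + s)                           ≤⟨ 2^-mono (≤-trans s≤ (*-monoˡ-≤ D 4≤D)) ⟩
    V                                     ∎
    where
      open ≤-Reasoning
      s = k + (H + (suc L + L))
      s≤ : 1 + s ≤ 4 * D
      s≤ = ≤-trans (≤-reflexive (solve 3 (λ k h l → con 1 :+ (k :+ (h :+ (con 1 :+ l :+ l))) := k :+ (h :+ ((l :+ con 1) :+ ((l :+ con 1) :+ con 0)))) refl k H L))
        (+-mono-≤ k≤D (+-mono-≤ H≤D (+-mono-≤ pl≤D (+-mono-≤ pl≤D z≤n))))
        where open +-*-Solver

  input : List ℕ
  input = n ∷ m ∷ cells

  MBounded : (ℕ → ℕ) → Set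
  MBounded M = ∀ i → M i ≤ V

  input-≤ : MBounded (contents input)
  input-≤ = contents-≤ (≤V n≤D ∷ ≤V m≤D ∷ All.map (λ lt → ≤-trans (<⇒≤ lt) (≤V B≤D)) digits′)

  truncate-≤ : ∀ b → MBounded (truncate (contents input) b)
  truncate-≤ b i with i <ᵇ b
  ... | true  = input-≤ i
  ... | false = z≤n

  module Emit = Emission K H m B N L clauses |clauses| digits w D

  fits : Emit.Fits
  fits = record
    { w≥4 = ≤-trans 4≤D D≤w ; h≤ = ≤V H≤D ; m≤ = ≤V m≤D ; B≤ = ≤V B≤D ; N≤ = N≤V ; pl≤ = ≤V pl≤D
    ; Φ≤ = Φ≤V ; B≤D = B≤D ; m≤D = m≤D ; pl≤D = pl≤D }

  1≤w : 1 ≤ w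
  1≤w = ≤-trans (s≤s z≤n) (≤-trans 4≤D D≤w)

  small : ∀ {x} → x ≤ 4 → x ≤ V
  small x≤4 = ≤V (≤-trans x≤4 4≤D)

  pre : (N Φ ptr j v u t y : ℕ) → List ℕ
  pre N Φ ptr j v u t y =
    1 ∷ 2 ∷ H ∷ m ∷ B ∷ N ∷ (L + 1) ∷ Φ ∷ ptr ∷ 0 ∷ 0 ∷ j ∷ 0 ∷ 0 ∷ v ∷ 0 ∷ u ∷ t ∷ y ∷ []

  pre-≤ : ∀ {N Φ j u} → N ≤ V → Φ ≤ V → j ≤ V → u ≤ V → All (_≤ V) (pre N Φ 0 j 0 u 0 0)
  pre-≤ a b c d = small (s≤s z≤n) ∷ small (s≤s (s≤s z≤n)) ∷ ≤V H≤D ∷ ≤V m≤D ∷ ≤V B≤D ∷ a ∷ ≤V pl≤D ∷ b ∷ z≤n ∷ z≤n ∷ z≤n ∷ c ∷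
                  z≤n ∷ z≤n ∷ z≤n ∷ z≤n ∷ d ∷ z≤n ∷ z≤n ∷ []

  double-loop : ∀ {Φ u M} j N → double j N ≤ V → Φ ≤ V → j ≤ V → u ≤ V → MBounded M →
    while≢0 rJ (block doubling) ⊢ (pre N Φ 0 j 0 u 0 0 , M) ⟶ (pre (double j N) Φ 0 0 0 u 0 0 , M)
      ⟨ j * (suc w + factor doubling * w) + 1 ⟩
  double-loop zero    N N≤ Φ≤ j≤ u≤ M≤ = loop-done {w = w} {t = factor doubling * w} refl
  double-loop (suc j) N N≤ Φ≤ j≤ u≤ M≤ = loop-next w j refl j≤
    (⟶-block doubling 1≤w (pre-≤ (≤-trans (≤-double (suc j) N) N≤) Φ≤ j≤ u≤ , M≤))
    (double-loop j (N * 2) N≤ Φ≤ (≤-trans (n≤1+n j) j≤) u≤ M≤)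

  pack-loop : ∀ u Φ → packDown B (contents cells) u Φ ≤ V → u ≤ V →
    while≢0 rU (block packing) ⊢ (pre N Φ 0 0 0 u 0 0 , truncate (contents input) (2 + u)) ⟶
      (pre N (packDown B (contents cells) u Φ) 0 0 0 0 0 0 , truncate (contents input) 2)
      ⟨ u * (suc w + factor packing * w) + 1 ⟩
  pack-loop zero    Φ Φ≤ u≤ = loop-done {w = w} {t = factor packing * w} refl
  pack-loop (suc u) Φ Φ≤ u≤ = loop-next w u refl u≤
    (⟶-post (⟶-block packing 1≤w (pre-≤ N≤V (≤-trans (≤-packDown B (contents cells) (suc u) Φ 1≤B) Φ≤) z≤n u≤ , truncate-≤ (3 + u)))
      (cong (λ v → pre N (Φ * B + v) 0 0 0 u 0 0) cell)
      (λ j → trans (update-cong {f = truncate (contents input) (3 + u)} {i = suc u + 1} (λ _ → refl) (+-comm (suc u) 1) refl j)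
                   (truncate-step (contents input) (2 + u) j)))
    (pack-loop u (Φ * B + contents cells u) Φ≤ (≤-trans (n≤1+n u) u≤))
    where
      1≤B : 1 ≤ B
      1≤B = ≤-trans (s≤s z≤n) (m≤n+m (suc q) (n + n))
      cell : truncate (contents input) (3 + u) (suc u + 1) ≡ contents cells u
      cell = trans (cong (truncate (contents input) (3 + u)) (+-comm (suc u) 1)) (truncate-< (contents input) {3 + u} {2 + u} ≤-refl)

  size : ℕ
  size = N * (suc L + L)

  tReduce : ℕ
  tReduce = factor (setup k q) * w + ((D * (suc w + factor doubling * w) + 1) + ((D * (suc w + factor packing * w) + 1) +
            (factor header * w + (Emit.tStrings fits 0 k + factor (save k R) * w))))

  strings≡ : ∀ i c → Emit.strings fits i c ≡ strings i c
  strings≡ i zero    = refl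
  strings≡ i (suc c) = cong (string i ++_) (strings≡ (suc i) c)

  |strings| : ∀ i c → i + c ≤ k → length (strings i c) ≡ c * size
  |strings| i zero    _  = refl
  |strings| i (suc c) le = trans (length-++ (string i)) (cong₂ _+_
    (Window.length-blocks (pad i) L (vector i) (|vector| i (≤-pred (≤-trans (s≤s (m≤m+n i c)) (≤-trans (≤-reflexive (sym (+-suc i c))) le)))) N)
    (|strings| (suc i) c (≤-trans (≤-reflexive (sym (+-suc i c))) le)))

  memory-header : ∀ i → update (update (truncate (contents input) 2) 0 size) 1 L i ≡ writes (λ _ → 0) 0 (size ∷ L ∷ []) i
  memory-header zero          = refl
  memory-header (suc zero)    = refl
  memory-header (suc (suc i)) = refl

  ptr-end : 2 + length (Emit.strings fits 0 k) ≤ V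
  ptr-end = ≤-trans (≤-reflexive (cong (2 +_) (trans (cong length (strings≡ 0 k)) (|strings| 0 k ≤-refl)))) P≤V

  output-≤ : MBounded (writes (λ _ → 0) 0 (size ∷ L ∷ []))
  output-≤ = writes-≤ (λ _ → 0) 0 (size≤ ∷ ≤V (≤-trans (m≤m+n L 1) pl≤D) ∷ []) (λ _ → z≤n)
    where
      size≤ : size ≤ V
      size≤ = ≤-trans (≤-trans (m≤m+n size (suc κ * size)) (m≤n+m _ 2)) P≤V

  reduce-run : reduce κ q R ⊢ (zeros , contents input) ⟶
    (withThreshold R threshold , contents (size ∷ L ∷ letters (strings 0 k))) ⟨ tReduce ⟩
  reduce-run = ⟶-seq
    (⟶-post (⟶-block (setup k q) 1≤w (All-zeros , input-≤))
      (cong₂ (λ h′ j → 1 ∷ 2 ∷ h′ ∷ m ∷ B ∷ 1 ∷ (L + 1) ∷ 0 ∷ 0 ∷ 0 ∷ 0 ∷ j ∷ 0 ∷ 0 ∷ 0 ∷ 0 ∷ E ∷ 0 ∷ 0 ∷ [])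
        (+-comm h 1) (trans (*-identityʳ (h + 1)) (+-comm h 1)))
      (truncate-contents input {2 + E} (s≤s (s≤s |cells|))))
    (⟶-seq
      (⟶-weaken (+-monoˡ-≤ 1 (*-monoˡ-≤ (suc w + factor doubling * w) H≤D))
        (⟶-post (double-loop H 1 (≤-trans (≤-reflexive N≡) N≤V) z≤n (≤V H≤D) (≤V E≤D) (truncate-≤ (2 + E)))
          (cong (λ N → pre N 0 0 0 0 E 0 0) N≡) (λ _ → refl)))
      (⟶-seq
        (⟶-weaken (+-monoˡ-≤ 1 (*-monoˡ-≤ (suc w + factor packing * w) E≤D))
          (⟶-post (pack-loop E 0 (≤-trans (≤-reflexive Φ≡) Φ≤V) (≤V E≤D))
            (cong (λ Φ → pre N Φ 0 0 0 0 0 0) Φ≡) (λ _ → refl)))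
        (⟶-seq
          (⟶-post (⟶-block header 1≤w (pre-≤ N≤V Φ≤V z≤n z≤n , truncate-≤ 2)) refl
            (λ i → trans (update-cong {f = update (truncate (contents input) 2) 0 (N * (L + 1 ∸ 1 + (L + 1)))} {i = 1}
                            (update-cong {f = truncate (contents input) 2} {i = 0} (λ _ → refl) refl size≡) refl L≡ i)
                         (memory-header i)))
          (⟶-seq
            (Emit.strings-steps fits 0 k ptr-end output-≤)
            (⟶-post (⟶-block (save k R) 1≤w
                (Emit.regs-≤ fits ptr-end z≤n z≤n z≤n z≤n z≤n z≤n z≤n z≤n z≤n z≤n ,
                 Emit.writes-MBounded fits 2 (Emit.strings fits 0 k) output-≤))
              refl final))))) 
    where
      All-zeros : All (_≤ V) zeros
      All-zeros = All-replicate⁺ 19 z≤n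
      N≡ : double H 1 ≡ N
      N≡ = trans (double≡ H 1) (*-identityˡ N)
      Φ≡ : packDown B (contents cells) E 0 ≡ pack B cells
      Φ≡ = packDown≡pack B cells E |cells|
      L≡ : L + 1 ∸ 1 ≡ L
      L≡ = m+n∸n≡m L 1
      size≡ : N * (L + 1 ∸ 1 + (L + 1)) ≡ size
      size≡ = cong (N *_) (trans (cong₂ _+_ L≡ (+-comm L 1)) (+-comm L (suc L)))
      final : ∀ i → writes (writes (λ _ → 0) 0 (size ∷ L ∷ [])) 2 (letters (Emit.strings fits 0 k)) i ≡
                    contents (size ∷ L ∷ letters (strings 0 k)) i
      final i = trans (cong (λ f → f i) (sym (writes-++ (λ _ → 0) 0 (size ∷ L ∷ []) (letters (Emit.strings fits 0 k)))))
        (trans (cong (λ s → writes (λ _ → 0) 0 (size ∷ L ∷ letters s) i) (strings≡ 0 k))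
          (writes-contents (size ∷ L ∷ letters (strings 0 k)) i))

contents-zeros : ∀ n i → contents (replicate n 0) i ≡ 0
contents-zeros zero    i       = refl
contents-zeros (suc n) zero    = refl
contents-zeros (suc n) (suc i) = contents-zeros n i

contents-withThreshold : ∀ R t i → contents (withThreshold R t) i ≡
  update (update (contents (0 ∷ 0 ∷ 0 ∷ t ∷ replicate 15 0)) R (t + 0)) 3 0 i
contents-withThreshold R t i = trans (sym (contents-set (set (0 ∷ 0 ∷ 0 ∷ t ∷ replicate 15 0) R (t + 0)) 3 0 i))
  (update-cong {i = 3} (λ j → sym (contents-set (0 ∷ 0 ∷ 0 ∷ t ∷ replicate 15 0) R (t + 0) j)) refl refl i)

withThreshold-zero : ∀ R t i → i ≢ R → contents (withThreshold R t) i ≡ 0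
withThreshold-zero R t i i≢R = trans (contents-withThreshold R t i) (go i i≢R)
  where
    f = contents (0 ∷ 0 ∷ 0 ∷ t ∷ replicate 15 0)
    go : ∀ i → i ≢ R → update (update f R (t + 0)) 3 0 i ≡ 0
    go 0 i≢R = update-other f {R} (t + 0) (≢-sym i≢R)
    go 1 i≢R = update-other f {R} (t + 0) (≢-sym i≢R)
    go 2 i≢R = update-other f {R} (t + 0) (≢-sym i≢R)
    go 3 i≢R = refl
    go (suc (suc (suc (suc i)))) i≢R = trans (update-other f {R} (t + 0) (≢-sym i≢R)) (contents-zeros 15 i)

withThreshold-R : ∀ R t → R ≢ 3 → contents (withThreshold R t) R ≡ t
withThreshold-R R t R≢3 = trans (contents-withThreshold R t R)
  (trans (update-other (update f R (t + 0)) 0 (≢-sym R≢3)) (trans (update-same f R (t + 0)) (+-identityʳ t)))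
  where
    f = contents (0 ∷ 0 ∷ 0 ∷ t ∷ replicate 15 0)

-- The output `1 ∸ (T ∸ r)` is 1 if the threshold `T` is at most `r`, and 0 otherwise.
compare : Reg → Program
compare R = op 0 sub R 0 ⨾ (const 1 1 ⨾ op 0 sub 1 0)

compare-run : ∀ R u {T r w} → 1 ≤ w → register u R ≡ T → register u 0 ≡ r → T ≤ 2 ^ w → r ≤ 2 ^ w →
              ∃[ u′ ] ∃[ t ] (compare R ∶ u ⇓ u′ [ t ]) × output u′ ≡ 1 ∸ (T ∸ r) × t ≤ 15 * w
compare-run R u {T} {r} {w} 1≤w refl refl T≤ r≤ =
  _ , _ , seq op (seq const op) , refl ,
  ≤-trans (+-mono-≤ (charge-op 1≤w (bits-≤ T≤) (bits-≤ r≤) (bits-≤ (≤-trans (m∸n≤m T r) (≤-trans T≤ w≤2w))))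
            (+-mono-≤ (≤-trans (bits-≤ {1} {0} ≤-refl) 1≤w)
              (charge-op 1≤w (bits-≤ 1≤) (bits-≤ (≤-trans (m∸n≤m T r) T≤)) (bits-≤ (≤-trans (m∸n≤m 1 (T ∸ r)) (≤-trans 1≤ w≤2w))))))
    (≤-reflexive (solve 1 (λ w → con 7 :* w :+ (w :+ con 7 :* w) := con 15 :* w) refl w))
  where
    open +-*-Solver
    1≤ : 1 ≤ 2 ^ w
    1≤ = m^n>0 2 w
    w≤2w : 2 ^ w ≤ 2 ^ (2 * w)
    w≤2w = 2^-mono (m≤m+n w (w + 0))

-- `p` starts in a state that agrees with `initial enc` only below `R`; `frame` transfers the given
-- run to it, with the same time.
oracle-run : ∀ {rd p R T w tR inp enc s t} → 19 ≤ R → Uses< R p →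
  rd ⊢ (zeros , contents inp) ⟶ (withThreshold R T , contents enc) ⟨ tR ⟩ →
  p ∶ initial enc ⇓ s [ t ] → 1 ≤ w → T ≤ 2 ^ w → output s ≤ 2 ^ w →
  ∃[ s′ ] ∃[ t′ ] (rd ⨾ (p ⨾ compare R) ∶ initial inp ⇓ s′ [ t′ ]) ×
    output s′ ≡ 1 ∸ (T ∸ output s) × t′ ≤ tR + (t + 15 * w)
oracle-run {R = R} {T} {s = s} {t} 19≤R uses rd d 1≤w T≤ r≤
  with run rd ((λ i → sym (contents-zeros 19 i)) , λ i → refl)
... | u , t₁ , d₁ , (regs , mems) , t₁≤
  with frame uses (agree (λ i i<R → sym (trans (regs i) (withThreshold-zero R T i (<⇒≢ i<R)))) (λ i → sym (mems i))) d
... | u′ , d₂ , agree regs₂ _ , above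
  with compare-run R u′ 1≤w (trans (sym (above R ≤-refl)) (trans (regs R) (withThreshold-R R T R≢3)))
         (sym (regs₂ 0 (≤-trans (s≤s z≤n) 19≤R))) T≤ r≤
  where
    R≢3 : R ≢ 3
    R≢3 refl = contradiction 19≤R (λ { (s≤s (s≤s (s≤s ()))) })
... | u″ , t₃ , d₃ , out , t₃≤ =
  u″ , _ , seq d₁ (seq d₂ d₃) , out , +-mono-≤ t₁≤ (+-monoʳ-≤ t t₃≤)

solver : ℕ → ℕ → Reg → Program → Program
solver κ q R p = reduce κ q R ⨾ (p ⨾ compare R)

module Correctness (κ q : ℕ) (R : Reg) (19≤R : 19 ≤ R) {p : Program} (uses : Uses< R p) (φ : CNF q) where

  open CNF φ
  private module I = Run κ q R clauses width

  L≤V : I.L ≤ 2 ^ I.w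
  L≤V = I.≤V (≤-trans (m≤m+n I.L 1) I.pl≤D)

  threshold≤V : I.threshold ≤ 2 ^ I.w
  threshold≤V = ≤-trans (*-monoʳ-≤ I.m (≤-trans (n≤1+n (3 + κ)) (≤-trans (≤-reflexive (+-comm 2 (2 + κ))) (+-monoʳ-≤ (2 + κ) (s≤s (s≤s z≤n)))))) L≤V

  reduce-run : reduce κ q R ⊢ (zeros , contents (Problem.encode (SAT q) φ)) ⟶
    (withThreshold R I.threshold , contents (Problem.encode (LocalLCS (2 + κ) 5) I.instanceLCS)) ⟨ I.tReduce ⟩
  reduce-run = subst₂ (λ cs e → reduce κ q R ⊢ (zeros , contents (n ∷ length clauses ∷ cs)) ⟶ (withThreshold R I.threshold , contents e) ⟨ I.tReduce ⟩)
    I.cells≡ (sym I.encode-instance) I.reduce-run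

  answer : ∀ {r} → Problem.Answer (LocalLCS (2 + κ) 5) I.instanceLCS r → Problem.Answer (SAT q) φ (1 ∸ (I.threshold ∸ r))
  answer {r} ((X , common , |X|) , max) = decide (I.threshold ≤? r)
    where
      decide : Dec (I.threshold ≤ r) → Problem.Answer (SAT q) φ (1 ∸ (I.threshold ∸ r))
      decide (yes T≤r) = inj₁ (I.sound X common (≤-trans T≤r (≤-reflexive (sym |X|))) , cong (1 ∸_) (m≤n⇒m∸n≡0 T≤r))
      decide (no  T≰r) = inj₂
        ( (λ sat → T≰r (≤-trans (≤-reflexive (sym (proj₂ (proj₂ (I.complete sat))))) (max _ (proj₁ (proj₂ (I.complete sat))))))
        , m≤n⇒m∸n≡0 (m<n⇒0<n∸m (≰⇒> T≰r)))

  -- The sequence attaining `r` lies in a window. The bound is used for the cost of the final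
  -- comparison.
  answer-≤ : ∀ {r} → Problem.Answer (LocalLCS (2 + κ) 5) I.instanceLCS r → r ≤ I.L
  answer-≤ {r} ((X , common , |X|) , max) = go (common 0F)
    where
      go : ∃[ Y ] Substring Y _ × length Y ≡ I.L × X ⊆ Y → r ≤ I.L
      go (Y , _ , |Y| , X⊆Y) = ≤-trans (≤-reflexive (sym |X|)) (≤-trans (length-mono-≤ X⊆Y) (≤-reflexive |Y|))

  solver-run : ∀ {s t} → p ∶ initial (Problem.encode (LocalLCS (2 + κ) 5) I.instanceLCS) ⇓ s [ t ] →
    Problem.Answer (LocalLCS (2 + κ) 5) I.instanceLCS (output s) →
    ∃[ s′ ] ∃[ t′ ] (solver κ q R p ∶ initial (Problem.encode (SAT q) φ) ⇓ s′ [ t′ ]) ×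
      output s′ ≡ 1 ∸ (I.threshold ∸ output s) × t′ ≤ I.tReduce + (t + 15 * I.w)
  solver-run d ans = oracle-run {inp = Problem.encode (SAT q) φ} {enc = Problem.encode (LocalLCS (2 + κ) 5) I.instanceLCS} 19≤R uses reduce-run d I.1≤w threshold≤V (≤-trans (answer-≤ ans) L≤V)

-- Running time

lookup-unique : ∀ {A : Set} {xs : List A} → Unique xs → ∀ i j → List.lookup xs i ≡ List.lookup xs j → i ≡ j
lookup-unique (x∉ ∷ u) Fin.zero    Fin.zero    eq = refl
lookup-unique (x∉ ∷ u) Fin.zero    (Fin.suc j) eq = contradiction eq (All.lookup x∉ (∈-lookup j))
lookup-unique (x∉ ∷ u) (Fin.suc i) Fin.zero    eq = contradiction (sym eq) (All.lookup x∉ (∈-lookup i))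
lookup-unique (x∉ ∷ u) (Fin.suc i) (Fin.suc j) eq = cong Fin.suc (lookup-unique u i j eq)

-- Pigeonhole principle: the positions of the list are mapped injectively to `Fin b`.
length-unique : ∀ {A : Set} (f : A → ℕ) b {xs} → (∀ {x y} → f x ≡ f y → x ≡ y) → All (λ x → f x < b) xs →
                Unique xs → length xs ≤ b
length-unique f b {xs} inj f< u = injective⇒≤ {f = λ i → fromℕ< (All.lookup f< (∈-lookup i))}
  (λ {i} {j} eq → lookup-unique u i j (inj (fromℕ<-injective _ _ (All.lookup f< (∈-lookup i)) (All.lookup f< (∈-lookup j)) eq)))

pack-injective : ∀ {B} us vs → All (_< B) (map suc us) → All (_< B) (map suc vs) →
                 pack B (map suc us) ≡ pack B (map suc vs) → us ≡ vs
pack-injective []       []       _         _         _  = refl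
pack-injective {B} (u ∷ us) (v ∷ vs) (u< ∷ us<) (v< ∷ vs<) eq = cong₂ _∷_
  (suc-injective (trans (sym (pop-digit B r u<)) (trans (cong (λ x → x ∸ ⟦ div ⟧ x B * B) eq) (pop-digit B r′ v<))))
  (pack-injective us vs us< vs< (trans (sym (pop-rest B r u<)) (trans (cong (λ x → ⟦ div ⟧ x B) eq) (pop-rest B r′ v<))))
  where
    r = pack B (map suc us)
    r′ = pack B (map suc vs)

encodeLiteral-injective : ∀ {n} {l l′ : Literal n} → encodeLiteral l ≡ encodeLiteral l′ → l ≡ l′
encodeLiteral-injective {l = b , v} {b′ , v′} eq = cong₂ _,_ (bit-injective b b′ (trans (sym (parity-bit b (toℕ v))) (trans (cong parity eq′) (parity-bit b′ (toℕ v′)))))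
    (toℕ-injective (trans (sym (half b (toℕ v))) (trans (cong (_/ 2) eq′) (half b′ (toℕ v′)))))
  where
    eq′ : bit b + toℕ v * 2 ≡ bit b′ + toℕ v′ * 2
    eq′ = trans (cong (bit b +_) (*-comm (toℕ v) 2)) (trans eq (cong (bit b′ +_) (*-comm 2 (toℕ v′))))
    bit-injective : ∀ b b′ → bit b ≡ bit b′ → b ≡ b′
    bit-injective true  true  _ = refl
    bit-injective false false _ = refl

-- Digits are raised by one: a digit 0 at the end of the list would not show in the packed number,
-- and clauses of different lengths could collide.
clauseCode : ∀ {n} → Clause n → ℕ
clauseCode {n} c = pack (suc (n + n)) (map suc (map encodeLiteral c))

clause-digits : ∀ {n} (c : Clause n) → All (_< suc (n + n)) (map suc (map encodeLiteral c))
clause-digits []      = []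
clause-digits (l ∷ c) = s≤s (encodeLiteral< l) ∷ clause-digits c

-- Codes of clauses with at most `q` literals are below the right-hand side, and `distinct` makes
-- them distinct. So `m` is polynomial in `n` for fixed `q`.
length-clauses : ∀ {q} (φ : CNF q) → length (CNF.clauses φ) ≤ suc (CNF.n φ + CNF.n φ) ^ q
length-clauses {q} φ = length-unique clauseCode (suc (n + n) ^ q)
  (λ {c} {c′} eq → map-injective encodeLiteral-injective
    (pack-injective (map encodeLiteral c) (map encodeLiteral c′) (clause-digits c) (clause-digits c′) eq))
  (All.map (λ {c} len → ≤-trans (pack-< _ (clause-digits c))
     (^-monoʳ-≤ (suc (n + n)) (≤-trans (≤-reflexive (trans (length-map suc (map encodeLiteral c)) (length-map encodeLiteral c))) len))) width)
  distinct
  where open CNF φ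

^-distrib-* : ∀ a b n → (a * b) ^ n ≡ a ^ n * b ^ n
^-distrib-* a b zero    = refl
^-distrib-* a b (suc n) = trans (cong (a * b *_) (^-distrib-* a b n))
  (solve 4 (λ a b x y → a :* b :* (x :* y) := a :* x :* (b :* y)) refl a b (a ^ n) (b ^ n))
  where open +-*-Solver

-- The sum is at most twice the larger of `x` and `y`.
+-^-≤ : ∀ x y e → (x + y) ^ e ≤ (2 * x) ^ e + (2 * y) ^ e
+-^-≤ x y e with ≤-total x y
... | inj₁ x≤y = ≤-trans (^-monoˡ-≤ e (≤-trans (+-monoˡ-≤ y x≤y) (≤-reflexive (cong (y +_) (sym (+-identityʳ y)))))) (m≤n+m _ _)
... | inj₂ y≤x = ≤-trans (^-monoˡ-≤ e (≤-trans (+-monoʳ-≤ x y≤x) (≤-reflexive (cong (x +_) (sym (+-identityʳ x)))))) (m≤m+n _ _)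

m≤m^suc : ∀ m e → m ≤ m ^ suc e
m≤m^suc zero    e = z≤n
m≤m^suc (suc m) e = m≤m*n (suc m) (suc m ^ e) ⦃ m^n≢0 (suc m) e ⦄

n<2^n : ∀ n → n < 2 ^ n
n<2^n zero    = s≤s z≤n
n<2^n (suc n) = +-mono-≤ (m^n>0 2 n) (≤-trans (n<2^n n) (≤-reflexive (sym (+-identityʳ _))))

halves : ∀ n → ∃[ r ] r + r ≤ n × suc n ≤ 2 * suc r
halves zero          = 0 , z≤n , s≤s z≤n
halves (suc zero)    = 0 , z≤n , s≤s (s≤s z≤n)
halves (suc (suc n)) with halves n
... | r , le , ge = suc r , s≤s (≤-trans (≤-reflexive (+-suc r r)) (s≤s le)) ,
  ≤-trans (s≤s (s≤s ge)) (≤-reflexive (solve 1 (λ r → con 2 :+ con 2 :* (con 1 :+ r) := con 2 :* (con 2 :+ r)) refl r))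
  where open +-*-Solver

-- Induction on the degree: for `r` about `n / 2`, one factor `suc r` is at most `2 ^ r`, and the
-- others are at most `K * 2 ^ r` by the induction hypothesis.
poly≤exp : ∀ d → ∃[ K ] ∀ n → suc n ^ d ≤ K * 2 ^ n
poly≤exp zero    = 1 , λ n → ≤-trans (m^n>0 2 n) (≤-reflexive (sym (*-identityˡ _)))
poly≤exp (suc d) with poly≤exp d
... | K , bound = 2 ^ suc d * K , λ n → go n (halves n)
  where
    go : ∀ n → ∃[ r ] r + r ≤ n × suc n ≤ 2 * suc r → suc n ^ suc d ≤ 2 ^ suc d * K * 2 ^ n
    go n (r , le , ge) = begin
      suc n ^ suc d                           ≤⟨ ^-monoˡ-≤ (suc d) ge ⟩
      (2 * suc r) ^ suc d                     ≡⟨ ^-distrib-* 2 (suc r) (suc d) ⟩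
      2 ^ suc d * (suc r * suc r ^ d)         ≤⟨ *-monoʳ-≤ (2 ^ suc d) (*-mono-≤ (n<2^n r) (bound r)) ⟩
      2 ^ suc d * (2 ^ r * (K * 2 ^ r))       ≡⟨ solve 3 (λ a k x → a :* (x :* (k :* x)) := a :* k :* (x :* x)) refl (2 ^ suc d) K (2 ^ r) ⟩
      2 ^ suc d * K * (2 ^ r * 2 ^ r)         ≡⟨ cong (2 ^ suc d * K *_) (sym (^-distribˡ-+-* 2 r r)) ⟩
      2 ^ suc d * K * 2 ^ (r + r)             ≤⟨ *-monoʳ-≤ (2 ^ suc d * K) (2^-mono le) ⟩
      2 ^ suc d * K * 2 ^ n                   ∎
      where
        open ≤-Reasoning
        open +-*-Solver

-- t ≤ c * Z, as a record so that c and Z can be inferred.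
infix 4 _≲_·_
record _≲_·_ (t c Z : ℕ) : Set where
  constructor ≲-intro
  field ≲-elim : t ≤ c * Z
open _≲_·_ public

≲-+ : ∀ {a b c d Z} → a ≲ c · Z → b ≲ d · Z → a + b ≲ c + d · Z
≲-+ {c = c} {d} {Z} (≲-intro p) (≲-intro q) = ≲-intro (≤-trans (+-mono-≤ p q) (≤-reflexive (sym (*-distribʳ-+ Z c d))))

≲-raise : ∀ {t c Z Z′} → Z ≤ Z′ → t ≲ c · Z → t ≲ c · Z′
≲-raise {c = c} Z≤ (≲-intro p) = ≲-intro (≤-trans p (*-monoʳ-≤ c Z≤))

-- Straight-line code costs a multiple of `w`, hence of `X`, and each loop around it with `D`
-- iterations adds a factor `X`. The exponent thus counts the nesting depth.
module LoopCost (D w : ℕ) (1≤D : 1 ≤ D) (1≤w : 1 ≤ w) where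

  X : ℕ
  X = D * w

  1≤X : 1 ≤ X
  1≤X = *-mono-≤ 1≤D 1≤w

  X^-mono : ∀ {d e} → d ≤ e → X ^ d ≤ X ^ e
  X^-mono d≤e = ^-monoʳ-≤ X ⦃ >-nonZero 1≤X ⦄ d≤e

  1≤X^ : ∀ e → 1 ≤ X ^ e
  1≤X^ e = m^n>0 X ⦃ >-nonZero 1≤X ⦄ e

  w≤X^ : ∀ e → w ≤ X ^ suc e
  w≤X^ e = ≤-trans (≤-trans (≤-reflexive (sym (*-identityˡ w))) (*-monoˡ-≤ w 1≤D))
    (m≤m^suc X e)

  block-≲ : ∀ F e → F * w ≲ F · X ^ suc e
  block-≲ F e = ≲-intro (*-monoʳ-≤ F (w≤X^ e))

  -- The 3 covers the 1 and the `w` in `suc w`, and the final test.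
  iterate-≲ : ∀ {t c} e M → t ≲ c · X ^ suc e → 1 ≤ M → M * (suc w + t) + 1 ≲ c + 3 · M * X ^ suc e
  iterate-≲ {t} {c} e M (≲-intro t≤) 1≤M = ≲-intro (begin
    M * (suc w + t) + 1                          ≤⟨ +-mono-≤ (*-monoʳ-≤ M (+-mono-≤ (+-mono-≤ (1≤X^ (suc e)) (w≤X^ e)) t≤))
                                                      (*-mono-≤ 1≤M (1≤X^ (suc e))) ⟩
    M * (x + x + c * x) + M * x                  ≡⟨ solve 3 (λ m c x → m :* (x :+ x :+ c :* x) :+ m :* x := (c :+ con 3) :* (m :* x)) refl M c x ⟩
    (c + 3) * (M * x)                            ∎)
    where
      open ≤-Reasoning
      open +-*-Solver
      x = X ^ suc e

  loop-≲ : ∀ {t c} e → t ≲ c · X ^ suc e → D * (suc w + t) + 1 ≲ c + 3 · X ^ suc (suc e)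
  loop-≲ e t≲ = ≲-raise (*-monoˡ-≤ (X ^ suc e) (≤-trans (≤-reflexive (sym (*-identityʳ D))) (*-monoʳ-≤ D 1≤w)))
    (iterate-≲ e D t≲ 1≤D)

cHalve : ℕ
cHalve = factor halving + 3

cLit cLits cClause cClauses cBlock cString : ℕ → ℕ → ℕ
cLit K i = factor (readLiteral i) + (cHalve + factor testLiteral)
cLits K i = cLit K i + 3
cClause K i = factor readClause + (cLits K i + factor (emitGadget K i))
cClauses K i = cClause K i + 3
cBlock K i = factor startBlock + ((factor (emitPad i) + 3) + (factor startGadgets + cClauses K i))
cString K i = factor startString + (cBlock K i + 3)

cStrings : ℕ → ℕ → ℕ → ℕ
cStrings K i zero    = 1
cStrings K i (suc c) = cString K i + cStrings K (suc i) c

cReduce : ℕ → ℕ → Reg → ℕ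
cReduce κ q R = factor (setup (2 + κ) q) + ((factor doubling + 3) + ((factor packing + 3) +
                (factor header + (cStrings (1 + κ) 0 (2 + κ) + factor (save (2 + κ) R)))))

module EmissionCost (K h m B N L : ℕ) (clauses : List (List ℕ))
                (|clauses| : length clauses ≡ m)
                (digits : All (λ c → All (_< B) (withLength c)) clauses)
                (w D : ℕ) (1≤D : 1 ≤ D) (1≤w : 1 ≤ w) (1≤N : 1 ≤ N) where

  open Emission K h m B N L clauses |clauses| digits w D hiding (1≤w)
  open LoopCost D w 1≤D 1≤w

  module _ (fits : Fits) where

    -- Halving within literals within clauses: three nested loops around straight-line code give the
    -- exponent 4.
    tClauses-≲ : ∀ i → tClauses fits i ≲ cClauses K i · X ^ 4
    tClauses-≲ i = loop-≲ 2 (≲-+ (block-≲ (factor readClause) 2) (≲-+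
      (loop-≲ 1 (≲-+ (block-≲ (factor (readLiteral i)) 1) (≲-+
        (loop-≲ 0 (block-≲ (factor halving) 0))
        (block-≲ (factor testLiteral) 1))))
      (block-≲ (factor (emitGadget K i)) 2)))

    tBlock-≲ : ∀ i → tBlock fits i ≲ cBlock K i · X ^ 4
    tBlock-≲ i = ≲-+ (block-≲ (factor startBlock) 3) (≲-+
      (≲-raise (X^-mono {2} {4} (s≤s (s≤s z≤n))) (loop-≲ 0 (block-≲ (factor (emitPad i)) 0)))
      (≲-+ (block-≲ (factor startGadgets) 3) (tClauses-≲ i)))

    tString-≲ : ∀ i → tString fits i ≲ cString K i · N * X ^ 4
    tString-≲ i = ≲-+ (≲-raise (m≤n*m (X ^ 4) N ⦃ >-nonZero 1≤N ⦄) (block-≲ (factor startString) 3))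
      (iterate-≲ 3 N (tBlock-≲ i) 1≤N)

    tStrings-≲ : ∀ i c → tStrings fits i c ≲ cStrings K i c · N * X ^ 4
    tStrings-≲ i zero    = ≲-intro (≤-trans (*-mono-≤ 1≤N (1≤X^ 4)) (≤-reflexive (sym (*-identityˡ (N * X ^ 4)))))
    tStrings-≲ i (suc c) = ≲-+ (tString-≲ i) (tStrings-≲ (suc i) c)

reduce-cost : ∀ {D w N ts cs} f₁ f₂ f₃ f₄ f₅ → 1 ≤ D → 1 ≤ w → 1 ≤ N → ts ≲ cs · N * (D * w) ^ 4 →
  f₁ * w + ((D * (suc w + f₂ * w) + 1) + ((D * (suc w + f₃ * w) + 1) + (f₄ * w + (ts + f₅ * w)))) ≲
  f₁ + ((f₂ + 3) + ((f₃ + 3) + (f₄ + (cs + f₅)))) · N * (D * w) ^ 4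
reduce-cost {D} {w} {N} f₁ f₂ f₃ f₄ f₅ 1≤D 1≤w 1≤N ts≲ =
  ≲-+ (blk f₁) (≲-+ (lp f₂) (≲-+ (lp f₃) (≲-+ (blk f₄) (≲-+ ts≲ (blk f₅)))))
  where
    open LoopCost D w 1≤D 1≤w
    N-≤ : ∀ x → x ≤ N * x
    N-≤ x = m≤n*m x N ⦃ >-nonZero 1≤N ⦄
    blk : ∀ f → f * w ≲ f · N * X ^ 4
    blk f = ≲-raise (N-≤ (X ^ 4)) (block-≲ f 3)
    lp : ∀ f → D * (suc w + f * w) + 1 ≲ f + 3 · N * X ^ 4
    lp f = ≲-raise (≤-trans (X^-mono {2} {4} (s≤s (s≤s z≤n))) (N-≤ (X ^ 4))) (loop-≲ 0 (block-≲ f 0))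

-- The denominator of the saving for SAT if that for Local-k-LCS is a / b.
exponent : ℕ → ℕ → ℕ
exponent b k = b * (2 * k)

-- Comparison of exponents

module Arithmetic (k b n N : ℕ) (2≤k : 2 ≤ k) (1≤b : 1 ≤ b) (N^k≤ : N ^ k ≤ 2 ^ (k + n)) (≤N^k : 2 ^ n ≤ N ^ k) where

  open ≤-Reasoning
  open +-*-Solver

  e : ℕ
  e = exponent b k

  N^e : ∀ x → x ^ e ≡ (x ^ k) ^ (2 * b)
  N^e x = trans (cong (x ^_) (solve 2 (λ b k → b :* (con 2 :* k) := k :* (con 2 :* b)) refl b k)) (sym (^-*-assoc x k (2 * b)))

  -- `N ^ e` is `(N ^ k) ^ (2 * b)`, about `2 ^ (2 b n)`. Compared with `e n = 2 b k n` this leaves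
  -- at least `2 n` as `k ≥ 2`: one `n` for the polynomial factors, one for the saving.
  reduce-bound : ∀ {u c P K} → u ≤ c * (N * P) → (2 * c * P) ^ e * 2 ^ (k * (2 * b)) ≤ K * 2 ^ n →
                 (2 * u) ^ e * 2 ^ n ≤ K * 2 ^ (e * n)
  reduce-bound {u} {c} {P} {K} u≤ K≤ = begin
    (2 * u) ^ e * 2 ^ n
      ≤⟨ *-monoˡ-≤ (2 ^ n) (^-monoˡ-≤ e (≤-trans (*-monoʳ-≤ 2 u≤) (≤-reflexive (solve 3 (λ c N P → con 2 :* (c :* (N :* P)) := con 2 :* c :* P :* N) refl c N P)))) ⟩
    (2 * c * P * N) ^ e * 2 ^ n
      ≡⟨ cong (_* 2 ^ n) (trans (^-distrib-* (2 * c * P) N e) (cong ((2 * c * P) ^ e *_) (N^e N))) ⟩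
    (2 * c * P) ^ e * (N ^ k) ^ (2 * b) * 2 ^ n
      ≤⟨ *-monoˡ-≤ (2 ^ n) (*-monoʳ-≤ ((2 * c * P) ^ e) (≤-trans (^-monoˡ-≤ (2 * b) N^k≤) (≤-reflexive split))) ⟩
    (2 * c * P) ^ e * (2 ^ (k * (2 * b)) * 2 ^ (n * (2 * b))) * 2 ^ n
      ≡⟨ solve 4 (λ x y z w → x :* (y :* z) :* w := x :* y :* (z :* w)) refl ((2 * c * P) ^ e) (2 ^ (k * (2 * b))) (2 ^ (n * (2 * b))) (2 ^ n) ⟩
    (2 * c * P) ^ e * 2 ^ (k * (2 * b)) * (2 ^ (n * (2 * b)) * 2 ^ n)
      ≤⟨ *-monoˡ-≤ (2 ^ (n * (2 * b)) * 2 ^ n) K≤ ⟩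
    K * 2 ^ n * (2 ^ (n * (2 * b)) * 2 ^ n)
      ≡⟨ trans (*-assoc K (2 ^ n) _) (cong (K *_) (trans (cong (2 ^ n *_) (sym (^-distribˡ-+-* 2 (n * (2 * b)) n))) (sym (^-distribˡ-+-* 2 n (n * (2 * b) + n))))) ⟩
    K * 2 ^ (n + (n * (2 * b) + n))
      ≤⟨ *-monoʳ-≤ K (2^-mono exponents) ⟩
    K * 2 ^ (e * n) ∎
    where
      split : (2 ^ (k + n)) ^ (2 * b) ≡ 2 ^ (k * (2 * b)) * 2 ^ (n * (2 * b))
      split = trans (^-*-assoc 2 (k + n) (2 * b)) (trans (cong (2 ^_) (*-distribʳ-+ (2 * b) k n)) (^-distribˡ-+-* 2 (k * (2 * b)) (n * (2 * b))))
      exponents : n + (n * (2 * b) + n) ≤ e * n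
      exponents = begin
        n + (n * (2 * b) + n)    ≡⟨ solve 2 (λ n b → n :+ (n :* (con 2 :* b) :+ n) := (con 2 :* con 1 :+ con 2 :* b) :* n) refl n b ⟩
        (2 * 1 + 2 * b) * n      ≤⟨ *-monoˡ-≤ n (+-monoˡ-≤ (2 * b) (*-monoʳ-≤ 2 1≤b)) ⟩
        (2 * b + 2 * b) * n      ≡⟨ cong (_* n) (solve 1 (λ b → con 2 :* b :+ con 2 :* b := b :* (con 2 :* con 2)) refl b) ⟩
        b * (2 * 2) * n          ≤⟨ *-monoˡ-≤ n (*-monoʳ-≤ b (*-monoʳ-≤ 2 2≤k)) ⟩
        e * n                    ∎

  -- With `S = N * Y`, raising the bound on `t` to the power `2 k` gives `t ^ e * S ^ (2 * k) ≤ C ^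
  -- e * S ^ (k * e)`. Since `S ^ (2 * k)` is at least `2 ^ n * 2 ^ n`, one factor `2 ^ n` absorbs
  -- the polynomial part and the other is the saving.
  oracle-bound : ∀ {t C a Y K} → 1 ≤ a → 1 ≤ N → 1 ≤ Y →
                 t ^ b * (N * Y) ^ a ≤ C ^ b * (N * Y) ^ (k * b) →
                 (2 * C) ^ e * (2 ^ (k * e) * Y ^ (k * e)) ≤ K * 2 ^ n →
                 (2 * t) ^ e * 2 ^ n ≤ K * 2 ^ (e * n)
  oracle-bound {t} {C} {suc a} {Y} {K} 1≤a 1≤N 1≤Y t≤ K≤ =
    *-cancelʳ-≤ ((2 * t) ^ e * 2 ^ n) (K * 2 ^ (e * n)) (2 ^ n) ⦃ m^n≢0 2 n ⦄ (begin
    (2 * t) ^ e * 2 ^ n * 2 ^ n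
      ≡⟨ trans (*-assoc ((2 * t) ^ e) _ _) (cong (_* (2 ^ n * 2 ^ n)) (^-distrib-* 2 t e)) ⟩
    2 ^ e * t ^ e * (2 ^ n * 2 ^ n)
      ≡⟨ *-assoc (2 ^ e) (t ^ e) _ ⟩
    2 ^ e * (t ^ e * (2 ^ n * 2 ^ n))
      ≤⟨ *-monoʳ-≤ (2 ^ e) raised ⟩
    2 ^ e * (C ^ e * (2 ^ ((k + n) * e) * Y ^ (k * e)))
      ≡⟨ cong (λ z → 2 ^ e * (C ^ e * (z * Y ^ (k * e)))) (trans (cong (2 ^_) (*-distribʳ-+ e k n)) (^-distribˡ-+-* 2 (k * e) (n * e))) ⟩
    2 ^ e * (C ^ e * (2 ^ (k * e) * 2 ^ (n * e) * Y ^ (k * e)))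
      ≡⟨ solve 5 (λ x c u v y → x :* (c :* (u :* v :* y)) := x :* c :* (u :* y) :* v) refl (2 ^ e) (C ^ e) (2 ^ (k * e)) (2 ^ (n * e)) (Y ^ (k * e)) ⟩
    2 ^ e * C ^ e * (2 ^ (k * e) * Y ^ (k * e)) * 2 ^ (n * e)
      ≡⟨ cong (λ z → z * (2 ^ (k * e) * Y ^ (k * e)) * 2 ^ (n * e)) (sym (^-distrib-* 2 C e)) ⟩
    (2 * C) ^ e * (2 ^ (k * e) * Y ^ (k * e)) * 2 ^ (n * e)
      ≤⟨ *-monoˡ-≤ (2 ^ (n * e)) K≤ ⟩
    K * 2 ^ n * 2 ^ (n * e)
      ≡⟨ cong (λ z → K * 2 ^ n * 2 ^ z) (*-comm n e) ⟩
    K * 2 ^ n * 2 ^ (e * n)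
      ≡⟨ solve 3 (λ K x y → K :* x :* y := K :* y :* x) refl K (2 ^ n) (2 ^ (e * n)) ⟩
    K * 2 ^ (e * n) * 2 ^ n ∎)
    where
      S = N * Y
      1≤S : 1 ≤ S
      1≤S = *-mono-≤ 1≤N 1≤Y
      instance
        S≢0 : NonZero S
        S≢0 = >-nonZero 1≤S
        Y≢0 : NonZero Y
        Y≢0 = >-nonZero 1≤Y
      -- The saving `a / b` is lowered to `1 / b`.
      t≤′ : t ^ b * S ≤ C ^ b * S ^ (k * b)
      t≤′ = ≤-trans (*-monoʳ-≤ (t ^ b) (m≤m^suc S a)) t≤
      2^n2^n≤ : 2 ^ n * 2 ^ n ≤ S ^ (2 * k)
      2^n2^n≤ = begin
        2 ^ n * 2 ^ n          ≤⟨ *-mono-≤ ≤N^k ≤N^k ⟩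
        N ^ k * N ^ k          ≡⟨ trans (sym (^-distribˡ-+-* N k k)) (cong (λ z → N ^ (k + z)) (sym (+-identityʳ k))) ⟩
        N ^ (2 * k)            ≤⟨ ^-monoˡ-≤ (2 * k) (m≤m*n N Y) ⟩
        S ^ (2 * k)            ∎
      raised : t ^ e * (2 ^ n * 2 ^ n) ≤ C ^ e * (2 ^ ((k + n) * e) * Y ^ (k * e))
      raised = begin
        t ^ e * (2 ^ n * 2 ^ n)             ≤⟨ *-monoʳ-≤ (t ^ e) 2^n2^n≤ ⟩
        t ^ e * S ^ (2 * k)                 ≡⟨ cong (_* S ^ (2 * k)) (sym (^-*-assoc t b (2 * k))) ⟩
        (t ^ b) ^ (2 * k) * S ^ (2 * k)     ≡⟨ sym (^-distrib-* (t ^ b) S (2 * k)) ⟩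
        (t ^ b * S) ^ (2 * k)               ≤⟨ ^-monoˡ-≤ (2 * k) t≤′ ⟩
        (C ^ b * S ^ (k * b)) ^ (2 * k)     ≡⟨ ^-distrib-* (C ^ b) (S ^ (k * b)) (2 * k) ⟩
        (C ^ b) ^ (2 * k) * (S ^ (k * b)) ^ (2 * k) ≡⟨ cong₂ _*_ (^-*-assoc C b (2 * k)) (trans (^-*-assoc S (k * b) (2 * k)) (cong (S ^_) (*-assoc k b (2 * k)))) ⟩
        C ^ e * S ^ (k * e)                 ≡⟨ cong (C ^ e *_) (^-distrib-* N Y (k * e)) ⟩
        C ^ e * (N ^ (k * e) * Y ^ (k * e)) ≤⟨ *-monoʳ-≤ (C ^ e) (*-monoˡ-≤ (Y ^ (k * e)) (≤-trans (≤-reflexive (sym (^-*-assoc N k e)))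
                                                 (≤-trans (^-monoˡ-≤ e N^k≤) (≤-reflexive (^-*-assoc 2 (k + n) e))))) ⟩
        C ^ e * (2 ^ ((k + n) * e) * Y ^ (k * e)) ∎

  total-bound : ∀ {t′ u t K₁ K₂} → t′ ≤ u + t → (2 * u) ^ e * 2 ^ n ≤ K₁ * 2 ^ (e * n) → (2 * t) ^ e * 2 ^ n ≤ K₂ * 2 ^ (e * n) →
                t′ ^ e * 2 ^ (1 * n) ≤ (K₁ + K₂) ^ e * 2 ^ (e * n)
  total-bound {t′} {u} {t} {K₁} {K₂} t′≤ u≤ t≤ = begin
    t′ ^ e * 2 ^ (1 * n)                       ≡⟨ cong (λ z → t′ ^ e * 2 ^ z) (*-identityˡ n) ⟩
    t′ ^ e * 2 ^ n                             ≤⟨ *-monoˡ-≤ (2 ^ n) (≤-trans (^-monoˡ-≤ e t′≤) (+-^-≤ u t e)) ⟩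
    ((2 * u) ^ e + (2 * t) ^ e) * 2 ^ n        ≡⟨ *-distribʳ-+ (2 ^ n) ((2 * u) ^ e) _ ⟩
    (2 * u) ^ e * 2 ^ n + (2 * t) ^ e * 2 ^ n  ≤⟨ +-mono-≤ u≤ t≤ ⟩
    K₁ * 2 ^ (e * n) + K₂ * 2 ^ (e * n)        ≡⟨ sym (*-distribʳ-+ (2 ^ (e * n)) K₁ K₂) ⟩
    (K₁ + K₂) * 2 ^ (e * n)                    ≤⟨ *-monoˡ-≤ (2 ^ (e * n)) (≤-trans (m≤m^suc (K₁ + K₂) (pred e)) (≤-reflexive (cong ((K₁ + K₂) ^_) (suc-pred e ⦃ e≢0 ⦄)))) ⟩
    (K₁ + K₂) ^ e * 2 ^ (e * n)                ∎
    where
      e≢0 : NonZero e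
      e≢0 = >-nonZero (*-mono-≤ 1≤b (*-mono-≤ {1} {2} (s≤s z≤n) (≤-trans (s≤s z≤n) 2≤k)))

-- One coefficient for each summand of `Run.D`, in the same order.
cD : ℕ → ℕ → ℕ
cD k q = 4 + (1 + (suc q + ((1 + 1 + suc q) + ((2 * k) + 1 + (1 + (k + 1))))))

dimension-≲ : ∀ {n m H k q M} → suc n ≤ M → m ≤ M → H ≤ suc n →
  4 + (n + (m * suc q + ((n + n + suc q) + (m * (2 * k) + 1 + (H + (k + m)))))) ≲ cD k q · M
dimension-≲ {n} {m} {H} {k} {q} {M} n≤ m≤ H≤ =
  ≲-+ (con 4) (≲-+ n≲ (≲-+ (times (suc q)) (≲-+ (≲-+ (≲-+ n≲ n≲) (con (suc q))) (≲-+ (≲-+ (times (2 * k)) (con 1)) (≲-+ (one (≤-trans H≤ n≤)) (≲-+ (con k) (one m≤)))))))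
  where
    one : ∀ {x} → x ≤ M → x ≲ 1 · M
    one x≤ = ≲-intro (≤-trans x≤ (≤-reflexive (sym (*-identityˡ M))))
    n≲ : n ≲ 1 · M
    n≲ = one (≤-trans (n≤1+n n) n≤)
    con : ∀ c → c ≲ c · M
    con c = ≲-intro (≤-trans (≤-reflexive (sym (*-identityʳ c))) (*-monoʳ-≤ c (≤-trans (s≤s z≤n) n≤)))
    times : ∀ c → m * c ≲ c · M
    times c = ≲-intro (≤-trans (*-monoˡ-≤ c m≤) (≤-reflexive (*-comm M c)))

-- By `length-clauses`, `D` is at most a constant times `2 ^ q * suc n ^ suc q`, so `poly≤exp`
-- bounds each fixed power of it.
D-poly : ∀ κ q R d → ∃[ K ] ((φ : CNF q) → Run.D κ q R (CNF.clauses φ) (CNF.width φ) ^ d ≤ K * 2 ^ CNF.n φ)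
D-poly κ q R d = c ^ d * ((2 ^ q) ^ d * K) , bound
  where
    k = 2 + κ
    c = cD k q
    K = proj₁ (poly≤exp (suc q * d))
    generic : ∀ {D n} → D ≤ c * (2 ^ q * suc n ^ suc q) → D ^ d ≤ c ^ d * ((2 ^ q) ^ d * K) * 2 ^ n
    generic {D} {n} D≤ = begin
      D ^ d                                               ≤⟨ ^-monoˡ-≤ d D≤ ⟩
      (c * (2 ^ q * suc n ^ suc q)) ^ d                   ≡⟨ trans (^-distrib-* c _ d) (cong (c ^ d *_) (^-distrib-* (2 ^ q) (suc n ^ suc q) d)) ⟩
      c ^ d * ((2 ^ q) ^ d * (suc n ^ suc q) ^ d)         ≡⟨ cong (λ z → c ^ d * ((2 ^ q) ^ d * z)) (^-*-assoc (suc n) (suc q) d) ⟩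
      c ^ d * ((2 ^ q) ^ d * suc n ^ (suc q * d))         ≤⟨ *-monoʳ-≤ (c ^ d) (*-monoʳ-≤ ((2 ^ q) ^ d) (proj₂ (poly≤exp (suc q * d)) n)) ⟩
      c ^ d * ((2 ^ q) ^ d * (K * 2 ^ n))                 ≡⟨ solve 4 (λ a b k x → a :* (b :* (k :* x)) := a :* (b :* k) :* x) refl (c ^ d) ((2 ^ q) ^ d) K (2 ^ n) ⟩
      c ^ d * ((2 ^ q) ^ d * K) * 2 ^ n                   ∎
      where
        open ≤-Reasoning
        open +-*-Solver
    bound : (φ : CNF q) → Run.D κ q R (CNF.clauses φ) (CNF.width φ) ^ d ≤ c ^ d * ((2 ^ q) ^ d * K) * 2 ^ CNF.n φ
    bound φ = generic (≲-elim (dimension-≲ n≤M m≤M (s≤s (m/n≤m n k))))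
      where
        open CNF φ
        M = 2 ^ q * suc n ^ suc q
        n≤M : suc n ≤ M
        n≤M = ≤-trans (m≤m^suc (suc n) q) (m≤n*m (suc n ^ suc q) (2 ^ q) ⦃ m^n≢0 2 q ⦄)
        m≤M : length clauses ≤ M
        m≤M = ≤-trans (length-clauses φ) (≤-trans (^-monoˡ-≤ q le) (≤-trans (≤-reflexive (^-distrib-* 2 (suc n) q))
               (*-monoʳ-≤ (2 ^ q) (m≤n*m (suc n ^ q) (suc n)))))
          where
            le : suc (n + n) ≤ 2 * suc n
            le = ≤-trans (n≤1+n _) (≤-reflexive (solve 1 (λ n → con 2 :+ (n :+ n) := con 2 :* (con 1 :+ n)) refl n))
              where open +-*-Solver

module Assembly (κ q : ℕ) (R : Reg) (19≤R : 19 ≤ R) {p : Program} (uses : Uses< R p) (C n₀ a b : ℕ) (1≤a : 1 ≤ a) (1≤b : 1 ≤ b) where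

  k = 2 + κ
  e = exponent b k

  K₁ K₂ c : ℕ
  -- The 15 pays for the final comparison. The 12 in `K₁` arises because `w = D * D`, so that
  -- `(D * w) ^ 4` is `D ^ 12`.
  c = cReduce κ q R + 15
  K₁ = (2 * c) ^ e * proj₁ (D-poly κ q R (12 * e)) * 2 ^ (k * (2 * b))
  K₂ = (2 * C) ^ e * (2 ^ (k * e) * (2 ^ (k * e) * proj₁ (D-poly κ q R (k * e))))

  module _ (φ : CNF q) where

    open CNF φ
    private module I = Run κ q R clauses width

    lcs : LocalLCSInstance k 5
    lcs = I.instanceLCS

    tReduce-≲ : I.tReduce ≲ cReduce κ q R · I.N * (I.D * I.w) ^ 4
    tReduce-≲ = reduce-cost (factor (setup k q)) (factor doubling) (factor packing) (factor header) (factor (save k R))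
      1≤D I.1≤w I.1≤N
      (EmissionCost.tStrings-≲ (1 + κ) I.H I.m I.B I.N I.L I.clauses I.|clauses| I.digits I.w I.D 1≤D I.1≤w I.1≤N I.fits 0 k)
      where
        1≤D : 1 ≤ I.D
        1≤D = ≤-trans (s≤s z≤n) I.4≤D

    overhead : ∀ {D w N r} → 1 ≤ D → 1 ≤ w → 1 ≤ N → r ≲ cReduce κ q R · N * (D * w) ^ 4 → r + 15 * w ≤ c * (N * (D * w) ^ 4)
    overhead {D} {w} {N} 1≤D 1≤w 1≤N r≲ = ≲-elim (≲-+ r≲ (≲-raise (m≤n*m _ N ⦃ >-nonZero 1≤N ⦄) (LoopCost.block-≲ D w 1≤D 1≤w 15 3)))

    N^k≤ : I.N ^ k ≤ 2 ^ (k + n)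
    N^k≤ = ≤-trans (≤-reflexive (^-*-assoc 2 I.H k)) (2^-mono (+-monoʳ-≤ k (m/n*n≤m n k)))

    ≤N^k : 2 ^ n ≤ I.N ^ k
    ≤N^k = ≤-trans (2^-mono (<⇒≤ (≤-trans I.n<kh (≤-reflexive (*-comm k I.H))))) (≤-reflexive (sym (^-*-assoc 2 I.H k)))

    open Arithmetic k b n I.N (s≤s (s≤s z≤n)) 1≤b N^k≤ ≤N^k using (reduce-bound; oracle-bound; total-bound)

    D-power : ∀ D → (D * (D * D)) ^ 4 ≡ D ^ 12
    D-power D = trans (cong (λ z → (D * (D * z)) ^ 4) (sym (*-identityʳ D))) (^-*-assoc D 3 4)

    K₁-≤ : ∀ {D w} → w ≡ D * D → D ^ (12 * e) ≤ proj₁ (D-poly κ q R (12 * e)) * 2 ^ n →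
           (2 * c * (D * w) ^ 4) ^ e * 2 ^ (k * (2 * b)) ≤ K₁ * 2 ^ n
    K₁-≤ {D} refl D≤ = begin
      (2 * c * (D * (D * D)) ^ 4) ^ e * z            ≡⟨ cong (_* z) (trans (^-distrib-* (2 * c) ((D * (D * D)) ^ 4) e)
                                                          (cong ((2 * c) ^ e *_) (trans (cong (_^ e) (D-power D)) (^-*-assoc D 12 e)))) ⟩
      (2 * c) ^ e * D ^ (12 * e) * z                 ≤⟨ *-monoˡ-≤ z (*-monoʳ-≤ ((2 * c) ^ e) D≤) ⟩
      (2 * c) ^ e * (K * 2 ^ n) * z                  ≡⟨ solve 4 (λ x k y z → x :* (k :* y) :* z := x :* k :* z :* y) refl ((2 * c) ^ e) K (2 ^ n) z ⟩
      K₁ * 2 ^ n                                     ∎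
      where
        open ≤-Reasoning
        open +-*-Solver
        z = 2 ^ (k * (2 * b))
        K = proj₁ (D-poly κ q R (12 * e))

    K₂-≤ : ∀ {D L} → suc L + L ≤ 2 * D → D ^ (k * e) ≤ proj₁ (D-poly κ q R (k * e)) * 2 ^ n →
           (2 * C) ^ e * (2 ^ (k * e) * (suc L + L) ^ (k * e)) ≤ K₂ * 2 ^ n
    K₂-≤ {D} {L} L≤ D≤ = begin
      x * (y * (suc L + L) ^ (k * e))     ≤⟨ *-monoʳ-≤ x (*-monoʳ-≤ y (≤-trans (^-monoˡ-≤ (k * e) L≤) (≤-reflexive (^-distrib-* 2 D (k * e))))) ⟩
      x * (y * (y * D ^ (k * e)))         ≤⟨ *-monoʳ-≤ x (*-monoʳ-≤ y (*-monoʳ-≤ y D≤)) ⟩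
      x * (y * (y * (K * 2 ^ n)))         ≡⟨ solve 4 (λ x y k z → x :* (y :* (y :* (k :* z))) := x :* (y :* (y :* k)) :* z) refl x y K (2 ^ n) ⟩
      K₂ * 2 ^ n                          ∎
      where
        open ≤-Reasoning
        open +-*-Solver
        x = (2 * C) ^ e
        y = 2 ^ (k * e)
        K = proj₁ (D-poly κ q R (k * e))

    time-≤ : ∀ {t t′} → t ^ b * I.size ^ a ≤ C ^ b * I.size ^ (k * b) → t′ ≤ I.tReduce + (t + 15 * I.w) →
             t′ ^ e * 2 ^ (1 * n) ≤ (K₁ + K₂) ^ e * 2 ^ (e * n)
    time-≤ {t} {t′} t≤ t′≤ = total-bound {t′} {I.tReduce + 15 * I.w} {t} {K₁} {K₂}
      (≤-trans t′≤ (≤-reflexive (trans (cong (I.tReduce +_) (+-comm t (15 * I.w))) (sym (+-assoc I.tReduce (15 * I.w) t)))))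
      (reduce-bound {I.tReduce + 15 * I.w} {c} {(I.D * I.w) ^ 4} {K₁}
        (overhead {I.D} {I.w} {I.N} (≤-trans (s≤s z≤n) I.4≤D) I.1≤w I.1≤N tReduce-≲)
        (K₁-≤ {I.D} {I.w} refl (proj₂ (D-poly κ q R (12 * e)) φ)))
      (oracle-bound {t} {C} {a} {suc I.L + I.L} {K₂} 1≤a I.1≤N (s≤s z≤n) t≤
        (K₂-≤ {I.D} {I.L} Y≤ (proj₂ (D-poly κ q R (k * e)) φ)))
      where
        Y≤ : suc I.L + I.L ≤ 2 * I.D
        Y≤ = +-mono-≤ (≤-trans (≤-reflexive (+-comm 1 I.L)) I.pl≤D)
               (≤-trans (≤-trans (m≤m+n I.L 1) I.pl≤D) (≤-reflexive (sym (+-identityʳ I.D))))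

    -- The time bound for `p` holds only from size `n₀` on. As a run has `L + 1` pads, blocks are
    -- nonempty even for a formula without clauses, so the strings have length at least `N`.
    size-≥ : k * n₀ ≤ n → n₀ ≤ I.size
    size-≥ le = begin
      n₀         ≤⟨ <⇒≤ (*-cancelˡ-< k n₀ I.H (≤-<-trans le I.n<kh)) ⟩
      I.H        ≤⟨ n≤2^n I.H ⟩
      I.N        ≤⟨ m≤m*n I.N (suc I.L + I.L) ⟩
      I.size     ∎
      where open ≤-Reasoning

    Result : Set
    Result = ∃[ s ] ∃[ t ] (solver κ q R p ∶ initial (Problem.encode (SAT q) φ) ⇓ s [ t ])
               × Problem.Answer (SAT q) φ (output s)
               × (k * n₀ ≤ n → t ^ e * 2 ^ (1 * n) ≤ (K₁ + K₂) ^ e * 2 ^ (e * n))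

    result : ∃[ s ] ∃[ t ] (p ∶ initial (Problem.encode (LocalLCS k 5) I.instanceLCS) ⇓ s [ t ])
               × Problem.Answer (LocalLCS k 5) I.instanceLCS (output s)
               × (n₀ ≤ I.size → t ^ b * I.size ^ a ≤ C ^ b * I.size ^ (k * b)) → Result
    result (s , t , d , ans , t≤) = finish (solver-run d ans)
      where
        open Correctness κ q R 19≤R uses φ
        finish : ∃[ s′ ] ∃[ t′ ] (solver κ q R p ∶ initial (Problem.encode (SAT q) φ) ⇓ s′ [ t′ ]) ×
                   output s′ ≡ 1 ∸ (I.threshold ∸ output s) × t′ ≤ I.tReduce + (t + 15 * I.w) → Result
        finish (s′ , t′ , d′ , out , t′≤) =
          s′ , t′ , d′ , subst (Problem.Answer (SAT q) φ) (sym out) (answer ans) , λ le → time-≤ {t} {t′} (t≤ (size-≥ le)) t′≤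

numerator≥1 : ∀ ε → 0ℚ <ℚ ε → 1 ≤ ℤ.∣ ↥ ε ∣
numerator≥1 ε 0<ε = n≢0⇒n>0 (λ z → <ℚ-irrefl (sym (↥p≡0⇒p≡0 ε (∣i∣≡0⇒i≡0 z))) 0<ε)

theorem7 : ∃[ c ] ((k : ℕ) (ε : ℚ) → 2 ≤ k → 0ℚ <ℚ ε →
    ((σ : ℕ) → σ ≤ c → LocalLCS k σ SolvableInO n^[ k - ε ]) →
    ¬ SETH)
theorem7 = 5 , contradict
  where
    contradict : (k : ℕ) (ε : ℚ) → 2 ≤ k → 0ℚ <ℚ ε →
      ((σ : ℕ) → σ ≤ 5 → LocalLCS k σ SolvableInO n^[ k - ε ]) → ¬ SETH
    contradict (suc (suc κ)) ε@(mkℚ _ b-1 _) (s≤s (s≤s _)) 0<ε hyp seth with hyp 5 ≤-refl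
    ... | p , C , n₀ , solves with uses-some p
    -- The rational `1 / e` for `e = exponent b k`. `mkℚ` takes the denominator minus one; here `e`
    -- reduces to a successor, so `pred` is undone by reduction.
    ...   | R₀ , uses with seth (mkℚ (ℤ.+ 1) (pred (exponent (suc b-1) (2 + κ))) (1-coprimeTo (exponent (suc b-1) (2 + κ)))) (positive⁻¹ _)
    ...     | q , _ , unsolvable = unsolvable
      ( solver κ q (19 + R₀) p , A.K₁ + A.K₂ , (2 + κ) * n₀
      , λ φ → A.result φ (solves (A.lcs φ)))
      where
        -- The register `19 + R₀` lies above the 19 registers of the reduction and above all those
        -- named in `p`.
        module A = Assembly κ q (19 + R₀) (m≤m+n 19 R₀) (uses-mono (m≤n+m R₀ 19) uses) C n₀ _ (suc b-1) (numerator≥1 ε 0<ε) (s≤s z≤n)
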